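{- Let $\Phi$, $\gamma$, $\prec$, $\Delta^m(\Phi)$ and $NC_{(m)}(\gamma)$ be as described in the context, with $m\ge 1$. A set $\sigma\subseteq\Phi^m_{\geq -1}$ is a face of the generalized cluster complex $\Delta^m(\Phi)$ if and only if the $m$-tuple $$\bigl(w_{\sigma_+}w_{\sigma^m},\ w_{\sigma^{m-1}},\ \ldots,\ w_{\sigma^2},\ w_{\sigma^1}w_{\sigma_- }\bigr)$$ is an element of $NC_{(m)}(\gamma)$ of rank $|\sigma|$ (for $m=1$ this tuple is the single element $w_{\sigma_+}w_{\sigma^1}w_{\sigma_- }$).
   Context: Let $\Phi$ be a finite irreducible root system of rank $n$ in $\mathbb{R}^n$ with positive system $\Phi^+$ and simple system $\Pi=\{\sigma_1,\dots,\sigma_n\}$, indexed so that $\Pi_+=\{\sigma_1,\dots,\sigma_r\}$ and $\Pi_-=\{\sigma_{r+1},\dots,\sigma_n\}$ each consist of pairwise orthogonal roots. Let $W$ be its reflection group, $R(\alpha)$ the reflection in the hyperplane orthogonal to $\alpha$, and $\gamma=R(\sigma_1)R(\sigma_2)\cdots R(\sigma_n)$ (bipartite Coxeter element). Let $h$ be the Coxeter number and $N=nh/2=|\Phi^+|$. Index simple roots cyclically mod $n$ and for $1\le i\le 2N$ put $\rho_i=R(\sigma_1)\cdots R(\sigma_{i-1})(\sigma_i)$, indices of $\rho$ taken mod $2N$ (so $\rho_{ -i}=\rho_{2N-i}$). Then $\{\rho_1,\dots,\rho_N\}=\Phi^+$, $\{\rho_{N+1},\dots,\rho_{N+r}\}=-\Pi_+$,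 $\{\rho_{ -n+r+1},\dots,\rho_0\}=-\Pi_-$, and the set $\Phi_{\ge-1}=\Phi^+\cup(-\Pi)$ of almost positive roots is totally ordered by $\rho_{ -n+r+1}\prec\cdots\prec\rho_0\prec\rho_1\prec\cdots\prec\rho_N\prec\rho_{N+1}\prec\cdots\prec\rho_{N+r}$. Cluster complexes: define $\mathcal R:\Phi_{\ge-1}\to\Phi_{\ge-1}$ by $\mathcal R(\alpha)=-\alpha$ if $\alpha\in\Pi_+\cup(-\Pi_-)$ and $\mathcal R(\alpha)=\gamma^{ -1}(\alpha)$ otherwise. Compatibility on $\Phi_{\ge-1}$ is the unique symmetric relation such that $\alpha,\beta$ are compatible iff $\mathcal R(\alpha),\mathcal R(\beta)$ are, and $-\sigma_i$ is compatible with $\beta\in\Phi^+$ iff the simple root expansion of $\beta$ does not involve $\sigma_i$. The degree $d(\alpha)$ is the least $d\ge 0$ with $\mathcal R^d(\alpha)\in-\Pi$. Fix an integer $m\ge1$. $\Phi^m_{\ge-1}$ consists of the colored positive roots $\alpha^k$ ($\alpha\in\Phi^+$, $k\in\{1,\dots,m\}$), forming $\Phi^m_{>0}$, together with one copy of each negative simple root, regarded as having color $1$. Two colored roots $\alpha^k,\beta^l$ are $m$-compatible iff one of: (a) $k>l$, $d(\alpha)\le d(\beta)$ and $\mathcal R(\alpha),\beta$ compatible; (b) $k<l$, $d(\alpha)\ge d(\beta)$ and $\alpha,\mathcal R(\beta)$ compatible; (c) $k>l$, $d(\alpha)>d(\beta)$ and $\alpha,\beta$ compatible; (d) $k<l$,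 $d(\alpha)<d(\beta)$ and $\alpha,\beta$ compatible; (e) $k=l$ and $\alpha,\beta$ compatible. $\Delta^m(\Phi)$ is the simplicial complex on $\Phi^m_{\ge-1}$ whose faces are the sets of pairwise $m$-compatible colored roots. Noncrossing partitions: $T$ is the set of reflections of $W$, $l_T(w)$ the least number of reflections whose product is $w$, and $u\le v$ iff $l_T(u)+l_T(u^{ -1}v)=l_T(v)$ (absolute order). $NC(\gamma)=\{w\in W:\mathbf 1\le w\le\gamma\}$. $NC_{(m)}(\gamma)$ is the set of $m$-tuples $(w_1,\dots,w_m)\in NC(\gamma)^m$ with $w_1\cdots w_m\le\gamma$ and $l_T(w_1\cdots w_m)=\sum_i l_T(w_i)$, ordered componentwise, with rank $\sum_i l_T(w_i)$. Notation: for a finite set $\tau$ of roots with elements $\alpha_1\prec\cdots\prec\alpha_k$, $w_\tau=R(\alpha_k)\cdots R(\alpha_1)$ (product in decreasing order), $w_\emptyset=\mathbf 1$. For $\sigma\subseteq\Phi^m_{\ge-1}$, $\sigma^i=\{\alpha\in\Phi^+:\alpha^i\in\sigma\}$ and $\sigma_\pm=\sigma\cap(-\Pi_\pm)$. -}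

module Defs where

open import Level using (0ℓ)
open import Algebra.Bundles using (CommutativeRing)
open import Relation.Binary.Core using (Rel)
open import Relation.Binary.Structures using (IsTotalOrder)
open import Relation.Nullary using (¬_)
open import Relation.Binary.PropositionalEquality using (_≡_)
open import Data.Bool using (Bool; true; false; if_then_else_)
open import Data.Nat as ℕ using (ℕ; zero; suc; NonZero; _∸_; _<ᵇ_; _≡ᵇ_)
open import Data.Nat.DivMod using (_%_; _/_; m%n<n)
open import Data.Fin using (Fin; zero; suc; toℕ; fromℕ<; opposite)
open import Data.List using (List; []; _∷_; _++_; map; reverse; applyUpTo; allFin)
open import Data.List.Membership.Propositional using (_∈_)
open import Data.List.Relation.Unary.AllPairs using (AllPairs)
open import Data.Product using (Σ; ∃; _×_; _,_)
open import Data.Sum using (_⊎_)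

-- Ordered fields (the scalars; ℝ is the intended instance)

record OrderedField : Set₁ where
  field
    commRing : CommutativeRing 0ℓ 0ℓ
  open CommutativeRing commRing public
    using (Carrier; _≈_; _+_; _*_; -_; 0#; 1#)
  field
    _⁻¹         : Carrier → Carrier
    ⁻¹-inverse  : ∀ x → ¬ (x ≈ 0#) → (x * (x ⁻¹)) ≈ 1#
    0≉1         : ¬ (0# ≈ 1#)
    _≤_         : Rel Carrier 0ℓ
    ≤-isTotalOrder : IsTotalOrder _≈_ _≤_
    +-mono-≤    : ∀ {x y} z → x ≤ y → (x + z) ≤ (y + z)
    *-nonneg    : ∀ {x y} → 0# ≤ x → 0# ≤ y → 0# ≤ (x * y)

module Vectors (F : OrderedField) (n : ℕ) where
  open OrderedField F using (Carrier; _≈_; _+_; _*_; -_; 0#; 1#; _⁻¹)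

  V : Set
  V = Fin n → Carrier

  _≈V_ : V → V → Set
  u ≈V v = ∀ i → u i ≈ v i

  0V : V
  0V _ = 0#

  _+V_ : V → V → V
  (u +V v) i = u i + v i

  negV : V → V
  negV u i = - (u i)

  _·V_ : Carrier → V → V
  (c ·V u) i = c * u i

  sumK : ∀ {k} → (Fin k → Carrier) → Carrier
  sumK {zero}  f = 0#
  sumK {suc k} f = f zero + sumK (λ i → f (suc i))

  sumV : ∀ {k} → (Fin k → V) → V
  sumV {zero}  f = 0V
  sumV {suc k} f = f zero +V sumV (λ i → f (suc i))

  _∙_ : V → V → Carrier
  u ∙ v = sumK (λ i → u i * v i)

  two : Carrier
  two = 1# + 1#

  Refl : V → V → V
  Refl a v = v +V negV (((two * (v ∙ a)) * ((a ∙ a) ⁻¹)) ·V a)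

  actV : List V → V → V
  actV []      v = v
  actV (a ∷ w) v = Refl a (actV w v)

-- A finite irreducible root system of rank n in K^n, with a simple
-- system Π = {σ_1,…,σ_n} (0-based: σ 0,…,σ (n-1)) indexed bipartitely:
-- Π₊ = {σ_i : i < r}, Π₋ = {σ_i : r ≤ i}, each pairwise orthogonal.

record BipRootSystem (F : OrderedField) (n : ℕ) : Set where
  open OrderedField F using (Carrier; _≈_; _+_; _*_; -_; 0#; 1#; _≤_)
  open Vectors F n
  field
    nz       : NonZero n
    M        : ℕ
    Φ        : Fin M → V
    Φ-inj    : ∀ j k → Φ j ≈V Φ k → j ≡ k
    nonzero  : ∀ j → ¬ (Φ j ≈V 0V)
    spans    : ∀ (v : V) → ∃ λ (c : Fin M → Carrier) → v ≈V sumV (λ j → c j ·V Φ j)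
    reduced  : ∀ j k (c : Carrier) → Φ k ≈V (c ·V Φ j) → (c ≈ 1#) ⊎ (c ≈ - 1#)
    refl-closed : ∀ j k → ∃ λ l → Refl (Φ j) (Φ k) ≈V Φ l
    irreducible : ∀ (P : Fin M → Bool) →
                  (∀ j k → P j ≡ true → P k ≡ false → (Φ j ∙ Φ k) ≈ 0#) →
                  (∀ j → P j ≡ true) ⊎ (∀ j → P j ≡ false)
    simp     : Fin n → Fin M
    simp-indep : ∀ (c : Fin n → Carrier) →
                 sumV (λ i → c i ·V Φ (simp i)) ≈V 0V → ∀ i → c i ≈ 0#
    simp-sign  : ∀ j → ∃ λ (c : Fin n → Carrier) →
                 (Φ j ≈V sumV (λ i → c i ·V Φ (simp i))) ×
                 ((∀ i → 0# ≤ c i) ⊎ (∀ i → c i ≤ 0#))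
    r        : ℕ
    r≤n      : r ℕ.≤ n
    orth₊    : ∀ i i' → toℕ i ℕ.< r → toℕ i' ℕ.< r → ¬ (i ≡ i') →
               (Φ (simp i) ∙ Φ (simp i')) ≈ 0#
    orth₋    : ∀ i i' → r ℕ.≤ toℕ i → r ℕ.≤ toℕ i' → ¬ (i ≡ i') →
               (Φ (simp i) ∙ Φ (simp i')) ≈ 0#

module WithRS (F : OrderedField) (n : ℕ) (D : BipRootSystem F n) where
  open OrderedField F using (Carrier; _≈_; _+_; _*_; -_; 0#; 1#; _≤_)
  open Vectors F n public
  open BipRootSystem D public

  instance
    nzI : NonZero n
    nzI = nz

  σ : Fin n → V
  σ i = Φ (simp i)

  linΠ : (Fin n → Carrier) → V
  linΠ c = sumV (λ i → c i ·V σ i)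

  IsPos : V → Set
  IsPos v = ∃ λ c → (v ≈V linΠ c) × (∀ i → 0# ≤ c i)

  NegSimple : V → Set
  NegSimple v = ∃ λ i → v ≈V negV (σ i)

  InΠ₊ : V → Set
  InΠ₊ v = ∃ λ i → (toℕ i ℕ.< r) × (v ≈V σ i)

  InNegΠ₊ : V → Set
  InNegΠ₊ v = ∃ λ i → (toℕ i ℕ.< r) × (v ≈V negV (σ i))

  InNegΠ₋ : V → Set
  InNegΠ₋ v = ∃ λ i → (r ℕ.≤ toℕ i) × (v ≈V negV (σ i))

  -- the bipartite Coxeter element γ = R(σ_1)⋯R(σ_n), as a list of simple roots
  γV : List V
  γV = map σ (allFin n)

  -- N = |Φ⁺| = |Φ|/2
  N : ℕ
  N = M / 2

  σc : ℕ → V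
  σc k = σ (fromℕ< (m%n<n k n))

  -- ρ₁ (suc i) = ρ_{i+1} = R(σ_1)⋯R(σ_i)(σ_{i+1})   (1-based index; ρ₁ 0 unused)
  ρ₁ : ℕ → V
  ρ₁ zero    = 0V
  ρ₁ (suc i) = actV (applyUpTo σc i) (σc i)

  -- the almost positive roots in ≺-order:
  -- position p ↦ ρ_{-n+r+1+p} for p < n-r, and ρ_{1+(p-(n-r))} afterwards
  Lρ : ℕ → V
  Lρ p = if p <ᵇ (n ∸ r)
           then ρ₁ ((2 ℕ.* N) ∸ (n ∸ r) ℕ.+ 1 ℕ.+ p)
           else ρ₁ (1 ℕ.+ (p ∸ (n ∸ r)))

  _≺_ : V → V → Set
  α ≺ β = ∃ λ p → ∃ λ q → (p ℕ.< q) × (q ℕ.< N ℕ.+ n) × (Lρ p ≈V α) × (Lρ q ≈V β)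

  Flip : V → Set
  Flip v = InΠ₊ v ⊎ InNegΠ₋ v

  𝓡Rel : V → V → Set
  𝓡Rel v u = (Flip v × (u ≈V negV v)) ⊎ ((¬ Flip v) × (u ≈V actV (reverse γV) v))

  𝓡Iter : ℕ → V → V → Set
  𝓡Iter zero    v u = u ≈V v
  𝓡Iter (suc k) v u = ∃ λ w → 𝓡Rel v w × 𝓡Iter k w u

  -- compatibility on Φ_{≥-1} (Fomin–Zelevinsky): transport by 𝓡^k until
  -- α becomes some -σ_i; then β is compatible iff 𝓡^k(β) is a negative
  -- simple root or a positive root whose expansion does not involve σ_i
  Compat : V → V → Set
  Compat α β = ∃ λ k → ∃ λ u → ∃ λ u' → 𝓡Iter k α u × 𝓡Iter k β u' ×
               ∃ λ i → (u ≈V negV (σ i)) ×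
               (NegSimple u' ⊎ (IsPos u' × ∃ λ c → (u' ≈V linΠ c) × (c i ≈ 0#)))

  Deg : V → ℕ → Set
  Deg v d = (∃ λ u → 𝓡Iter d v u × NegSimple u) ×
            (∀ d' → d' ℕ.< d → ∀ u → 𝓡Iter d' v u → ¬ NegSimple u)

  module Colored (m : ℕ) where
    -- colors k ∈ Fin m stand for k+1 ∈ {1,…,m}
    MCompat : V → Fin m → V → Fin m → Set
    MCompat α k β l =
        ((toℕ l ℕ.< toℕ k) × ∃ λ dα → ∃ λ dβ → Deg α dα × Deg β dβ × (dα ℕ.≤ dβ) ×
            ∃ λ u → 𝓡Rel α u × Compat u β)
      ⊎ ((toℕ k ℕ.< toℕ l) × ∃ λ dα → ∃ λ dβ → Deg α dα × Deg β dβ × (dβ ℕ.≤ dα) ×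
            ∃ λ u → 𝓡Rel β u × Compat α u)
      ⊎ ((toℕ l ℕ.< toℕ k) × ∃ λ dα → ∃ λ dβ → Deg α dα × Deg β dβ × (dβ ℕ.< dα) ×
            Compat α β)
      ⊎ ((toℕ k ℕ.< toℕ l) × ∃ λ dα → ∃ λ dβ → Deg α dα × Deg β dβ × (dα ℕ.< dβ) ×
            Compat α β)
      ⊎ ((k ≡ l) × Compat α β)

    -- a subset of Fin M × Fin m; (j , k) stands for the colored root (Φ j)^(k+1)
    CSubset : Set
    CSubset = Fin M → Fin m → Bool

    ValidCol : Fin M → Fin m → Set
    ValidCol j k = IsPos (Φ j) ⊎ (NegSimple (Φ j) × (toℕ k ≡ 0))

    InΦm : CSubset → Set
    InΦm σs = ∀ j k → σs j k ≡ true → ValidCol j k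

    Face : CSubset → Set
    Face σs = ∀ j k j' k' → σs j k ≡ true → σs j' k' ≡ true →
              ¬ ((j ≡ j') × (k ≡ k')) → MCompat (Φ j) k (Φ j') k'

    sumℕ : ∀ {t} → (Fin t → ℕ) → ℕ
    sumℕ {zero}  f = 0
    sumℕ {suc t} f = f zero ℕ.+ sumℕ (λ i → f (suc i))

    card : CSubset → ℕ
    card σs = sumℕ (λ j → sumℕ (λ k → if σs j k then 1 else 0))

    colorPart : CSubset → Fin m → Fin M → Set
    colorPart σs k j = (σs j k ≡ true) × IsPos (Φ j)

    plusPart : CSubset → Fin M → Set
    plusPart σs j = (∃ λ k → σs j k ≡ true) × InNegΠ₊ (Φ j)

    minusPart : CSubset → Fin M → Set
    minusPart σs j = (∃ λ k → σs j k ≡ true) × InNegΠ₋ (Φ j)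

  -- the reflection group, as words of reflections R(Φ j)

  Word : Set
  Word = List (Fin M)

  act : Word → V → V
  act w = actV (map Φ w)

  _≈W_ : Word → Word → Set
  u ≈W v = ∀ x → act u x ≈V act v x

  -- w_τ = R(α_k)⋯R(α_1) for τ = {α_1 ≺ ⋯ ≺ α_k}: IsWτ τ w says the word w
  -- lists exactly the elements of τ in ≺-decreasing order
  IsWτ : (Fin M → Set) → Word → Set
  IsWτ τ w = AllPairs (λ a b → Φ b ≺ Φ a) w × (∀ j → (τ j → j ∈ w) × (j ∈ w → τ j))

  HasLT : Word → ℕ → Set
  HasLT w k = (∃ λ t → (Data.List.length t ≡ k) × (t ≈W w)) ×
              (∀ t → t ≈W w → k ℕ.≤ Data.List.length t)

  AbsLe : Word → Word → Set
  AbsLe u v = ∃ λ a → ∃ λ b → ∃ λ c → HasLT u a × HasLT (reverse u ++ v) b × HasLT v c ×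
              (a ℕ.+ b ≡ c)

  γW : Word
  γW = map simp (allFin n)

  InNC : Word → Set
  InNC w = AbsLe [] w × AbsLe w γW

  prodW : ∀ {t} → (Fin t → Word) → Word
  prodW {zero}  f = []
  prodW {suc t} f = f zero ++ prodW (λ i → f (suc i))

  module ColoredNC (m : ℕ) where
    open Colored m

    InNCmRank : (Fin m → Word) → ℕ → Set
    InNCmRank ws k = (∀ p → InNC (ws p)) × AbsLe (prodW ws) γW ×
                     ∃ λ (ℓ : Fin m → ℕ) → (∀ p → HasLT (ws p) (ℓ p)) ×
                       HasLT (prodW ws) (sumℕ ℓ) × (sumℕ ℓ ≡ k)

    -- the tuple (w_{σ₊} w_{σ^m}, w_{σ^{m-1}}, …, w_{σ^2}, w_{σ^1} w_{σ₋});
    -- wc k is w_{σ^(k+1)}; position p carries color m-p (1-based)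
    tuple : Word → Word → (Fin m → Word) → Fin m → Word
    tuple wP wM wc p = (if toℕ p ≡ᵇ 0 then wP else []) ++ wc (opposite p) ++
                       (if suc (toℕ p) ≡ᵇ m then wM else [])

{-# OPTIONS --safe #-}
-- Let χ(x, y) = (1 − γ)⁻¹x ∙ y. Then χ(x, y) + χ(y, x) = x ∙ y and χ(x, y) = − χ(y, γ⁻¹x). For roots β₁, …, β_k
-- the product R(β₁)⋯R(β_k) has length k and lies below γ exactly when χ(β_i, β_j) = 0 for all i < j, and every such
-- sequence extends to a factorization of γ into n reflections (by Carter's argument there is always one more root
-- orthogonal to the vectors (1 − γ)⁻¹β_i). Hence the condition on the tuple is a condition on pairs of roots.
--
-- So is being a face, and the two conditions agree pair by pair: for α ≺ β compatibility means χ(β, α) = 0. When one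
-- of the roots is −σ_i, the form χ reads off a coefficient at σ_i; and 𝓡 is γ⁻¹ or −1, so the duality above makes
-- the condition invariant under 𝓡. The same duality absorbs the extra 𝓡 in cases (a) and (b) of m-compatibility.
--
-- The order ≺ is controlled without eigenvectors: each γ-orbit enters Φ⁺ at one of ρ_1, …, ρ_n and leaves it at one of
-- −ρ_1, …, −ρ_n. At the exit χ changes sign, which bounds the exit times of adjacent vertices against each other;
-- irreducibility then makes the exit times constant on Π₊ and on Π₋.
--
-- Equality in the field need not be decidable, so linear algebra is done up to double negation; what is needed
-- constructively about roots is decided by the permutation action on their indices.

module Submission where

open import Level using (0ℓ)
open import Algebra.Bundles using (CommutativeRing; RawRing)
open import Algebra.Structures using (IsCommutativeRing)
import Algebra.Solver.Ring
import Algebra.Properties.Ring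
import Algebra.Properties.Semiring.Mult
open import Algebra.Solver.Ring.AlmostCommutativeRing using (fromCommutativeRing; _-Raw-AlmostCommutative⟶_)
open import Data.Nat as ℕ using (ℕ; zero; suc; _≤_)
import Data.Nat.Properties as ℕₚ
open import Data.Product using (∃; _×_; _,_; proj₁; proj₂)
open import Data.Maybe using (Maybe; just; nothing)
open import Data.Fin as Fin using (Fin; zero; suc; toℕ; fromℕ<)
open import Data.List using (List; []; _∷_; _++_; map; reverse; length; filter; allFin; tabulate; lookup; applyUpTo)
open import Data.List.Relation.Unary.All as All using (All; []; _∷_)
open import Data.List.Relation.Unary.AllPairs as AllPairs using (AllPairs; []; _∷_)
import Data.List.Properties as Listₚ
open import Relation.Nullary using (¬_; yes; no; Dec)
open import Relation.Binary.Core using (Rel)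
open import Relation.Binary.PropositionalEquality as ≡ using (_≡_; refl; sym; trans; cong; cong₂; subst; subst₂)
import Relation.Binary.Reasoning.Setoid
open import Function using (_∘_; id)
open import Defs
open import Data.Bool as Bool using (Bool; true; false; not; if_then_else_; _∧_)
open import Data.Sum using (_⊎_; inj₁; inj₂; [_,_]′)
open import Data.Empty using (⊥; ⊥-elim)
import Data.List.Relation.Unary.All.Properties as Allₚ
open import Relation.Binary.Structures using (IsTotalOrder)
import Data.Fin.Properties as Finₚ
open import Data.List.Membership.Propositional using (_∈_; lose)
import Data.List.Membership.Propositional.Properties as ∈ₚ
open import Relation.Nullary.Decidable using (decidable-stable; ¬?; _×-dec_; map′; does; dec-true; dec-false; _⊎-dec_)
open import Data.Bool.Properties using (∧-conicalˡ; ∧-conicalʳ; ∧-identityʳ; ∧-zeroʳ; not-injective; ¬-not; T-≡; not-¬)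
open import Data.Nat.Induction using (<-wellFounded)
open import Induction.WellFounded using (Acc; acc)
open import Data.Unit using (⊤; tt)
open import Data.List.Relation.Unary.Any using (here; there)
open import Data.List.Relation.Unary.Unique.Propositional using (Unique)
import Data.List.Relation.Unary.Unique.Propositional.Properties as Uniqueₚ
import Data.List.Relation.Unary.AllPairs.Properties as AllPairsₚ
import Data.List.Relation.Unary.Any.Properties as Anyₚ
open import Data.Nat.DivMod using (_%_; _/_; m%n<n; m<n⇒m%n≡m; [m+n]%n≡m%n; %-distribˡ-+; m≤n⇒[n∸m]%m≡n%m; m≡m%n+[m/n]*n; m*n/n≡m)
open import Data.Product.Properties using (≡-dec)
open import Relation.Binary.Definitions using (Tri; tri<; tri≈; tri>)
open import Function.Bundles using (Equivalence; _⇔_; mk⇔)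

-- χ plays the part of the Euler form of a quiver, and sequences with χ(β_i, β_j) = 0 for i < j that
-- of exceptional sequences; the rule χ(x, y) = -χ(y, γ⁻¹x) is Serre duality. Two obstacles shape
-- the proof. First, ≺ is indexed through N = |Φ|/2 and indices mod 2N, so ρ_1, ..., ρ_N must be
-- identified with Φ⁺ beforehand. The exit permutation i ↦ i* is never computed: only its effect on
-- the two sides Π₊, Π₋ matters, since the roots inside -Π₋, and those inside -Π₊, are orthogonal
-- and may be taken in any order; the key of `Cls` forgets that order. Second, 𝓡 mixes γ⁻¹ and -1.
-- When it acts on two roots by the same map their order is kept; when it acts by different maps the
-- order is reversed, and this is exactly where duality exchanges the arguments of χ. Colours then
-- remove ≺: for positive roots of different colours, m-compatibility is χ(α, β) = 0 with α of the
-- larger colour. Two facts are needed in the field's own equality, orthogonality for `irreducible`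
-- and a zero coefficient for `Compat`; both are recovered from the action on indices.

-- The ring solver with formal differences of naturals as coefficients.
module RingSolver (R : CommutativeRing 0ℓ 0ℓ) where
  open CommutativeRing R renaming (refl to ≈refl; sym to ≈sym; trans to ≈trans)
  open Algebra.Properties.Semiring.Mult semiring using () renaming (_×_ to _⊠_)
  open Algebra.Properties.Semiring.Mult semiring using (×-homo-+; ×1-homo-*; ×-cong; ×-congˡ)
  open Algebra.Properties.Ring ring
  open Relation.Binary.Reasoning.Setoid setoid
  private
    -- Cancelling the common part keeps one component zero, so that 0 and 1 always reach the special
    -- cases of `⟦⟧`.
    norm : ℕ → ℕ → ℕ × ℕ
    norm (suc a) (suc b) = norm a b
    norm a b = a , b
    Coeff : RawRing 0ℓ 0ℓ
    Coeff = record
      { Carrier = ℕ × ℕ ; _≈_ = _≡_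
      ; _+_ = λ (a , b) (c , d) → norm (a ℕ.+ c) (b ℕ.+ d)
      ; _*_ = λ (a , b) (c , d) → norm (a ℕ.* c ℕ.+ b ℕ.* d) (a ℕ.* d ℕ.+ b ℕ.* c)
      ; -_ = λ (a , b) → (b , a)
      ; 0# = (0 , 0) ; 1# = (1 , 0) }
    ι : ℕ → Carrier
    ι k = k ⊠ 1#
    exch : ∀ a b c d → (a + b) + (c + d) ≈ (a + c) + (b + d)
    exch a b c d = begin
      (a + b) + (c + d) ≈⟨ +-assoc a b _ ⟩
      a + (b + (c + d)) ≈⟨ +-congˡ (≈sym (+-assoc b c d)) ⟩
      a + ((b + c) + d) ≈⟨ +-congˡ (+-congʳ (+-comm b c)) ⟩
      a + ((c + b) + d) ≈⟨ +-congˡ (+-assoc c b d) ⟩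
      a + (c + (b + d)) ≈⟨ ≈sym (+-assoc a c _) ⟩
      (a + c) + (b + d) ∎
    -- Special-cased so that the literals :0 and :1 denote 0# and 1# definitionally.
    ⟦⟧ : ℕ × ℕ → Carrier
    ⟦⟧ (0 , 0) = 0#
    ⟦⟧ (1 , 0) = 1#
    ⟦⟧ (a , b) = ι a + (- ι b)
    ⟦⟧-def : ∀ a b → ⟦⟧ (a , b) ≈ ι a + (- ι b)
    ⟦⟧-def 0 0 = ≈sym (-‿inverseʳ 0#)
    ⟦⟧-def 1 0 = ≈sym (≈trans (+-congˡ -0#≈0#) (≈trans (+-identityʳ _) (+-identityʳ 1#)))
    ⟦⟧-def 0 (suc b) = ≈refl
    ⟦⟧-def 1 (suc b) = ≈refl
    ⟦⟧-def (suc (suc a)) b = ≈refl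
    norm-def : ∀ a b → ⟦⟧ (norm a b) ≈ ι a + (- ι b)
    norm-def 0 b = ⟦⟧-def 0 b
    norm-def (suc a) 0 = ⟦⟧-def (suc a) 0
    norm-def (suc a) (suc b) = ≈trans (norm-def a b) (≈sym (begin
      (1# + ι a) + (- (1# + ι b)) ≈⟨ +-congˡ (≈sym (-‿+-comm 1# (ι b))) ⟩
      (1# + ι a) + ((- 1#) + (- ι b)) ≈⟨ exch _ _ _ _ ⟩
      (1# + (- 1#)) + (ι a + (- ι b)) ≈⟨ +-congʳ (-‿inverseʳ 1#) ⟩
      0# + (ι a + (- ι b)) ≈⟨ +-identityˡ _ ⟩
      ι a + (- ι b) ∎))
    neg-+ : ∀ x y → - (x + y) ≈ (- x) + (- y)
    neg-+ x y = ≈sym (-‿+-comm x y)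
    mul : ∀ a b c d → (a * c + b * d) + (- (a * d + b * c)) ≈ (a + (- b)) * (c + (- d))
    mul a b c d = begin
      (a * c + b * d) + (- (a * d + b * c)) ≈⟨ +-congˡ (neg-+ _ _) ⟩
      (a * c + b * d) + ((- (a * d)) + (- (b * c))) ≈⟨ exch _ _ _ _ ⟩
      (a * c + (- (a * d))) + (b * d + (- (b * c))) ≈⟨ +-cong (+-congˡ (-‿distribʳ-* a d)) (+-comm _ _) ⟩
      (a * c + (a * (- d))) + ((- (b * c)) + b * d)
        ≈⟨ +-cong (≈sym (distribˡ a c (- d))) (+-cong (-‿distribˡ-* b c) (≈sym (≈trans (≈sym (-‿distribʳ-* (- b) d)) (≈trans (-‿cong (≈sym (-‿distribˡ-* b d))) (-‿involutive _))))) ⟩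
      a * (c + (- d)) + ((- b) * c + (- b) * (- d)) ≈⟨ +-congˡ (≈sym (distribˡ (- b) c (- d))) ⟩
      a * (c + (- d)) + (- b) * (c + (- d)) ≈⟨ ≈sym (distribʳ _ a (- b)) ⟩
      (a + (- b)) * (c + (- d)) ∎
    ι-+* : ∀ a b c d → ι (a ℕ.* c ℕ.+ b ℕ.* d) ≈ ι a * ι c + ι b * ι d
    ι-+* a b c d = ≈trans (×-homo-+ 1# (a ℕ.* c) (b ℕ.* d)) (+-cong (×1-homo-* a c) (×1-homo-* b d))
    hom : Coeff -Raw-AlmostCommutative⟶ fromCommutativeRing R
    hom = record
      { ⟦_⟧ = ⟦⟧
      ; +-homo = λ (a , b) (c , d) → ≈trans (norm-def (a ℕ.+ c) (b ℕ.+ d)) (≈trans (+-cong (×-homo-+ 1# a c) (≈trans (-‿cong (×-homo-+ 1# b d)) (neg-+ _ _)))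
          (≈trans (exch _ _ _ _) (≈sym (+-cong (⟦⟧-def a b) (⟦⟧-def c d)))))
      ; *-homo = λ (a , b) (c , d) → ≈trans (norm-def (a ℕ.* c ℕ.+ b ℕ.* d) (a ℕ.* d ℕ.+ b ℕ.* c)) (≈trans (+-cong (ι-+* a b c d) (-‿cong (ι-+* a b d c)))
          (≈trans (mul (ι a) (ι b) (ι c) (ι d)) (≈sym (*-cong (⟦⟧-def a b) (⟦⟧-def c d)))))
      ; -‿homo = λ (a , b) → ≈trans (⟦⟧-def b a) (≈sym (≈trans (-‿cong (⟦⟧-def a b)) (≈trans (neg-+ (ι a) (- ι b)) (≈trans (+-comm _ _) (+-congʳ (-‿involutive _))))))
      ; 0-homo = ≈refl
      ; 1-homo = ≈refl }
    dec : (x y : ℕ × ℕ) → Maybe (⟦⟧ x ≈ ⟦⟧ y)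
    dec (a , b) (c , d) with a ℕ.+ d ℕ.≟ c ℕ.+ b
    ... | no _ = nothing
    ... | yes e = just (begin
      ⟦⟧ (a , b) ≈⟨ ⟦⟧-def a b ⟩
      ι a + (- ι b) ≈⟨ ≈sym (+-identityʳ _) ⟩
      (ι a + (- ι b)) + 0# ≈⟨ +-congˡ (≈sym (-‿inverseʳ (ι d))) ⟩
      (ι a + (- ι b)) + (ι d + (- ι d)) ≈⟨ exch _ _ _ _ ⟩
      (ι a + ι d) + ((- ι b) + (- ι d)) ≈⟨ +-congʳ (≈trans (≈sym (×-homo-+ 1# a d)) (≈trans (×-congˡ {1#} e) (×-homo-+ 1# c b))) ⟩
      (ι c + ι b) + ((- ι b) + (- ι d)) ≈⟨ +-congˡ (+-comm _ _) ⟩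
      (ι c + ι b) + ((- ι d) + (- ι b)) ≈⟨ exch _ _ _ _ ⟩
      (ι c + (- ι d)) + (ι b + (- ι b)) ≈⟨ +-congˡ (-‿inverseʳ (ι b)) ⟩
      (ι c + (- ι d)) + 0# ≈⟨ +-identityʳ _ ⟩
      ι c + (- ι d) ≈⟨ ≈sym (⟦⟧-def c d) ⟩
      ⟦⟧ (c , d) ∎)
  open Algebra.Solver.Ring Coeff (fromCommutativeRing R) hom dec public
    using (solve; _:=_; _:+_; _:*_; :-_; con; var; Polynomial)
  :0 :1 : ∀ {m} → Polynomial m
  :0 = con (0 , 0)
  :1 = con (1 , 0)

-- Vectors, inner product and reflections over an abstract equality of scalars.

-- _~₀_ is instantiated both with _≈_ and with its double negation.
module VecAlg (F : OrderedField) (n : ℕ) (_~₀_ : Rel (OrderedField.Carrier F) 0ℓ)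
    (isCR : IsCommutativeRing _~₀_ (OrderedField._+_ F) (OrderedField._*_ F) (OrderedField.-_ F) (OrderedField.0# F) (OrderedField.1# F))
    (inv : ∀ x → ¬ (x ~₀ OrderedField.0# F) → OrderedField._*_ F x (OrderedField._⁻¹ F x) ~₀ OrderedField.1# F) where
  open OrderedField F using (_⁻¹)
  open Vectors F n using (V; 0V; _+V_; negV; _·V_; sumK; sumV; two; Refl; actV) renaming (_∙_ to infix 8 _∙_)
  R : CommutativeRing 0ℓ 0ℓ
  R = record { isCommutativeRing = isCR }
  open CommutativeRing R hiding (zero) renaming (_≈_ to infix 4 _~_; refl to ~refl; sym to ~sym; trans to ~trans; reflexive to ~reflexive)
  open RingSolver R public using (solve; _:=_; _:+_; _:*_; :-_; :0; :1; Polynomial)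
  open Relation.Binary.Reasoning.Setoid setoid

  _~V_ : V → V → Set
  u ~V v = ∀ i → u i ~ v i

  ~Vrefl : ∀ {u} → u ~V u
  ~Vrefl i = ~refl
  ~Vsym : ∀ {u v} → u ~V v → v ~V u
  ~Vsym e i = ~sym (e i)
  ~Vtrans : ∀ {u v w} → u ~V v → v ~V w → u ~V w
  ~Vtrans e f i = ~trans (e i) (f i)

  +V-cong : ∀ {u u' v v'} → u ~V u' → v ~V v' → (u +V v) ~V (u' +V v')
  +V-cong e f i = +-cong (e i) (f i)
  negV-cong : ∀ {u v} → u ~V v → negV u ~V negV v
  negV-cong e i = -‿cong (e i)
  ·V-cong : ∀ {c d u v} → c ~ d → u ~V v → (c ·V u) ~V (d ·V v)
  ·V-cong e f i = *-cong e (f i)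

  sumK-cong : ∀ {k} {f g : Fin k → Carrier} → (∀ i → f i ~ g i) → sumK f ~ sumK g
  sumK-cong {zero} e = ~refl
  sumK-cong {suc k} e = +-cong (e zero) (sumK-cong (λ i → e (suc i)))

  sumK-+ : ∀ {k} (f g : Fin k → Carrier) → sumK (λ i → f i + g i) ~ sumK f + sumK g
  sumK-+ {zero} f g = ~sym (+-identityʳ 0#)
  sumK-+ {suc k} f g = ~trans (+-congˡ (sumK-+ (f ∘ suc) (g ∘ suc)))
    (solve 4 (λ a b c d → (a :+ b) :+ (c :+ d) := (a :+ c) :+ (b :+ d)) ~refl _ _ _ _)

  sumK-* : ∀ {k} c (f : Fin k → Carrier) → sumK (λ i → c * f i) ~ c * sumK f
  sumK-* {zero} c f = ~sym (zeroʳ c)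
  sumK-* {suc k} c f = ~trans (+-congˡ (sumK-* c (f ∘ suc))) (~sym (distribˡ c _ _))

  sumK-0 : ∀ {k} {f : Fin k → Carrier} → (∀ i → f i ~ 0#) → sumK f ~ 0#
  sumK-0 {zero} e = ~refl
  sumK-0 {suc k} e = ~trans (+-cong (e zero) (sumK-0 (λ i → e (suc i)))) (+-identityʳ 0#)

  sumK-single : ∀ {k} (f : Fin k → Carrier) i → (∀ j → ¬ (j ≡ i) → f j ~ 0#) → sumK f ~ f i
  sumK-single f zero e = ~trans (+-congˡ (sumK-0 (λ i → e (suc i) λ ()))) (+-identityʳ _)
  sumK-single f (suc i) e = ~trans (+-cong (e zero λ ()) (sumK-single (f ∘ suc) i (λ j ne → e (suc j) λ { refl → ne refl }))) (+-identityˡ _)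

  ∙-cong : ∀ {u u' v v'} → u ~V u' → v ~V v' → u ∙ v ~ u' ∙ v'
  ∙-cong e f = sumK-cong (λ i → *-cong (e i) (f i))
  ∙-comm : ∀ u v → u ∙ v ~ v ∙ u
  ∙-comm u v = sumK-cong (λ i → *-comm (u i) (v i))
  ∙-+ʳ : ∀ u v w → u ∙ (v +V w) ~ u ∙ v + u ∙ w
  ∙-+ʳ u v w = ~trans (sumK-cong (λ i → distribˡ (u i) (v i) (w i))) (sumK-+ (λ i → u i * v i) (λ i → u i * w i))
  ∙-·ʳ : ∀ c u v → u ∙ (c ·V v) ~ c * (u ∙ v)
  ∙-·ʳ c u v = ~trans (sumK-cong (λ i → solve 3 (λ a b c → a :* (b :* c) := b :* (a :* c)) ~refl (u i) c (v i))) (sumK-* c (λ i → u i * v i))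
  neg-as-· : ∀ u → negV u ~V ((- 1#) ·V u)
  neg-as-· u i = solve 1 (λ a → :- a := (:- :1) :* a) ~refl (u i)
  ∙-negʳ : ∀ u v → u ∙ (negV v) ~ - (u ∙ v)
  ∙-negʳ u v = ~trans (∙-cong (~Vrefl {u}) (neg-as-· v)) (~trans (∙-·ʳ (- 1#) u v) (solve 1 (λ a → (:- :1) :* a := :- a) ~refl (u ∙ v)))
  ∙-0ʳ : ∀ u → u ∙ 0V ~ 0#
  ∙-0ʳ u = sumK-0 (λ i → zeroʳ (u i))
  ∙-+ˡ : ∀ u v w → (u +V v) ∙ w ~ u ∙ w + v ∙ w
  ∙-+ˡ u v w = ~trans (∙-comm (u +V v) w) (~trans (∙-+ʳ w u v) (+-cong (∙-comm w u) (∙-comm w v)))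
  ∙-·ˡ : ∀ c u v → (c ·V u) ∙ v ~ c * (u ∙ v)
  ∙-·ˡ c u v = ~trans (∙-comm (c ·V u) v) (~trans (∙-·ʳ c v u) (*-congˡ (∙-comm v u)))
  ∙-negˡ : ∀ u v → (negV u) ∙ v ~ - (u ∙ v)
  ∙-negˡ u v = ~trans (∙-comm (negV u) v) (~trans (∙-negʳ v u) (-‿cong (∙-comm v u)))
  ∙-0ˡ : ∀ u → 0V ∙ u ~ 0#
  ∙-0ˡ u = ~trans (∙-comm 0V u) (∙-0ʳ u)

  ∙-sumV : ∀ {k} u (f : Fin k → V) → u ∙ sumV f ~ sumK (λ i → u ∙ f i)
  ∙-sumV {zero} u f = ∙-0ʳ u
  ∙-sumV {suc k} u f = ~trans (∙-+ʳ u (f zero) (sumV (f ∘ suc))) (+-congˡ (∙-sumV u (f ∘ suc)))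

  ∙-lin : ∀ {k} u (c : Fin k → Carrier) (f : Fin k → V) → u ∙ sumV (λ i → c i ·V f i) ~ sumK (λ i → c i * (u ∙ f i))
  ∙-lin u c f = ~trans (∙-sumV u (λ i → c i ·V f i)) (sumK-cong (λ i → ∙-·ʳ (c i) u (f i)))

  sumV-cong : ∀ {k} {f g : Fin k → V} → (∀ i → f i ~V g i) → sumV f ~V sumV g
  sumV-cong {zero} e = ~Vrefl
  sumV-cong {suc k} e = +V-cong (e zero) (sumV-cong (λ i → e (suc i)))

  sumV-at : ∀ l {k} (f : Fin k → V) → sumV f l ~ sumK (λ i → f i l)
  sumV-at l {zero} f = ~refl
  sumV-at l {suc k} f = +-congˡ (sumV-at l (f ∘ suc))

  NZ : V → Set
  NZ a = ¬ (a ∙ a ~ 0#)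

  -- The coroot pairing, spelled so that `Refl a v` is definitionally v minus this multiple of a.
  coef : V → V → Carrier
  coef a v = (two * (v ∙ a)) * ((a ∙ a) ⁻¹)

  coef-∙ : ∀ {a} → NZ a → ∀ v → coef a v * (a ∙ a) ~ two * (v ∙ a)
  coef-∙ {a} nz v = ~trans (solve 3 (λ x y z → (x :* y) :* z := x :* (z :* y)) ~refl (two * (v ∙ a)) ((a ∙ a) ⁻¹) (a ∙ a))
    (~trans (*-congˡ (inv (a ∙ a) nz)) (*-identityʳ _))

  coef-cong : ∀ {a u v} → u ~V v → coef a u ~ coef a v
  coef-cong {a} e = *-congʳ (*-congˡ (∙-cong e (~Vrefl {a})))
  coef-0 : ∀ a v → v ∙ a ~ 0# → coef a v ~ 0#
  coef-0 a v e = ~trans (*-congʳ (~trans (*-congˡ e) (zeroʳ _))) (zeroˡ _)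

  Refl-cong : ∀ a {u v} → u ~V v → Refl a u ~V Refl a v
  Refl-cong a {u} {v} e = +V-cong e (negV-cong (·V-cong {u = a} {v = a} (coef-cong {a} {u} {v} e) ~Vrefl))

  Refl-fix : ∀ a v → v ∙ a ~ 0# → Refl a v ~V v
  Refl-fix a v e i = ~trans (+-congˡ (-‿cong (*-congʳ (coef-0 a v e)))) (solve 2 (λ x y → x :+ (:- (:0 :* y)) := x) ~refl (v i) (a i))

  Refl-+ : ∀ a u v → Refl a (u +V v) ~V (Refl a u +V Refl a v)
  Refl-+ a u v i = ~trans (+-congˡ (-‿cong (*-congʳ (*-congʳ (*-congˡ (∙-+ˡ u v a))))))
    (solve 7 (λ x y t p q r z → (x :+ y) :+ (:- (((t :* (p :+ q)) :* r) :* z)) := (x :+ (:- (((t :* p) :* r) :* z))) :+ (y :+ (:- (((t :* q) :* r) :* z)))) ~refl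
      (u i) (v i) two (u ∙ a) (v ∙ a) ((a ∙ a) ⁻¹) (a i))

  Refl-· : ∀ a c u → Refl a (c ·V u) ~V (c ·V Refl a u)
  Refl-· a c u i = ~trans (+-congˡ (-‿cong (*-congʳ (*-congʳ (*-congˡ (∙-·ˡ c u a))))))
    (solve 6 (λ x t p r z c → (c :* x) :+ (:- (((t :* (c :* p)) :* r) :* z)) := c :* (x :+ (:- (((t :* p) :* r) :* z)))) ~refl
      (u i) two (u ∙ a) ((a ∙ a) ⁻¹) (a i) c)

  Refl-0 : ∀ a → Refl a 0V ~V 0V
  Refl-0 a = Refl-fix a 0V (∙-0ˡ a)

  Refl-∙ʳ : ∀ a u w → w ∙ Refl a u ~ w ∙ u + (- (coef a u * (w ∙ a)))
  Refl-∙ʳ a u w = ~trans (∙-+ʳ w u _) (+-congˡ (~trans (∙-negʳ w (coef a u ·V a)) (-‿cong (∙-·ʳ (coef a u) w a))))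

  Refl-∙ˡ : ∀ a u w → Refl a u ∙ w ~ u ∙ w + (- (coef a u * (a ∙ w)))
  Refl-∙ˡ a u w = ~trans (∙-comm (Refl a u) w) (~trans (Refl-∙ʳ a u w) (+-cong (∙-comm w u) (-‿cong (*-congˡ (∙-comm w a)))))

  Refl-self : ∀ {a} → NZ a → Refl a a ~V negV a
  Refl-self {a} nz i = ~trans (+-congˡ (-‿cong (*-congʳ c2))) (solve 1 (λ x → x :+ (:- ((:1 :+ :1) :* x)) := :- x) ~refl (a i))
    where
    c2 : coef a a ~ two
    c2 = ~trans (*-assoc _ _ _) (~trans (*-congˡ (inv (a ∙ a) nz)) (*-identityʳ _))

  Refl-∙-self : ∀ {a} → NZ a → ∀ u → Refl a u ∙ a ~ - (u ∙ a)
  Refl-∙-self {a} nz u = ~trans (Refl-∙ˡ a u a) (~trans (+-congˡ (-‿cong (coef-∙ {a} nz u)))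
    (solve 1 (λ x → x :+ (:- ((:1 :+ :1) :* x)) := :- x) ~refl (u ∙ a)))

  Refl-iso : ∀ {a} → NZ a → ∀ u v → Refl a u ∙ Refl a v ~ u ∙ v
  Refl-iso {a} nz u v = begin
    Refl a u ∙ Refl a v ≈⟨ Refl-∙ʳ a v (Refl a u) ⟩
    Refl a u ∙ v + (- (coef a v * (Refl a u ∙ a))) ≈⟨ +-cong (Refl-∙ˡ a u v) (-‿cong (*-congˡ (Refl-∙-self {a} nz u))) ⟩
    (u ∙ v + (- (coef a u * (a ∙ v)))) + (- (coef a v * (- (u ∙ a)))) ≈⟨ +-congʳ (+-congˡ (-‿cong (*-congˡ (∙-comm a v)))) ⟩
    (u ∙ v + (- (((two * (u ∙ a)) * ((a ∙ a) ⁻¹)) * (v ∙ a)))) + (- (((two * (v ∙ a)) * ((a ∙ a) ⁻¹)) * (- (u ∙ a))))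
      ≈⟨ solve 5 (λ x t p r q → (x :+ (:- (((t :* p) :* r) :* q))) :+ (:- (((t :* q) :* r) :* (:- p))) := x) ~refl (u ∙ v) two (u ∙ a) ((a ∙ a) ⁻¹) (v ∙ a) ⟩
    u ∙ v ∎

  Refl-invol : ∀ {a} → NZ a → ∀ v → Refl a (Refl a v) ~V v
  Refl-invol {a} nz v i = ~trans (+-congˡ (-‿cong (*-congʳ (*-congʳ (*-congˡ (Refl-∙-self {a} nz v))))))
    (solve 5 (λ x t p r z → (x :+ (:- (((t :* p) :* r) :* z))) :+ (:- (((t :* (:- p)) :* r) :* z)) := x) ~refl (v i) two (v ∙ a) ((a ∙ a) ⁻¹) (a i))

  inv-cong : ∀ {x y} → ¬ (x ~ 0#) → x ~ y → x ⁻¹ ~ y ⁻¹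
  inv-cong {x} {y} nz e = begin
    x ⁻¹ ≈⟨ ~sym (*-identityʳ _) ⟩
    x ⁻¹ * 1# ≈⟨ *-congˡ (~sym (inv y (λ z → nz (~trans e z)))) ⟩
    x ⁻¹ * (y * y ⁻¹) ≈⟨ ~sym (*-assoc _ _ _) ⟩
    (x ⁻¹ * y) * y ⁻¹ ≈⟨ *-congʳ (~trans (*-comm _ _) (~trans (*-congʳ (~sym e)) (inv x nz))) ⟩
    1# * y ⁻¹ ≈⟨ *-identityˡ _ ⟩
    y ⁻¹ ∎

  cancel : ∀ {x y} → ¬ (x ~ 0#) → x * y ~ 0# → y ~ 0#
  cancel {x} {y} nz e = begin
    y ≈⟨ ~sym (*-identityˡ y) ⟩
    1# * y ≈⟨ *-congʳ (~sym (inv x nz)) ⟩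
    (x * x ⁻¹) * y ≈⟨ solve 3 (λ x i y → (x :* i) :* y := i :* (x :* y)) ~refl x (x ⁻¹) y ⟩
    x ⁻¹ * (x * y) ≈⟨ ~trans (*-congˡ e) (zeroʳ _) ⟩
    0# ∎

  Refl-congˡ : ∀ {a b} → NZ a → a ~V b → ∀ v → Refl a v ~V Refl b v
  Refl-congˡ {a} {b} nz e v = +V-cong (~Vrefl {v}) (negV-cong (·V-cong {u = a} {v = b}
    (*-cong (*-congˡ (∙-cong (~Vrefl {v}) e)) (inv-cong nz (∙-cong e e))) e))

  Refl-neg : ∀ {a} → NZ a → ∀ v → Refl (negV a) v ~V Refl a v
  Refl-neg {a} nz v i = +-congˡ (-‿cong (begin
    ((two * (v ∙ negV a)) * ((negV a ∙ negV a) ⁻¹)) * (- a i) ≈⟨ *-congʳ (*-cong (*-congˡ (∙-negʳ v a)) (~sym (inv-cong nz aa))) ⟩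
    ((two * (- (v ∙ a))) * ((a ∙ a) ⁻¹)) * (- a i) ≈⟨ solve 4 (λ t p r z → ((t :* (:- p)) :* r) :* (:- z) := ((t :* p) :* r) :* z) ~refl two (v ∙ a) ((a ∙ a) ⁻¹) (a i) ⟩
    ((two * (v ∙ a)) * ((a ∙ a) ⁻¹)) * a i ∎))
    where
    aa : a ∙ a ~ negV a ∙ negV a
    aa = ~sym (~trans (∙-negʳ (negV a) a) (~trans (-‿cong (∙-negˡ a a)) (solve 1 (λ x → :- (:- x) := x) ~refl (a ∙ a))))

  Refl-conj : ∀ {a b} → NZ a → NZ b → ∀ v → Refl (Refl a b) v ~V Refl a (Refl b (Refl a v))
  Refl-conj {a} {b} na nb v = ~Vsym (~Vtrans
      (Refl-+ a (Refl a v) (negV (coef b (Refl a v) ·V b)))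
      (+V-cong (Refl-invol {a} na v) (~Vtrans (Refl-cong a (neg-as-· (coef b (Refl a v) ·V b)))
        (~Vtrans (Refl-· a (- 1#) (coef b (Refl a v) ·V b)) (~Vtrans (~Vsym (neg-as-· (Refl a (coef b (Refl a v) ·V b))))
          (negV-cong (~Vtrans (Refl-· a (coef b (Refl a v)) b) (·V-cong {u = Refl a b} ce ~Vrefl))))))))
    where
    ce : coef b (Refl a v) ~ coef (Refl a b) v
    ce = *-cong (*-congˡ (~trans (~sym (Refl-iso {a} na (Refl a v) b)) (∙-cong (Refl-invol {a} na v) (~Vrefl {Refl a b}))))
                (inv-cong nb (~sym (Refl-iso {a} na b b)))

  actV-cong : ∀ w {u v} → u ~V v → actV w u ~V actV w v
  actV-cong [] e = e
  actV-cong (a ∷ w) e = Refl-cong a (actV-cong w e)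
  actV-+ : ∀ w u v → actV w (u +V v) ~V (actV w u +V actV w v)
  actV-+ [] u v = ~Vrefl
  actV-+ (a ∷ w) u v = ~Vtrans (Refl-cong a (actV-+ w u v)) (Refl-+ a _ _)
  actV-· : ∀ w c u → actV w (c ·V u) ~V (c ·V actV w u)
  actV-· [] c u = ~Vrefl
  actV-· (a ∷ w) c u = ~Vtrans (Refl-cong a (actV-· w c u)) (Refl-· a c _)
  actV-0 : ∀ w → actV w 0V ~V 0V
  actV-0 [] = ~Vrefl
  actV-0 (a ∷ w) = ~Vtrans (Refl-cong a (actV-0 w)) (Refl-0 a)
  actV-neg : ∀ w u → actV w (negV u) ~V negV (actV w u)
  actV-neg w u = ~Vtrans (actV-cong w (neg-as-· u)) (~Vtrans (actV-· w (- 1#) u) (~Vsym (neg-as-· (actV w u))))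
  actV-lin : ∀ {k} w (c : Fin k → Carrier) (f : Fin k → V) → actV w (sumV (λ i → c i ·V f i)) ~V sumV (λ i → c i ·V actV w (f i))
  actV-lin {zero} w c f = actV-0 w
  actV-lin {suc k} w c f = ~Vtrans (actV-+ w (c zero ·V f zero) _) (+V-cong (actV-· w (c zero) (f zero)) (actV-lin w (c ∘ suc) (f ∘ suc)))
  actV-++ : ∀ u w v → actV (u ++ w) v ≡ actV u (actV w v)
  actV-++ [] w v = refl
  actV-++ (a ∷ u) w v = cong (Refl a) (actV-++ u w v)
  actV-iso : ∀ {w} → All NZ w → ∀ u v → actV w u ∙ actV w v ~ u ∙ v
  actV-iso [] u v = ~refl
  actV-iso {a ∷ w} (p ∷ ps) u v = ~trans (Refl-iso {a} p (actV w u) (actV w v)) (actV-iso ps u v)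
  actV-fix : ∀ w {v} → All (λ a → v ∙ a ~ 0#) w → actV w v ~V v
  actV-fix [] [] = ~Vrefl
  actV-fix (a ∷ w) {v} (p ∷ ps) = ~Vtrans (Refl-cong a (actV-fix w ps)) (Refl-fix a v p)
  actV-rev : ∀ {w} → All NZ w → ∀ v → actV (reverse w) (actV w v) ~V v
  actV-rev [] v = ~Vrefl
  actV-rev {a ∷ w} (p ∷ ps) v i rewrite Listₚ.unfold-reverse a w | actV-++ (reverse w) (a ∷ []) (Refl a (actV w v)) =
    ~trans (actV-cong (reverse w) (Refl-invol {a} p (actV w v)) i) (actV-rev ps v i)

-- Double-negated reasoning and linear algebra over an ordered field.

infixl 1 _>>=_
_>>=_ : ∀ {a b} {A : Set a} {B : Set b} → ¬ ¬ A → (A → ¬ ¬ B) → ¬ ¬ B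
m >>= f = λ k → m (λ a → f a k)

return : ∀ {a} {A : Set a} → A → ¬ ¬ A
return a k = k a

em : ∀ {a} {A : Set a} → ¬ ¬ Dec A
em k = k (no (λ a → k (yes a)))

-- Double-negation shift, available because the index set is finite.
¬¬-Fin : ∀ {k} {P : Fin k → Set} → (∀ i → ¬ ¬ P i) → ¬ ¬ (∀ i → P i)
¬¬-Fin {zero} f = return λ ()
¬¬-Fin {suc k} f = f zero >>= λ p → ¬¬-Fin (λ i → f (suc i)) >>= λ q → return λ { zero → p ; (suc i) → q i }

module Classical (F : OrderedField) (n : ℕ) where
  open OrderedField F using (_⁻¹; ⁻¹-inverse; 0≉1; ≤-isTotalOrder; +-mono-≤; *-nonneg) renaming (_≤_ to infix 4 _≤₀_; commRing to R₀)
  module R₀ = CommutativeRing R₀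

  _~₀_ : Rel R₀.Carrier 0ℓ
  x ~₀ y = ¬ ¬ (x R₀.≈ y)

  private
    isCR : IsCommutativeRing _~₀_ R₀._+_ R₀._*_ R₀.-_ R₀.0# R₀.1#
    isCR = record
      { isRing = record
        { +-isAbelianGroup = record
          { isGroup = record
            { isMonoid = record
              { isSemigroup = record
                { isMagma = record
                  { isEquivalence = record { refl = return R₀.refl ; sym = λ p → p >>= return ∘ R₀.sym ; trans = λ p q → p >>= λ a → q >>= λ b → return (R₀.trans a b) }
                  ; ∙-cong = λ p q → p >>= λ a → q >>= λ b → return (R₀.+-cong a b) }
                ; assoc = λ x y z → return (R₀.+-assoc x y z) }
              ; identity = (λ x → return (R₀.+-identityˡ x)) , (λ x → return (R₀.+-identityʳ x)) }
            ; inverse = (λ x → return (R₀.-‿inverseˡ x)) , (λ x → return (R₀.-‿inverseʳ x))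
            ; ⁻¹-cong = λ p → p >>= return ∘ R₀.-‿cong }
          ; comm = λ x y → return (R₀.+-comm x y) }
        ; *-cong = λ p q → p >>= λ a → q >>= λ b → return (R₀.*-cong a b)
        ; *-assoc = λ x y z → return (R₀.*-assoc x y z)
        ; *-identity = (λ x → return (R₀.*-identityˡ x)) , (λ x → return (R₀.*-identityʳ x))
        ; distrib = (λ x y z → return (R₀.distribˡ x y z)) , (λ x y z → return (R₀.distribʳ x y z)) }
      ; *-comm = λ x y → return (R₀.*-comm x y) }

  module St = VecAlg F n R₀._≈_ R₀.isCommutativeRing ⁻¹-inverse
  open VecAlg F n _~₀_ isCR (λ x nz → return (⁻¹-inverse x (λ e → nz (return e)))) public
  open CommutativeRing R public hiding (zero) renaming (_≈_ to infix 4 _~_; refl to ~refl; sym to ~sym; trans to ~trans; reflexive to ~reflexive)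
  open Vectors F n public using (V; 0V; _+V_; negV; _·V_; sumK; sumV; two; Refl; actV; _≈V_) renaming (_∙_ to infix 8 _∙_)
  module ~-Reasoning = Relation.Binary.Reasoning.Setoid setoid
  open Algebra.Properties.Ring ring public using (-0#≈0#; -‿involutive)
  open IsTotalOrder ≤-isTotalOrder using (total; antisym; ≤-resp-≈)

  ↑ : ∀ {x y} → x R₀.≈ y → x ~ y
  ↑ = return
  ↑V : ∀ {u v} → u ≈V v → u ~V v
  ↑V e i = return (e i)
  ~-stable : ∀ {x y} → ¬ ¬ (x ~ y) → x ~ y
  ~-stable p k = p (λ q → q k)
  ~V-stable : ∀ {x y} → ¬ ¬ (x ~V y) → x ~V y
  ~V-stable p i = ~-stable (p >>= λ q → return (q i))
  ↓V : ∀ {u v} → u ~V v → ¬ ¬ (u ≈V v)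
  ↓V = ¬¬-Fin

  Nn : Carrier → Set
  Nn x = ¬ ¬ (0# ≤₀ x)

  Nn-resp : ∀ {x y} → x ~ y → Nn x → Nn y
  Nn-resp e p = e >>= λ e → p >>= λ p → return (proj₁ ≤-resp-≈ e p)
  ≤⇒Nn : ∀ {x y} → x ≤₀ y → Nn (y + (- x))
  ≤⇒Nn {x} p = return (proj₂ ≤-resp-≈ (R₀.-‿inverseʳ x) (+-mono-≤ (- x) p))
  Nn-+ : ∀ {x y} → Nn x → Nn y → Nn (x + y)
  Nn-+ {x} {y} p q = p >>= λ p → q >>= λ q → return (IsTotalOrder.trans ≤-isTotalOrder q (proj₂ ≤-resp-≈ (R₀.+-identityˡ y) (+-mono-≤ y p)))
  Nn-* : ∀ {x y} → Nn x → Nn y → Nn (x * y)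
  Nn-* p q = p >>= λ p → q >>= λ q → return (*-nonneg p q)
  Nn-0 : Nn 0#
  Nn-0 = return (IsTotalOrder.refl ≤-isTotalOrder)
  -- A genuine disjunction: totality of the order is part of the structure, so a sign can be chosen
  -- although zero cannot be tested.
  Nn-total : ∀ x → Nn x ⊎ Nn (- x)
  Nn-total x with total 0# x
  ... | inj₁ p = inj₁ (return p)
  ... | inj₂ p = inj₂ (Nn-resp (+-identityˡ (- x)) (≤⇒Nn p))
  Nn-antisym : ∀ {x} → Nn x → Nn (- x) → x ~ 0#
  Nn-antisym {x} p q = p >>= λ p → q >>= λ q → return (R₀.sym (antisym p
    (proj₂ ≤-resp-≈ (R₀.+-identityˡ x) (proj₁ ≤-resp-≈ (R₀.-‿inverseˡ x) (+-mono-≤ x q)))))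
  Nn-sq : ∀ x → Nn (x * x)
  Nn-sq x with Nn-total x
  ... | inj₁ p = Nn-* p p
  ... | inj₂ p = Nn-resp (solve 1 (λ a → (:- a) :* (:- a) := a :* a) ~refl x) (Nn-* p p)
  Nn-1 : Nn 1#
  Nn-1 = Nn-resp (*-identityʳ 1#) (Nn-sq 1#)
  1≁0 : ¬ (1# ~ 0#)
  1≁0 p = p (λ e → 0≉1 (R₀.sym e))
  Nn-+-0 : ∀ {x y} → Nn x → Nn y → x + y ~ 0# → x ~ 0#
  Nn-+-0 {x} {y} p q e = Nn-antisym p (Nn-resp (begin
    y ≈⟨ solve 2 (λ x y → y := (x :+ y) :+ (:- x)) ~refl x y ⟩
    (x + y) + (- x) ≈⟨ +-congʳ e ⟩
    0# + (- x) ≈⟨ +-identityˡ _ ⟩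
    - x ∎) q)
    where open ~-Reasoning
  Nn-cancel : ∀ {x y} → Nn x → ¬ (x ~ 0#) → Nn (x * y) → Nn y
  Nn-cancel {x} {y} p nz q with Nn-total y
  ... | inj₁ r = r
  ... | inj₂ r = Nn-resp (~sym (cancel nz (Nn-antisym q (Nn-resp (solve 2 (λ x y → x :* (:- y) := :- (x :* y)) ~refl x y) (Nn-* p r))))) Nn-0
  two≁0 : ¬ (two ~ 0#)
  two≁0 e = 1≁0 (Nn-+-0 Nn-1 Nn-1 e)
  Nn-two : Nn two
  Nn-two = Nn-+ Nn-1 Nn-1

  sq-0 : ∀ {x} → x * x ~ 0# → x ~ 0#
  sq-0 {x} e = ~-stable λ k → k (cancel (λ z → k z) e)

  sumK-Nn : ∀ {k} {f : Fin k → Carrier} → (∀ i → Nn (f i)) → Nn (sumK f)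
  sumK-Nn {zero} p = Nn-0
  sumK-Nn {suc k} p = Nn-+ (p zero) (sumK-Nn (p ∘ suc))
  sumK-Nn-0 : ∀ {k} {f : Fin k → Carrier} → (∀ i → Nn (f i)) → sumK f ~ 0# → ∀ i → f i ~ 0#
  sumK-Nn-0 {suc k} p e zero = Nn-+-0 (p zero) (sumK-Nn (p ∘ suc)) e
  sumK-Nn-0 {suc k} p e (suc i) = sumK-Nn-0 (p ∘ suc) (Nn-+-0 (sumK-Nn (p ∘ suc)) (p zero) (~trans (+-comm _ _) e)) i

  ∙-Nn : ∀ v → Nn (v ∙ v)
  ∙-Nn v = sumK-Nn (λ i → Nn-sq (v i))
  ∙-def : ∀ v → v ∙ v ~ 0# → v ~V 0V
  ∙-def v e i = sq-0 (sumK-Nn-0 (λ i → Nn-sq (v i)) e i)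

  -- Gaussian elimination, one column at a time.
  homogeneous : ∀ m (rows : List (Fin m → Carrier)) → length rows ℕ.< m →
    ¬ ¬ ∃ λ (x : Fin m → Carrier) → (∃ λ i → ¬ (x i ~ 0#)) × All (λ r → sumK (λ i → r i * x i) ~ 0#) rows
  homogeneous (suc m) rows (ℕ.s≤s lt) = pivot rows >>= λ { (inj₁ all0) → return (e₀ , (zero , 1≁0) , All.map (λ {r} → e₀-sol r) all0)
                                        ; (inj₂ (r , rest , nz , len , back)) → step r rest nz back (ℕₚ.≤-trans (ℕₚ.≤-reflexive (sym len)) lt) }
    where
    Row : Set
    Row = Fin (suc m) → Carrier
    Sol : Row → Row → Set
    Sol x r = sumK (λ i → r i * x i) ~ 0#
    e₀ : Row
    e₀ zero = 1#
    e₀ (suc i) = 0#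
    e₀-sol : ∀ r → r zero ~ 0# → Sol e₀ r
    e₀-sol r e = ~trans (+-cong (~trans (*-congʳ e) (zeroˡ _)) (sumK-0 {f = λ i → r (suc i) * 0#} (λ i → zeroʳ (r (suc i))))) (+-identityʳ 0#)
    pivot : ∀ rows → ¬ ¬ (All (λ r → r zero ~ 0#) rows ⊎ ∃ λ r → ∃ λ rest → ¬ (r zero ~ 0#) × (length rows ≡ suc (length rest)) ×
              (∀ x → Sol x r → All (Sol x) rest → All (Sol x) rows))
    pivot [] = return (inj₁ [])
    pivot (r ∷ rows) = em {A = r zero ~ 0#} >>= λ
      { (no nz) → return (inj₂ (r , rows , nz , refl , λ x p q → p ∷ q))
      ; (yes z) → pivot rows >>= λ
        { (inj₁ zs) → return (inj₁ (z ∷ zs))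
        ; (inj₂ (r' , rest , nz , len , back)) → return (inj₂ (r' , r ∷ rest , nz , cong suc len , λ { x p (q ∷ qs) → q ∷ back x p qs })) } }
    step : ∀ r rest → ¬ (r zero ~ 0#) → (∀ x → Sol x r → All (Sol x) rest → All (Sol x) rows) → length rest ℕ.< m →
      ¬ ¬ ∃ λ (x : Row) → (∃ λ i → ¬ (x i ~ 0#)) × All (Sol x) rows
    step r rest nz back lt' = homogeneous m (map elim rest) (ℕₚ.≤-trans (ℕₚ.≤-reflexive (cong suc (Listₚ.length-map elim rest))) lt') >>= λ { (x' , (i , nzi) , sol) →
        return (x x' , (suc i , λ e → nzi (cancel nz e)) , back (x x') (sol-r x') (All.map (λ {r'} → sol-rest x' r') (Allₚ.map⁻ sol))) }
      where
      p = r zero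
      -- Fraction-free: each row is scaled by the pivot instead of divided by it, and the solution
      -- of the smaller system is rescaled by p to match.
      elim : Row → Fin m → Carrier
      elim r' i = p * r' (suc i) + (- (r' zero * r (suc i)))
      x : (Fin m → Carrier) → Row
      x x' zero = - sumK (λ i → r (suc i) * x' i)
      x x' (suc i) = p * x' i
      expand : ∀ x' r' → sumK (λ i → r' (suc i) * (p * x' i)) ~ p * sumK (λ i → r' (suc i) * x' i)
      expand x' r' = ~trans (sumK-cong (λ i → solve 3 (λ a b c → a :* (b :* c) := b :* (a :* c)) ~refl (r' (suc i)) p (x' i))) (sumK-* p (λ i → r' (suc i) * x' i))
      sol-r : ∀ x' → Sol (x x') r
      sol-r x' = ~trans (+-congˡ (expand x' r)) (solve 2 (λ a b → a :* (:- b) :+ a :* b := :0) ~refl p _)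
      sol-rest : ∀ x' r' → sumK (λ i → elim r' i * x' i) ~ 0# → Sol (x x') r'
      sol-rest x' r' e = begin
        r' zero * (- s) + sumK (λ i → r' (suc i) * (p * x' i)) ≈⟨ +-congˡ (expand x' r') ⟩
        r' zero * (- s) + p * s' ≈⟨ solve 4 (λ a s p s' → a :* (:- s) :+ p :* s' := p :* s' :+ (:- a) :* s) ~refl (r' zero) s p s' ⟩
        p * s' + (- r' zero) * s ≈⟨ ~sym (+-cong (sumK-* p (λ i → r' (suc i) * x' i)) (sumK-* (- r' zero) (λ i → r (suc i) * x' i))) ⟩
        sumK (λ i → p * (r' (suc i) * x' i)) + sumK (λ i → (- r' zero) * (r (suc i) * x' i)) ≈⟨ ~sym (sumK-+ (λ i → p * (r' (suc i) * x' i)) (λ i → (- r' zero) * (r (suc i) * x' i))) ⟩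
        sumK (λ i → p * (r' (suc i) * x' i) + (- r' zero) * (r (suc i) * x' i)) ≈⟨ sumK-cong (λ i → solve 5 (λ p a b z c → p :* (a :* b) :+ (:- z) :* (c :* b) := (p :* a :+ (:- (z :* c))) :* b) ~refl p (r' (suc i)) (x' i) (r' zero) (r (suc i))) ⟩
        sumK (λ i → elim r' i * x' i) ≈⟨ e ⟩
        0# ∎
        where
        open ~-Reasoning
        s = sumK (λ i → r (suc i) * x' i)
        s' = sumK (λ i → r' (suc i) * x' i)

  -- Stands in for dimension counts: it bounds the length of γ from below, produces fundamental
  -- weights, and supplies the test vector in `factor⇒Z`.
  common-perp : (L : List V) → length L ℕ.< n → ¬ ¬ ∃ λ x → NZ x × All (λ a → x ∙ a ~ 0#) L
  common-perp L lt = homogeneous n L lt >>= λ { (x , (i , nz) , sol) →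
    return (x , (λ e → nz (∙-def x e i)) , All.map (λ {a} e → ~trans (∙-comm x a) e) sol) }

-- Roots as indices: reflections, signs and simple-root coefficients.

module RootSystem (F : OrderedField) (n : ℕ) (D : BipRootSystem F n) where
  open Classical F n public
  open WithRS F n D public hiding (_∙_; _≈V_; V; 0V; _+V_; negV; _·V_; sumK; sumV; two; Refl; actV; _≈W_; ρ₁; Lρ; _≺_; 𝓡Rel; 𝓡Iter; Flip; Compat; Deg; module Colored; module ColoredNC; HasLT; AbsLe; InNC; prodW; N; γV; σc; IsWτ)

  Φ-NZ : ∀ j → NZ (Φ j)
  Φ-NZ j e = ↓V (∙-def (Φ j) e) (nonzero j)
  Φ-NZ₀ : ∀ j → St.NZ (Φ j)
  Φ-NZ₀ j e = Φ-NZ j (↑ e)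

  -- Equality of indices is decidable, so a double-negated equality of roots becomes an honest
  -- equality of indices. This is the way back from classical linear algebra to constructive data.
  Φ-inj~ : ∀ {j k} → Φ j ~V Φ k → j ≡ k
  Φ-inj~ {j} {k} e = decidable-stable (j Finₚ.≟ k) (↓V e >>= λ e → return (Φ-inj j k e))

  ref : Fin M → Fin M → Fin M
  ref j k = proj₁ (refl-closed j k)
  Φ-ref : ∀ j k → Φ (ref j k) ≈V Refl (Φ j) (Φ k)
  Φ-ref j k = St.~Vsym (proj₂ (refl-closed j k))

  actI : Word → Fin M → Fin M
  actI [] j = j
  actI (a ∷ w) j = ref a (actI w j)

  Φ-act : ∀ w j → Φ (actI w j) ≈V act w (Φ j)
  Φ-act [] j = St.~Vrefl
  Φ-act (a ∷ w) j = St.~Vtrans (Φ-ref a (actI w j)) (St.Refl-cong (Φ a) (Φ-act w j))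

  All-NZ : ∀ w → All NZ (map Φ w)
  All-NZ [] = []
  All-NZ (a ∷ w) = Φ-NZ a ∷ All-NZ w
  act-++ : ∀ u w v → act (u ++ w) v ≡ act u (act w v)
  act-++ u w v = trans (cong (λ l → actV l v) (Listₚ.map-++ Φ u w)) (St.actV-++ (map Φ u) (map Φ w) v)
  act-rev : ∀ w v → act (reverse w) (act w v) ~V v
  act-rev w v i = ~trans (~reflexive (cong (λ l → actV l (act w v) i) (Listₚ.reverse-map Φ w))) (actV-rev (All-NZ w) v i)
  act-iso : ∀ w u v → act w u ∙ act w v ~ u ∙ v
  act-iso w = actV-iso (All-NZ w)
  act-cong : ∀ w {u v} → u ~V v → act w u ~V act w v
  act-cong w = actV-cong (map Φ w)

  actI-++ : ∀ u w j → actI (u ++ w) j ≡ actI u (actI w j)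
  actI-++ [] w j = refl
  actI-++ (a ∷ u) w j = cong (ref a) (actI-++ u w j)
  ref-ref : ∀ a j → ref a (ref a j) ≡ j
  ref-ref a j = Φ-inj~ (~Vtrans (↑V (St.~Vtrans (Φ-ref a (ref a j)) (St.Refl-cong (Φ a) (Φ-ref a j)))) (Refl-invol {Φ a} (Φ-NZ a) (Φ j)))
  actI-rev : ∀ w j → actI (reverse w) (actI w j) ≡ j
  actI-rev [] j = refl
  actI-rev (a ∷ w) j = trans (cong (λ v → actI v (ref a (actI w j))) (Listₚ.unfold-reverse a w))
    (trans (actI-++ (reverse w) (a ∷ []) (ref a (actI w j))) (trans (cong (actI (reverse w)) (ref-ref a (actI w j))) (actI-rev w j)))
  actI-rev′ : ∀ w j → actI w (actI (reverse w) j) ≡ j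
  actI-rev′ w j = trans (cong (λ v → actI v (actI (reverse w) j)) (sym (Listₚ.reverse-involutive w))) (actI-rev (reverse w) j)
  actI-inj : ∀ w {j k} → actI w j ≡ actI w k → j ≡ k
  actI-inj w {j} {k} e = trans (sym (actI-rev w j)) (trans (cong (actI (reverse w)) e) (actI-rev w k))

  -- R(β)β = -β, so closure under negation comes from closure under reflections.
  neg : Fin M → Fin M
  neg j = ref j j
  Φ-neg : ∀ j → Φ (neg j) ≈V negV (Φ j)
  Φ-neg j = St.~Vtrans (Φ-ref j j) (St.Refl-self {Φ j} (Φ-NZ₀ j))
  Φ-neg~ : ∀ j → Φ (neg j) ~V negV (Φ j)
  Φ-neg~ j = ↑V (Φ-neg j)
  neg-neg : ∀ j → neg (neg j) ≡ j
  neg-neg j = Φ-inj~ (λ i → ~trans (Φ-neg~ (neg j) i) (~trans (-‿cong (Φ-neg~ j i)) (-‿involutive _)))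
  neg-inj : ∀ {j k} → neg j ≡ neg k → j ≡ k
  neg-inj {j} {k} e = trans (sym (neg-neg j)) (trans (cong neg e) (neg-neg k))
  ref-neg : ∀ a j → ref a (neg j) ≡ neg (ref a j)
  ref-neg a j = Φ-inj~ (~Vtrans (↑V (Φ-ref a (neg j))) (~Vtrans (Refl-cong (Φ a) (Φ-neg~ j)) (~Vtrans (actV-neg (Φ a ∷ []) (Φ j))
    (~Vtrans (negV-cong (~Vsym (↑V (Φ-ref a j)))) (~Vsym (Φ-neg~ (ref a j)))))))
  actI-neg : ∀ w j → actI w (neg j) ≡ neg (actI w j)
  actI-neg [] j = refl
  actI-neg (a ∷ w) j = trans (cong (ref a) (actI-neg w j)) (ref-neg a (actI w j))
  ref-negˡ : ∀ a j → ref (neg a) j ≡ ref a j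
  ref-negˡ a j = Φ-inj~ (~Vtrans (↑V (Φ-ref (neg a) j)) (~Vtrans (Refl-congˡ {Φ (neg a)} (Φ-NZ (neg a)) (Φ-neg~ a) (Φ j))
    (~Vtrans (Refl-neg {Φ a} (Φ-NZ a) (Φ j)) (~Vsym (↑V (Φ-ref a j))))))
  ref-conj : ∀ a b j → ref (ref a b) j ≡ ref a (ref b (ref a j))
  ref-conj a b j = Φ-inj~ (~Vtrans (↑V (Φ-ref (ref a b) j)) (~Vtrans (Refl-congˡ {Φ (ref a b)} (Φ-NZ (ref a b)) (↑V (Φ-ref a b)) (Φ j))
    (~Vtrans (Refl-conj {Φ a} {Φ b} (Φ-NZ a) (Φ-NZ b) (Φ j)) (↑V (St.~Vsym (Φ-act (a ∷ b ∷ a ∷ []) j))))))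

  -- Orthogonality up to double negation already makes `ref j k` and k the same index; the multiple
  -- of Φ j subtracted by the reflection is then zero in the field's own equality, and so is the
  -- inner product. `irreducible` asks for this strict form.
  ∙0-strict : ∀ j k → Φ j ∙ Φ k ~ 0# → Φ j ∙ Φ k R₀.≈ 0#
  ∙0-strict j k e = R₀.trans (St.∙-comm (Φ j) (Φ k)) (St.cancel (λ z → two≁0 (↑ z)) (R₀.trans (R₀.sym (St.coef-∙ {Φ j} (Φ-NZ₀ j) (Φ k)))
      (R₀.trans (R₀.sym (St.∙-·ˡ c (Φ j) (Φ j))) (R₀.trans (St.∙-cong {v = Φ j} cz (St.~Vrefl)) (St.∙-0ˡ (Φ j))))))
    where
    c = St.coef (Φ j) (Φ k)
    e' : Refl (Φ j) (Φ k) ~V Φ k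
    e' = Refl-fix (Φ j) (Φ k) (~trans (∙-comm (Φ k) (Φ j)) e)
    r≡k : ref j k ≡ k
    r≡k = Φ-inj~ (~Vtrans (↑V (Φ-ref j k)) e')
    cz : (c ·V Φ j) ≈V (λ _ → 0#)
    cz i = R₀.trans (St.solve 2 (λ x y → y St.:= (x St.:+ (St.:- (x St.:+ (St.:- y))))) R₀.refl (Φ k i) (c * Φ j i))
      (R₀.trans (R₀.+-congˡ (R₀.-‿cong (R₀.trans (R₀.sym (Φ-ref j k i)) (R₀.reflexive (cong (λ l → Φ l i) r≡k))))) (R₀.-‿inverseʳ _))

  ref-perp : ∀ {a j} → Φ a ∙ Φ j ~ 0# → ref a j ≡ j
  ref-perp {a} {j} e = Φ-inj~ (~Vtrans (↑V (Φ-ref a j)) (Refl-fix (Φ a) (Φ j) (~trans (∙-comm (Φ j) (Φ a)) e)))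

  -- The suffix ₀ on these coefficient lemmas marks the field's own equality; such versions are what
  -- `cf-0-strict` relies on to conclude without a double negation.
  linΠ-+neg₀ : ∀ c d → (linΠ c +V negV (linΠ d)) ≈V linΠ (λ i → c i + (- d i))
  linΠ-+neg₀ = go {n} σ
    where
    go : ∀ {k} (s : Fin k → V) (c d : Fin k → Carrier) → (sumV (λ i → c i ·V s i) +V negV (sumV (λ i → d i ·V s i))) ≈V sumV (λ i → (c i + (- d i)) ·V s i)
    go {zero} s c d j = R₀.-‿inverseʳ 0#
    go {suc k} s c d j = R₀.trans (St.solve 5 (λ c a x d b → (c St.:* a St.:+ x) St.:+ (St.:- (d St.:* a St.:+ b)) St.:= (c St.:+ (St.:- d)) St.:* a St.:+ (x St.:+ (St.:- b))) R₀.refl (c zero) (s zero j) (sumV (λ i → c (suc i) ·V s (suc i)) j) (d zero) (sumV (λ i → d (suc i) ·V s (suc i)) j))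
      (R₀.+-congˡ (go (s ∘ suc) (c ∘ suc) (d ∘ suc) j))
  linΠ-uniq₀ : ∀ c d → linΠ c ≈V linΠ d → ∀ i → c i R₀.≈ d i
  linΠ-uniq₀ c d e i = R₀.trans (St.solve 2 (λ c d → c St.:= (c St.:+ (St.:- d)) St.:+ d) R₀.refl (c i) (d i))
    (R₀.trans (R₀.+-congʳ (simp-indep (λ i → c i + (- d i)) (St.~Vtrans (St.~Vsym (linΠ-+neg₀ c d)) (λ j → R₀.trans (R₀.+-congʳ (e j)) (R₀.-‿inverseʳ _))) i)) (R₀.+-identityˡ _))
  linΠ-0₀ : linΠ (λ _ → 0#) ≈V 0V
  linΠ-0₀ = go {n} σ
    where
    go : ∀ {k} (s : Fin k → V) → sumV (λ i → 0# ·V s i) ≈V 0V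
    go {zero} s = St.~Vrefl
    go {suc k} s j = R₀.trans (R₀.+-cong (R₀.zeroˡ _) (go (s ∘ suc) j)) (R₀.+-identityˡ _)
  linΠ-cong₀ : ∀ {c d} → (∀ i → c i R₀.≈ d i) → linΠ c ≈V linΠ d
  linΠ-cong₀ e = St.sumV-cong {n} (λ i → St.·V-cong {u = σ i} {v = σ i} (e i) St.~Vrefl)
  linΠ-neg₀ : ∀ c → negV (linΠ c) ≈V linΠ (λ i → - c i)
  linΠ-neg₀ c j = R₀.trans (R₀.sym (R₀.+-identityˡ _)) (R₀.trans (R₀.+-congʳ (R₀.sym (linΠ-0₀ j))) (R₀.trans (linΠ-+neg₀ (λ _ → 0#) c j) (linΠ-cong₀ (λ i → R₀.+-identityˡ _) j)))

  linΠ-indep : ∀ c → linΠ c ~V 0V → ∀ i → c i ~ 0#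
  linΠ-indep c e i = ↓V e >>= λ e → return (simp-indep c e i)
  linΠ-uniq : ∀ c d → linΠ c ~V linΠ d → ∀ i → c i ~ d i
  linΠ-uniq c d e i = ↓V e >>= λ e → return (linΠ-uniq₀ c d e i)
  linΠ-cong : ∀ {c d} → (∀ i → c i ~ d i) → linΠ c ~V linΠ d
  linΠ-cong e = sumV-cong {n} (λ i → ·V-cong {u = σ i} {v = σ i} (e i) ~Vrefl)
  linΠ-0 : linΠ (λ _ → 0#) ~V 0V
  linΠ-0 = ↑V linΠ-0₀
  linΠ-neg : ∀ c → negV (linΠ c) ~V linΠ (λ i → - c i)
  linΠ-neg c = ↑V (linΠ-neg₀ c)
  δ : Fin n → Fin n → Carrier
  δ i j with i Finₚ.≟ j
  ... | yes _ = 1#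
  ... | no _ = 0#
  δ-self : ∀ i → δ i i ≡ 1#
  δ-self i with i Finₚ.≟ i
  ... | yes _ = refl
  ... | no ne = ⊥-elim (ne refl)
  δ-other : ∀ {i j} → ¬ i ≡ j → δ i j ≡ 0#
  δ-other {i} {j} ne with i Finₚ.≟ j
  ... | yes e = ⊥-elim (ne e)
  ... | no _ = refl
  linΠ-single : ∀ c i → (∀ j → ¬ j ≡ i → c j R₀.≈ 0#) → linΠ c ≈V (c i ·V σ i)
  linΠ-single c i z l = go {n} (λ j → (c j ·V σ j)) i (λ j ne l → R₀.trans (R₀.*-congʳ (z j ne)) (R₀.zeroˡ _)) l
    where
    go0 : ∀ {k} (s : Fin k → V) → (∀ j → s j ≈V 0V) → sumV s ≈V 0V
    go0 {zero} s z = St.~Vrefl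
    go0 {suc k} s z l = R₀.trans (R₀.+-cong (z zero l) (go0 (s ∘ suc) (z ∘ suc) l)) (R₀.+-identityˡ _)
    go : ∀ {k} (s : Fin k → V) i → (∀ j → ¬ j ≡ i → s j ≈V 0V) → sumV s ≈V s i
    go s zero z l = R₀.trans (R₀.+-congˡ (go0 (s ∘ suc) (λ j → z (suc j) λ ()) l)) (R₀.+-identityʳ _)
    go s (suc i) z l = R₀.trans (R₀.+-cong (z zero (λ ()) l) (go (s ∘ suc) i (λ j ne → z (suc j) (λ { refl → ne refl })) l)) (R₀.+-identityˡ _)
  σ-lin : ∀ i → σ i ≈V linΠ (δ i)
  σ-lin i l = R₀.sym (R₀.trans (linΠ-single (δ i) i (λ j ne → R₀.reflexive (δ-other (ne ∘ sym))) l) (R₀.trans (R₀.*-congʳ (R₀.reflexive (δ-self i))) (R₀.*-identityˡ _)))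

  cf : Fin M → Fin n → Carrier
  cf j = proj₁ (simp-sign j)
  Φ-lin : ∀ j → Φ j ≈V linΠ (cf j)
  Φ-lin j = proj₁ (proj₂ (simp-sign j))
  abstract
    -- Decidable because `simp-sign` returns a disjunction; sealed so that later goals never unfold
    -- into its witnesses.
    pos : Fin M → Bool
    pos j with proj₂ (proj₂ (simp-sign j))
    ... | inj₁ _ = true
    ... | inj₂ _ = false
  Pos : Fin M → Set
  Pos j = pos j ≡ true
  Neg : Fin M → Set
  Neg j = pos j ≡ false
  abstract
    Pos-Nn : ∀ j → Pos j → ∀ i → Nn (cf j i)
    Pos-Nn j p i with proj₂ (proj₂ (simp-sign j))
    ... | inj₁ q = return (q i)
    Pos-IsPos : ∀ j → Pos j → IsPos (Φ j)
    Pos-IsPos j p with proj₂ (proj₂ (simp-sign j))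
    ... | inj₁ q = cf j , Φ-lin j , q
    Neg-Nn : ∀ j → Neg j → ∀ i → Nn (- cf j i)
    Neg-Nn j p i with proj₂ (proj₂ (simp-sign j))
    ... | inj₂ q = Nn-resp (+-identityˡ _) (≤⇒Nn (q i))
  cf-uniq : ∀ j c → Φ j ~V linΠ c → ∀ i → cf j i ~ c i
  cf-uniq j c e = linΠ-uniq (cf j) c (~Vtrans (~Vsym (↑V (Φ-lin j))) e)
  cf-nz : ∀ j → ¬ (∀ i → cf j i ~ 0#)
  cf-nz j z = ↓V (~Vtrans (↑V (Φ-lin j)) (~Vtrans (linΠ-cong z) linΠ-0)) (nonzero j)
  Nn⇒Pos : ∀ j c → Φ j ~V linΠ c → (∀ i → Nn (c i)) → Pos j
  Nn⇒Pos j c e nn with pos j Bool.≟ true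
  ... | yes p = p
  ... | no np = ⊥-elim (cf-nz j (λ i → Nn-antisym (Nn-resp (~sym (cf-uniq j c e i)) (nn i)) (Neg-Nn j (¬-not np) i)))
  IsPos⇒Pos : ∀ j → IsPos (Φ j) → Pos j
  IsPos⇒Pos j (c , e , nn) = Nn⇒Pos j c (↑V e) (λ i → return (nn i))
  Pos-simp : ∀ i → Pos (simp i)
  Pos-simp i = Nn⇒Pos (simp i) (δ i) (↑V (σ-lin i)) nn
    where
    nn : ∀ j → Nn (δ i j)
    nn j with i Finₚ.≟ j
    ... | yes _ = Nn-1
    ... | no _ = Nn-0
  Pos-Neg : ∀ {j} → Pos j → Neg j → ⊥
  Pos-Neg p q with trans (sym p) q
  ... | ()
  Neg⇒ : ∀ {j} → ¬ Pos j → Neg j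
  Neg⇒ = ¬-not
  Pos⇒ : ∀ {j} → ¬ Neg j → Pos j
  Pos⇒ = ¬-not
  Pos⊎Neg : ∀ j → Pos j ⊎ Neg j
  Pos⊎Neg j with pos j
  ... | true = inj₁ refl
  ... | false = inj₂ refl
  Neg⇒Pos-neg : ∀ {j} → Neg j → Pos (neg j)
  Neg⇒Pos-neg {j} q = Nn⇒Pos (neg j) (λ i → - cf j i) (~Vtrans (Φ-neg~ j) (~Vtrans (negV-cong (↑V (Φ-lin j))) (linΠ-neg (cf j)))) (Neg-Nn j q)
  Pos⇒Neg-neg : ∀ {j} → Pos j → Neg (neg j)
  Pos⇒Neg-neg {j} p = Neg⇒ λ q → cf-nz j (λ i → Nn-antisym (Pos-Nn j p i)
    (Nn-resp (cf-uniq (neg j) (λ i → - cf j i) (~Vtrans (Φ-neg~ j) (~Vtrans (negV-cong (↑V (Φ-lin j))) (linΠ-neg (cf j)))) i) (Pos-Nn (neg j) q i)))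
  simp-inj : ∀ {i j} → simp i ≡ simp j → i ≡ j
  simp-inj {i} {j} e with i Finₚ.≟ j
  ... | yes p = p
  ... | no ne = ⊥-elim (1≁0 (~trans (~reflexive (sym (δ-self i))) (~trans (linΠ-uniq (δ i) (δ j) (~Vtrans (~Vsym (↑V (σ-lin i))) (~Vtrans (λ l → ~reflexive (cong (λ x → Φ x l) e)) (↑V (σ-lin j)))) i) (~reflexive (δ-other (ne ∘ sym))))))

  s : Fin n → Fin M → Fin M
  s i = ref (simp i)

  cf-s₀ : ∀ i j l → ¬ l ≡ i → cf (s i j) l R₀.≈ cf j l
  cf-s₀ i j l ne = R₀.trans (linΠ-uniq₀ (cf (s i j)) (λ l → cf j l + (- (k * δ i l))) (St.~Vtrans (St.~Vsym (Φ-lin (s i j))) eq) l)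
      (R₀.trans (R₀.+-congˡ (R₀.-‿cong (R₀.trans (R₀.*-congˡ (R₀.reflexive (δ-other (ne ∘ sym)))) (R₀.zeroʳ _)))) (St.solve 1 (λ x → x St.:+ (St.:- St.:0) St.:= x) R₀.refl (cf j l)))
    where
    k = St.coef (σ i) (Φ j)
    kσ : (k ·V σ i) ≈V linΠ (λ l → k * δ i l)
    kσ l = R₀.sym (R₀.trans (linΠ-single (λ l → k * δ i l) i (λ j ne → R₀.trans (R₀.*-congˡ (R₀.reflexive (δ-other (ne ∘ sym)))) (R₀.zeroʳ _)) l)
      (R₀.*-congʳ (R₀.trans (R₀.*-congˡ (R₀.reflexive (δ-self i))) (R₀.*-identityʳ _))))
    eq : Φ (s i j) ≈V linΠ (λ l → cf j l + (- (k * δ i l)))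
    eq = St.~Vtrans (Φ-ref (simp i) j) (St.~Vtrans (St.+V-cong (Φ-lin j) (St.negV-cong kσ)) (linΠ-+neg₀ (cf j) (λ l → k * δ i l)))
  cf-s : ∀ i j l → ¬ l ≡ i → cf (s i j) l ~ cf j l
  cf-s i j l ne = ↑ (cf-s₀ i j l ne)
  cf-neg₀ : ∀ j l → cf (neg j) l R₀.≈ - cf j l
  cf-neg₀ j = linΠ-uniq₀ (cf (neg j)) (λ l → - cf j l) (St.~Vtrans (St.~Vsym (Φ-lin (neg j))) (St.~Vtrans (Φ-neg j) (St.~Vtrans (St.negV-cong (Φ-lin j)) (linΠ-neg₀ (cf j)))))

  -- s_i alters only the coefficient at σ_i. If the image were negative, all other coefficients of
  -- the root would be both ≥ 0 and ≤ 0, so the root would be a multiple of σ_i, hence σ_i itself by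
  -- reducedness and positivity.
  s-Pos : ∀ i j → Pos j → ¬ j ≡ simp i → Pos (s i j)
  s-Pos i j p ne = Pos⇒ λ q → ne (decidable-stable (j Finₚ.≟ simp i) (¬¬-Fin (zeros q) >>= λ z → ↓V (multiple z) >>= λ e → return (case-red (reduced (simp i) j (cf j i) e) e)))
    where
    zeros : Neg (s i j) → ∀ l → ¬ ¬ (¬ l ≡ i → cf j l ~ 0#)
    zeros q l = return λ ne → Nn-antisym (Pos-Nn j p l) (Nn-resp (-‿cong (cf-s i j l ne)) (Neg-Nn (s i j) q l))
    multiple : (∀ l → ¬ l ≡ i → cf j l ~ 0#) → Φ j ~V (cf j i ·V σ i)
    multiple z = ~V-stable (¬¬-Fin (λ l → em {A = l ≡ i} >>= λ { (yes e) → return (λ ne → ⊥-elim (ne e)) ; (no ne) → z l ne >>= λ e → return (λ _ → e) }) >>= λ z' →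
      return (↑V (St.~Vtrans (Φ-lin j) (linΠ-single (cf j) i z'))))
    case-red : (cf j i R₀.≈ 1#) ⊎ (cf j i R₀.≈ - 1#) → Φ j ≈V (cf j i ·V σ i) → j ≡ simp i
    case-red (inj₁ e) f = Φ-inj _ _ (St.~Vtrans f (λ l → R₀.trans (R₀.*-congʳ e) (R₀.*-identityˡ _)))
    case-red (inj₂ e) f = ⊥-elim (1≁0 (Nn-antisym Nn-1 (Nn-resp (↑ e) (Pos-Nn j p i))))
  s-s : ∀ i j → s i (s i j) ≡ j
  s-s i = ref-ref (simp i)
  Pos-neg-flip : ∀ {i j} → Pos j → Neg (s i j) → j ≡ simp i
  Pos-neg-flip {i} {j} p q with j Finₚ.≟ simp i
  ... | yes e = e
  ... | no ne = ⊥-elim (Pos-Neg (s-Pos i j p ne) q)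

  perp-all : ∀ x → (∀ i → x ∙ σ i ~ 0#) → x ∙ x ~ 0#
  perp-all x z = ~trans (∙-cong (~Vrefl {x}) (↑V (proj₂ (spans x)))) (~trans (∙-lin x (proj₁ (spans x)) Φ) (sumK-0 (λ j → ~trans (*-congˡ
    (~trans (∙-cong (~Vrefl {x}) (↑V (Φ-lin j))) (~trans (∙-lin x (cf j) σ) (sumK-0 (λ i → ~trans (*-congˡ (z i)) (zeroʳ _)))))) (zeroʳ _))))
  perp-all-V : ∀ x → (∀ i → x ∙ σ i ~ 0#) → x ~V 0V
  perp-all-V x z = ∙-def x (perp-all x z)

  -- A fundamental weight ω_i. The n - 1 other simple roots have a common orthogonal vector; as the
  -- simple roots span, it cannot be orthogonal to σ_i as well and can be rescaled.
  dual : ∀ i → ¬ ¬ ∃ λ x → (∀ j → ¬ j ≡ i → x ∙ σ j ~ 0#) × (coef (σ i) x ~ 1#)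
  dual i = common-perp L len >>= λ { (x , nz , perp) →
      let c = coef (σ i) x
          p : ∀ j → ¬ j ≡ i → x ∙ σ j ~ 0#
          p j ne = All.lookup (Allₚ.map⁻ perp) (∈ₚ.∈-filter⁺ P? (∈ₚ.∈-allFin j) ne)
          c≁0 : ¬ (c ~ 0#)
          c≁0 = λ e → nz (perp-all x (λ j → ~-stable (em {A = j ≡ i} >>= λ
            { (no ne) → return (p j ne)
            ; (yes refl) → return (cancel two≁0 (~trans (~sym (coef-∙ {σ i} (Φ-NZ (simp i)) x)) (~trans (*-congʳ e) (zeroˡ _)))) })))
      in return ((c ⁻¹ ·V x) , (λ j ne → ~trans (∙-·ˡ (c ⁻¹) x (σ j)) (~trans (*-congˡ (p j ne)) (zeroʳ _))) ,
        ~trans (*-congʳ (*-congˡ (∙-·ˡ (c ⁻¹) x (σ i)))) (~trans (solve 4 (λ t k p r → (t :* (k :* p)) :* r := k :* ((t :* p) :* r)) ~refl two (c ⁻¹) (x ∙ σ i) ((σ i ∙ σ i) ⁻¹))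
          (~trans (*-comm (c ⁻¹) c) (return (⁻¹-inverse c (λ e → c≁0 (↑ e))))))) }
    where
    open OrderedField F using (⁻¹-inverse) renaming (_⁻¹ to infix 21 _⁻¹)
    P? = λ j → ¬? (j Finₚ.≟ i)
    L = map σ (filter P? (allFin n))
    len : length L ℕ.< n
    len = ℕₚ.≤-trans (ℕₚ.≤-trans (ℕ.s≤s (ℕₚ.≤-reflexive (Listₚ.length-map σ (filter P? (allFin n))))) (Listₚ.filter-notAll P? (allFin n) (lose (∈ₚ.∈-allFin i) (λ ne → ne refl)))) (ℕₚ.≤-reflexive (Listₚ.length-tabulate id))

-- Iteration and counting.

iter : ∀ {A : Set} → (A → A) → ℕ → A → A
iter f zero x = x
iter f (suc e) x = iter f e (f x)

iter-comm : ∀ {A : Set} (f : A → A) e x → iter f e (f x) ≡ f (iter f e x)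
iter-comm f zero x = refl
iter-comm f (suc e) x = iter-comm f e (f x)

iter-+ : ∀ {A : Set} (f : A → A) d e x → iter f (d ℕ.+ e) x ≡ iter f d (iter f e x)
iter-+ f zero e x = refl
iter-+ f (suc d) e x = trans (iter-+ f d e (f x)) (cong (iter f d) (iter-comm f e x))

iter-inj : ∀ {A : Set} (f : A → A) → (∀ {x y} → f x ≡ f y → x ≡ y) → ∀ e {x y} → iter f e x ≡ iter f e y → x ≡ y
iter-inj f inj zero p = p
iter-inj f inj (suc e) p = inj (iter-inj f inj e p)

count : ∀ {k} → (Fin k → Bool) → ℕ
count {zero} f = 0
count {suc k} f = (if f zero then 1 else 0) ℕ.+ count (f ∘ suc)

private
  bit-≤ : ∀ {a b} → (a ≡ true → b ≡ true) → (if a then 1 else 0) ℕ.≤ (if b then 1 else 0)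
  bit-≤ {false} p = ℕ.z≤n
  bit-≤ {true} {false} p with p refl
  ... | ()
  bit-≤ {true} {true} p = ℕₚ.≤-refl

count-≤ : ∀ {k} (f g : Fin k → Bool) → (∀ i → f i ≡ true → g i ≡ true) → count f ℕ.≤ count g
count-≤ {zero} f g p = ℕ.z≤n
count-≤ {suc k} f g p = ℕₚ.+-mono-≤ (bit-≤ (p zero)) (count-≤ (f ∘ suc) (g ∘ suc) (p ∘ suc))

count-< : ∀ {k} (f g : Fin k → Bool) → (∀ i → f i ≡ true → g i ≡ true) → ∀ i → f i ≡ false → g i ≡ true → count f ℕ.< count g
count-< {suc k} f g p zero a b rewrite a | b = ℕ.s≤s (count-≤ (f ∘ suc) (g ∘ suc) (p ∘ suc))
count-< {suc k} f g p (suc i) a b = ℕₚ.+-mono-≤-< (bit-≤ (p zero)) (count-< (f ∘ suc) (g ∘ suc) (p ∘ suc) i a b)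

-- Words in reflections, the deletion argument, fixed vectors and orbits of γ.

module Reflections (F : OrderedField) (n : ℕ) (D : BipRootSystem F n) where
  open RootSystem F n D public

  -- Group elements compared as permutations of the finitely many roots, which is decidable. Since
  -- the roots span, this determines the linear map.
  _≋_ : Word → Word → Set
  u ≋ v = ∀ j → actI u j ≡ actI v j

  _≋?_ : ∀ u v → Dec (u ≋ v)
  u ≋? v = Finₚ.all? (λ j → actI u j Finₚ.≟ actI v j)

  ≋⇒≈ : ∀ {u v} → u ≋ v → ∀ x → act u x ≈V act v x
  ≋⇒≈ {u} {v} e x = St.~Vtrans (expand u) (St.~Vtrans (St.sumV-cong (λ j → St.·V-cong {u = act u (Φ j)} R₀.refl
      (St.~Vtrans (St.~Vsym (Φ-act u j)) (St.~Vtrans (λ l → R₀.reflexive (cong (λ k → Φ k l) (e j))) (Φ-act v j))))) (St.~Vsym (expand v)))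
    where
    c = proj₁ (spans x)
    expand : ∀ w → act w x ≈V sumV (λ j → c j ·V act w (Φ j))
    expand w = St.~Vtrans (St.actV-cong (map Φ w) (proj₂ (spans x))) (St.actV-lin (map Φ w) c Φ)

  ≈⇒≋ : ∀ {u v} → (∀ x → act u x ~V act v x) → u ≋ v
  ≈⇒≋ {u} {v} e j = Φ-inj~ (~Vtrans (↑V (Φ-act u j)) (~Vtrans (e (Φ j)) (~Vsym (↑V (Φ-act v j)))))

  ref-actI : ∀ w a k → ref (actI w a) k ≡ actI w (ref a (actI (reverse w) k))
  ref-actI [] a k = refl
  ref-actI (b ∷ w) a k = trans (ref-conj b (actI w a) k) (cong (ref b) (trans (ref-actI w a (ref b k))
    (cong (λ x → actI w (ref a x)) (trans (sym (actI-++ (reverse w) (b ∷ []) k)) (cong (λ v → actI v k) (sym (Listₚ.unfold-reverse b w)))))))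

  sact : List (Fin n) → Fin M → Fin M
  sact v = actI (map simp v)

  -- The inverse of `sact v`, consuming letters from the left so that the root can be followed along
  -- prefixes of the word.
  walk : List (Fin n) → Fin M → Fin M
  walk [] j = j
  walk (i ∷ v) j = walk v (s i j)

  sact-walk : ∀ v j → sact v (walk v j) ≡ j
  sact-walk [] j = refl
  sact-walk (i ∷ v) j = trans (cong (s i) (sact-walk v (s i j))) (s-s i j)
  walk-sact : ∀ v j → walk v (sact v j) ≡ j
  walk-sact [] j = refl
  walk-sact (i ∷ v) j = trans (cong (walk v) (s-s i (sact v j))) (walk-sact v j)
  walk-++ : ∀ u v j → walk (u ++ v) j ≡ walk v (walk u j)
  walk-++ [] v j = refl
  walk-++ (i ∷ u) v j = walk-++ u v (s i j)
  sact-++ : ∀ u v j → sact (u ++ v) j ≡ sact u (sact v j)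
  sact-++ u v j = trans (cong (λ w → actI w j) (Listₚ.map-++ simp u v)) (actI-++ (map simp u) (map simp v) j)
  sact-inj : ∀ v {j k} → sact v j ≡ sact v k → j ≡ k
  sact-inj v = actI-inj (map simp v)
  walk-inj : ∀ v {j k} → walk v j ≡ walk v k → j ≡ k
  walk-inj v {j} {k} e = trans (sym (sact-walk v j)) (trans (cong (sact v) e) (sact-walk v k))
  walk-rev : ∀ v j → walk v j ≡ actI (reverse (map simp v)) j
  walk-rev v j = trans (sym (actI-rev (map simp v) (walk v j))) (cong (actI (reverse (map simp v))) (sact-walk v j))
  sact-neg : ∀ v j → sact v (neg j) ≡ neg (sact v j)
  sact-neg v = actI-neg (map simp v)
  walk-neg : ∀ v j → walk v (neg j) ≡ neg (walk v j)
  walk-neg [] j = refl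
  walk-neg (i ∷ v) j = trans (cong (walk v) (ref-neg (simp i) j)) (walk-neg v (s i j))

  -- s_i makes no positive root negative except σ_i, so a walk can leave Φ⁺ only at the simple root
  -- whose reflection is the next letter.
  sign-change : ∀ v j → Pos j → Neg (walk v j) → ∃ λ v₁ → ∃ λ i → ∃ λ v₂ → (v ≡ v₁ ++ i ∷ v₂) × (walk v₁ j ≡ simp i)
  sign-change [] j p q = ⊥-elim (Pos-Neg p q)
  sign-change (i ∷ v) j p q with j Finₚ.≟ simp i
  ... | yes e = [] , i , v , refl , e
  ... | no ne with sign-change v (s i j) (s-Pos i j p ne) q
  ... | v₁ , i′ , v₂ , e₁ , e₂ = i ∷ v₁ , i′ , v₂ , cong (i ∷_) e₁ , e₂

  -- The exchange rule s_i v = v R(v⁻¹σ_i); deletion follows when v⁻¹σ_i is the simple root of the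
  -- next letter.
  sact-ref : ∀ v i k → s i (sact v k) ≡ sact v (ref (walk v (simp i)) k)
  sact-ref v i k = trans (cong (λ a → ref a (sact v k)) (sym (sact-walk v (simp i))))
    (trans (ref-actI (map simp v) (walk v (simp i)) (sact v k)) (cong (λ x → sact v (ref (walk v (simp i)) x)) (actI-rev (map simp v) k)))

  Pos-pres : ∀ v → (∀ i → Pos (sact v (simp i))) → ∀ j → Pos j → Pos (sact v j)
  Pos-pres v p j q = Pos⇒ λ r → cf-nz j (λ i → vanish r i)
    where
    c = cf j
    -- Σ_i c_i cf(v σ_i) has nonnegative terms and nonpositive sum.
    expand : Φ (sact v j) ~V sumV (λ i → c i ·V Φ (sact v (simp i)))
    expand = ~Vtrans (↑V (Φ-act (map simp v) j)) (~Vtrans (act-cong (map simp v) (↑V (Φ-lin j))) (~Vtrans (actV-lin (map Φ (map simp v)) c σ)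
      (sumV-cong (λ i → ·V-cong {c = c i} {u = act (map simp v) (σ i)} ~refl (~Vsym (↑V (Φ-act (map simp v) (simp i))))))))
    lin : ∀ {k} (c : Fin k → Carrier) (f : Fin k → Fin M) → sumV (λ i → c i ·V Φ (f i)) ~V linΠ (λ l → sumK (λ i → c i * cf (f i) l))
    lin {zero} c f = ~Vsym linΠ-0
    lin {suc k} c f = ~Vtrans (+V-cong (·V-cong {c = c zero} ~refl (↑V (Φ-lin (f zero)))) (lin (c ∘ suc) (f ∘ suc))) (comb (c zero) (cf (f zero)) _)
      where
      comb : ∀ a d e → ((a ·V linΠ d) +V linΠ e) ~V linΠ (λ l → a * d l + e l)
      comb a d e = go {n} σ d e where
        go : ∀ {k} (s : Fin k → V) (d e : Fin k → Carrier) → ((a ·V sumV (λ i → d i ·V s i)) +V sumV (λ i → e i ·V s i)) ~V sumV (λ i → (a * d i + e i) ·V s i)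
        go {zero} s d e j = ~trans (+-identityʳ _) (zeroʳ a)
        go {suc k} s d e j = ~trans (solve 6 (λ a d s x e y → a :* (d :* s :+ x) :+ (e :* s :+ y) := (a :* d :+ e) :* s :+ (a :* x :+ y)) ~refl a (d zero) (s zero j) (sumV (λ i → d (suc i) ·V s (suc i)) j) (e zero) (sumV (λ i → e (suc i) ·V s (suc i)) j))
          (+-congˡ (go (s ∘ suc) (d ∘ suc) (e ∘ suc) j))
    coord : ∀ l → cf (sact v j) l ~ sumK (λ i → c i * cf (sact v (simp i)) l)
    coord = cf-uniq (sact v j) _ (~Vtrans expand (lin c (λ i → sact v (simp i))))
    term : ∀ i l → Nn (c i * cf (sact v (simp i)) l)
    term i l = Nn-* (Pos-Nn j q i) (Pos-Nn (sact v (simp i)) (p i) l)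
    vanish : Neg (sact v j) → ∀ i → c i ~ 0#
    vanish r i = ~-stable λ k → cf-nz (sact v (simp i)) (λ l → cancel k (sumK-Nn-0 (λ i → term i l)
      (Nn-antisym (sumK-Nn (λ i → term i l)) (Nn-resp (-‿cong (coord l)) (Neg-Nn (sact v j) r l))) i))

  -- Deletion: if v = k ∷ v′ keeps Π positive, then v′⁻¹ σ_k < 0, so two letters cancel.
  Pos-pres⇒id : ∀ v → (∀ i → Pos (sact v (simp i))) → ∀ j → sact v j ≡ j
  Pos-pres⇒id v = go v (<-wellFounded (length v))
    where
    go : ∀ v → Acc ℕ._<_ (length v) → (∀ i → Pos (sact v (simp i))) → ∀ j → sact v j ≡ j
    go [] _ p j = refl
    go (k ∷ v′) (acc rs) p j = trans (same j) (go (v₁ ++ v₂) (rs len) (λ i → trans (cong pos (sym (same (simp i)))) (p i)) j)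
      where
      neg-walk : Neg (walk v′ (simp k))
      neg-walk = Neg⇒ λ q → Pos-Neg (Pos-pres (k ∷ v′) p _ q) (trans (cong (pos ∘ s k) (sact-walk v′ (simp k))) (Pos⇒Neg-neg (Pos-simp k)))
      sc = sign-change v′ (simp k) (Pos-simp k) neg-walk
      v₁ = proj₁ sc
      i = proj₁ (proj₂ sc)
      v₂ = proj₁ (proj₂ (proj₂ sc))
      split : v′ ≡ v₁ ++ i ∷ v₂
      split = proj₁ (proj₂ (proj₂ (proj₂ sc)))
      hit : walk v₁ (simp k) ≡ simp i
      hit = proj₂ (proj₂ (proj₂ (proj₂ sc)))
      same : ∀ j → sact (k ∷ v′) j ≡ sact (v₁ ++ v₂) j
      same j = trans (cong (λ v → s k (sact v j)) split) (trans (cong (s k) (sact-++ v₁ (i ∷ v₂) j))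
        (trans (sact-ref v₁ k (sact (i ∷ v₂) j)) (trans (cong (λ a → sact v₁ (ref a (sact (i ∷ v₂) j))) hit)
          (trans (cong (sact v₁) (s-s i (sact v₂ j))) (sym (sact-++ v₁ v₂ j))))))
      len : length (v₁ ++ v₂) ℕ.< length (k ∷ v′)
      len = ℕ.s≤s (ℕₚ.≤-trans (ℕₚ.≤-reflexive (Listₚ.length-++ v₁)) (ℕₚ.≤-trans (ℕₚ.+-monoʳ-≤ (length v₁) (ℕₚ.n≤1+n _))
        (ℕₚ.≤-reflexive (sym (trans (cong length split) (Listₚ.length-++ v₁))))))

  γL : List (Fin n)
  γL = allFin n
  γI γ⁻ : Fin M → Fin M
  γI = sact γL
  γ⁻ = walk γL
  γγ⁻ : ∀ j → γI (γ⁻ j) ≡ j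
  γγ⁻ = sact-walk γL
  γ⁻γ : ∀ j → γ⁻ (γI j) ≡ j
  γ⁻γ = walk-sact γL

  -- Pair the equation with ω_i, i the first letter. The remaining letters fix ω_i, so only the
  -- multiple of σ_i subtracted by s_i survives, and it must vanish. Then x is fixed by the
  -- remaining word and orthogonal to σ_i.
  act-fix⇒perp : ∀ L → Unique L → ∀ x → act (map simp L) x ~V x → All (λ i → x ∙ σ i ~ 0#) L
  act-fix⇒perp [] _ x e = []
  act-fix⇒perp (i ∷ L) (i∉ ∷ uq) x e = x⟂σᵢ ∷ act-fix⇒perp L uq x y~x
    where
    y = act (map simp L) x
    coef0 : coef (σ i) y ~ 0#
    coef0 = ~-stable (dual i >>= λ (w , perp , one) → return (cancel-w w perp one))
      where
      open ~-Reasoning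
      cancel-w : ∀ w → (∀ j → ¬ j ≡ i → w ∙ σ j ~ 0#) → coef (σ i) w ~ 1# → coef (σ i) y ~ 0#
      cancel-w w perp one = cancel w≁0 (begin
        (w ∙ σ i) * coef (σ i) y ≈⟨ solve 3 (λ p c q → p :* c := q :+ (:- (q :+ (:- (c :* p))))) ~refl (w ∙ σ i) (coef (σ i) y) (w ∙ y) ⟩
        w ∙ y + (- (w ∙ y + (- (coef (σ i) y * (w ∙ σ i))))) ≈⟨ +-congˡ (-‿cong (~sym (Refl-∙ʳ (σ i) y w))) ⟩
        w ∙ y + (- (w ∙ Refl (σ i) y)) ≈⟨ +-cong wy (-‿cong (∙-cong (~Vrefl {w}) e)) ⟩
        w ∙ x + (- (w ∙ x)) ≈⟨ -‿inverseʳ _ ⟩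
        0# ∎)
        where
        w≁0 : ¬ (w ∙ σ i ~ 0#)
        w≁0 z = 1≁0 (~trans (~sym one) (coef-0 (σ i) w z))
        w-fix : act (map simp L) w ~V w
        w-fix = actV-fix (map Φ (map simp L)) (Allₚ.map⁺ (Allₚ.map⁺ (All.map (λ {j} ne → perp j (λ q → ne (sym q))) i∉)))
        wy : w ∙ y ~ w ∙ x
        wy = ~trans (∙-cong (~Vsym w-fix) (~Vrefl {y})) (act-iso (map simp L) w x)
    x~y : Refl (σ i) y ~V y
    x~y j = ~trans (+-congˡ (-‿cong (~trans (*-congʳ coef0) (zeroˡ _)))) (~trans (+-congˡ -0#≈0#) (+-identityʳ _))
    y~x : y ~V x
    y~x = ~Vtrans (~Vsym x~y) e
    x⟂σᵢ : x ∙ σ i ~ 0#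
    x⟂σᵢ = ~trans (∙-cong (~Vsym y~x) (~Vrefl {σ i})) (cancel two≁0 (~trans (~sym (coef-∙ {σ i} (Φ-NZ (simp i)) y)) (~trans (*-congʳ coef0) (zeroˡ _))))

  γ-fix : ∀ x → act γW x ~V x → x ~V 0V
  γ-fix x e = perp-all-V x (λ i → All.lookup (act-fix⇒perp γL (Uniqueₚ.allFin⁺ n) x e) (∈ₚ.∈-allFin i))
  γ⁻-fix : ∀ x → act (reverse γW) x ~V x → x ~V 0V
  γ⁻-fix x e = γ-fix x (~Vtrans (act-cong γW (~Vsym e)) (~Vtrans (λ l → ~reflexive (cong (λ w → act w (act (reverse γW) x) l) (sym (Listₚ.reverse-involutive γW)))) (act-rev (reverse γW) x)))

  length-γW : length γW ≡ n
  length-γW = trans (Listₚ.length-map simp (allFin n)) (Listₚ.length-tabulate id)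

  -- With fewer than n reflections, some nonzero vector would be orthogonal to all their roots,
  -- hence fixed by γ.
  γ-shortest : ∀ t → t ≋ γW → n ℕ.≤ length t
  γ-shortest t e = ℕₚ.≮⇒≥ λ lt → common-perp (map Φ t) (ℕₚ.≤-trans (ℕₚ.≤-reflexive (cong suc (Listₚ.length-map Φ t))) lt) (λ (x , nz , perp) →
    nz (~trans (∙-cong (γ-fix x (~Vtrans (~Vsym (↑V (≋⇒≈ {t} {γW} e x))) (actV-fix (map Φ t) perp))) (~Vrefl {x})) (∙-0ˡ x)))

  -- The sum over an orbit is fixed by g, hence 0, so it is not a sum of positive roots.
  orbit-Neg : ∀ g f → (∀ j → f j ≡ actI g j) → (∀ x → act g x ~V x → x ~V 0V) → ∀ j → ∃ λ e → Neg (iter f e j)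
  -- M + 1 exponents suffice: among so many iterates of one index two coincide, which closes the
  -- orbit.
  orbit-Neg g f fg fix j with Finₚ.any? (λ (e : Fin (suc M)) → pos (iter f (toℕ e) j) Bool.≟ false)
  ... | yes (e , q) = toℕ e , q
  ... | no none = ⊥-elim (bad (Finₚ.pigeonhole (ℕₚ.n<1+n M) (λ e → iter f (toℕ e) j)))
    where
    f-inj : ∀ {x y} → f x ≡ f y → x ≡ y
    f-inj {x} {y} p = actI-inj g (trans (sym (fg x)) (trans p (fg y)))
    allPos : ∀ e → e ℕ.≤ M → Pos (iter f e j)
    allPos e le = Pos⇒ λ q → none (fromℕ< (ℕ.s≤s le) , trans (cong (λ e → pos (iter f e j)) (Finₚ.toℕ-fromℕ< (ℕ.s≤s le))) q)
    S : ℕ → V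
    S zero = 0V
    S (suc c) = Φ (iter f c j) +V S c
    C : ℕ → Fin n → Carrier
    C zero l = 0#
    C (suc c) l = cf (iter f c j) l + C c l
    S-lin : ∀ c → S c ~V linΠ (C c)
    S-lin zero = ~Vsym linΠ-0
    S-lin (suc c) = ~Vtrans (+V-cong (↑V (Φ-lin (iter f c j))) (S-lin c)) (go {n} σ (cf (iter f c j)) (C c))
      where
      go : ∀ {k} (s : Fin k → V) (d e : Fin k → Carrier) → (sumV (λ i → d i ·V s i) +V sumV (λ i → e i ·V s i)) ~V sumV (λ i → (d i + e i) ·V s i)
      go {zero} s d e j = +-identityʳ 0#
      go {suc k} s d e j = ~trans (solve 5 (λ d s x e y → (d :* s :+ x) :+ (e :* s :+ y) := (d :+ e) :* s :+ (x :+ y)) ~refl (d zero) (s zero j) (sumV (λ i → d (suc i) ·V s (suc i)) j) (e zero) (sumV (λ i → e (suc i) ·V s (suc i)) j))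
          (+-congˡ (go (s ∘ suc) (d ∘ suc) (e ∘ suc) j))
    C-Nn : ∀ c → c ℕ.≤ suc M → ∀ l → Nn (C c l)
    C-Nn zero _ l = Nn-0
    C-Nn (suc c) (ℕ.s≤s le) l = Nn-+ (Pos-Nn (iter f c j) (allPos c le) l) (C-Nn c (ℕₚ.m≤n⇒m≤1+n le) l)
    telescope : ∀ c → (act g (S c) +V Φ j) ~V S (suc c)
    telescope zero l = ~trans (+-congʳ (actV-0 (map Φ g) l)) (+-comm _ _)
    telescope (suc c) l = ~trans (+-congʳ (~trans (actV-+ (map Φ g) (Φ (iter f c j)) (S c) l) (+-congʳ (~trans (~sym (↑ (Φ-act g (iter f c j) l))) (~reflexive (cong (λ k → Φ k l) (trans (sym (fg (iter f c j))) (sym (iter-comm f c j)))))))))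
      (~trans (+-assoc _ _ _) (+-congˡ (telescope c l)))
    S-fixed : ∀ c → iter f c j ≡ j → act g (S c) ~V S c
    S-fixed c e l = begin
      act g (S c) l ≈⟨ solve 2 (λ a b → a := (a :+ b) :+ (:- b)) ~refl (act g (S c) l) (Φ j l) ⟩
      (act g (S c) l + Φ j l) + (- Φ j l) ≈⟨ +-congʳ (telescope c l) ⟩
      (Φ (iter f c j) l + S c l) + (- Φ j l) ≈⟨ +-congʳ (+-congʳ (~reflexive (cong (λ k → Φ k l) e))) ⟩
      (Φ j l + S c l) + (- Φ j l) ≈⟨ solve 2 (λ a b → (a :+ b) :+ (:- a) := b) ~refl (Φ j l) (S c l) ⟩
      S c l ∎
      where open ~-Reasoning
    periodic : ∀ c → suc c ℕ.≤ suc M → iter f (suc c) j ≡ j → ⊥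
    periodic c (ℕ.s≤s le) e = cf-nz (iter f c j) (λ l → Nn-+-0 (Pos-Nn (iter f c j) (allPos c le) l) (C-Nn c (ℕₚ.m≤n⇒m≤1+n le) l)
      (linΠ-indep (C (suc c)) (~Vtrans (~Vsym (S-lin (suc c))) (fix (S (suc c)) (S-fixed (suc c) e))) l))
    bad : (∃ λ a → ∃ λ b → a Fin.< b × iter f (toℕ a) j ≡ iter f (toℕ b) j) → ⊥
    bad (a , b , lt , e) = periodic c (ℕₚ.≤-trans (ℕₚ.≤-trans (ℕₚ.m≤n+m (suc c) (toℕ a)) (ℕₚ.≤-reflexive (sym b≡))) (ℕₚ.<⇒≤ (Finₚ.toℕ<n b))) (sym (iter-inj f f-inj (toℕ a) (trans e (trans (cong (λ x → iter f x j) b≡) (iter-+ f (toℕ a) (suc c) j)))))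
      where
      c = toℕ b ℕ.∸ suc (toℕ a)
      b≡ : toℕ b ≡ toℕ a ℕ.+ suc c
      b≡ = sym (trans (ℕₚ.+-suc (toℕ a) c) (ℕₚ.m+[n∸m]≡n lt))

  γI-Neg : ∀ j → ∃ λ e → Neg (iter γI e j)
  γI-Neg = orbit-Neg γW γI (λ j → refl) γ-fix
  γ⁻-Neg : ∀ j → ∃ λ e → Neg (iter γ⁻ e j)
  γ⁻-Neg = orbit-Neg (reverse γW) γ⁻ (walk-rev γL) γ⁻-fix

  γrep : ℕ → List (Fin n)
  γrep zero = []
  γrep (suc e) = γL ++ γrep e
  walk-γrep : ∀ e j → walk (γrep e) j ≡ iter γ⁻ e j
  walk-γrep zero j = refl
  walk-γrep (suc e) j = trans (walk-++ γL (γrep e) j) (walk-γrep e (γ⁻ j))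

  -- Some power of γ⁻¹ makes the root negative, and along the corresponding word it must pass
  -- through a simple root.
  Pos⇒conj-simp : ∀ j → Pos j → ∃ λ v → ∃ λ i → j ≡ sact v (simp i)
  Pos⇒conj-simp j p = let e , q = γ⁻-Neg j
                          v₁ , i , _ , _ , h = sign-change (γrep e) j p (trans (cong pos (walk-γrep e j)) q)
                      in v₁ , i , trans (sym (sact-walk v₁ j)) (cong (sact v₁) h)

  -- R(vσ_i) = v s_i v⁻¹, so the simple reflections generate the reflection group.
  ref-simple : ∀ j → ∃ λ v → ∀ k → ref j k ≡ sact v k
  ref-simple j with Pos⊎Neg j
  ... | inj₁ p = let v , i , e = Pos⇒conj-simp j p in v ++ i ∷ reverse v , λ k → trans (cong (λ a → ref a k) e) (trans (ref-actI (map simp v) (simp i) k)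
          (sym (trans (sact-++ v (i ∷ reverse v) k) (cong (λ w → sact v (s i (actI w k))) (Listₚ.reverse-map simp v)))))
  ... | inj₂ q = let v , i , e = Pos⇒conj-simp (neg j) (Neg⇒Pos-neg q) in v ++ i ∷ reverse v , λ k → trans (sym (ref-negˡ j k)) (trans (cong (λ a → ref a k) e) (trans (ref-actI (map simp v) (simp i) k)
          (sym (trans (sact-++ v (i ∷ reverse v) k) (cong (λ w → sact v (s i (actI w k))) (Listₚ.reverse-map simp v))))))

  word-simple : ∀ w → ∃ λ v → ∀ k → actI w k ≡ sact v k
  word-simple [] = [] , λ k → refl
  word-simple (a ∷ w) = let v₁ , e₁ = ref-simple a
                            v₂ , e₂ = word-simple w
                        in v₁ ++ v₂ , λ k → trans (e₁ (actI w k)) (trans (cong (sact v₁) (e₂ k)) (sym (sact-++ v₁ v₂ k)))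

  word-Pos-pres⇒id : ∀ w → (∀ i → Pos (actI w (simp i))) → w ≋ []
  word-Pos-pres⇒id w p j = let v , e = word-simple w in trans (e j) (Pos-pres⇒id v (λ i → trans (cong pos (sym (e (simp i)))) (p i)) j)

-- Roots orthogonal to fixed vectors, and the form χ.

module Carter (F : OrderedField) (n : ℕ) (D : BipRootSystem F n) where
  open Reflections F n D public

  -- Weak lexicographic positivity of the values u ∙ x, the zero sequence included. The double
  -- negation at every level makes it stable, so signs may be chosen classically.
  Lex : List V → V → Set
  Lex [] x = ⊤
  Lex (u ∷ us) x = ¬ ¬ ((Nn (u ∙ x) × ¬ (u ∙ x ~ 0#)) ⊎ ((u ∙ x ~ 0#) × Lex us x))

  Lex-stable : ∀ us {x} → ¬ ¬ Lex us x → Lex us x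
  Lex-stable [] p = tt
  Lex-stable (u ∷ us) p k = p (λ q → q k)

  Lex-resp : ∀ us {x y} → All (λ u → u ∙ x ~ u ∙ y) us → Lex us x → Lex us y
  Lex-resp [] [] p = tt
  Lex-resp (u ∷ us) (e ∷ es) p = p >>= λ
    { (inj₁ (a , b)) → return (inj₁ (Nn-resp e a , λ z → b (~trans e z)))
    ; (inj₂ (a , b)) → return (inj₂ (~trans (~sym e) a , Lex-resp us es b)) }

  Lex-perp : ∀ us {x} → All (λ u → u ∙ x ~ 0#) us → Lex us x
  Lex-perp [] [] = tt
  Lex-perp (u ∷ us) (e ∷ es) = return (inj₂ (e , Lex-perp us es))

  Lex-+ : ∀ us {x y} → Lex us x → Lex us y → Lex us (x +V y)
  Lex-+ [] p q = tt
  Lex-+ (u ∷ us) {x} {y} p q = p >>= λ p → q >>= λ q → return (add p q)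
    where
    A : V → Set
    A x = (Nn (u ∙ x) × ¬ (u ∙ x ~ 0#)) ⊎ ((u ∙ x ~ 0#) × Lex us x)
    add : A x → A y → A (x +V y)
    add (inj₁ (a , b)) q = inj₁ (Nn-resp (~sym (∙-+ʳ u x y)) (Nn-+ a (nn q)) , λ z → b (Nn-+-0 a (nn q) (~trans (~sym (∙-+ʳ u x y)) z)))
      where
      nn : A y → Nn (u ∙ y)
      nn (inj₁ (a , _)) = a
      nn (inj₂ (a , _)) = Nn-resp (~sym a) Nn-0
    add (inj₂ (a , _)) (inj₁ (c , d)) = inj₁ (Nn-resp (~sym e) c , λ z → d (~trans (~sym e) z))
      where
      e : u ∙ (x +V y) ~ u ∙ y
      e = ~trans (∙-+ʳ u x y) (~trans (+-congʳ a) (+-identityˡ _))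
    add (inj₂ (a , b)) (inj₂ (c , d)) = inj₂ (~trans (∙-+ʳ u x y) (~trans (+-cong a c) (+-identityˡ _)) , Lex-+ us b d)

  Lex-· : ∀ us {c x} → Nn c → Lex us x → Lex us (c ·V x)
  Lex-· us {c} {x} nn p = Lex-stable us (em {A = c ~ 0#} >>= λ
      { (yes z) → return (Lex-perp us (zero-scale us z)) ; (no nz) → return (scale us nz p) })
    where
    zero-scale : ∀ us → c ~ 0# → All (λ u → u ∙ (c ·V x) ~ 0#) us
    zero-scale us z = All.universal (λ u → ~trans (∙-·ʳ c u x) (~trans (*-congʳ z) (zeroˡ _))) us
    scale : ∀ us → ¬ (c ~ 0#) → Lex us x → Lex us (c ·V x)
    scale [] nz p = tt
    scale (u ∷ us) nz p = p >>= λ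
      { (inj₁ (a , b)) → return (inj₁ (Nn-resp (~sym (∙-·ʳ c u x)) (Nn-* nn a) , λ z → b (cancel nz (~trans (~sym (∙-·ʳ c u x)) z))))
      ; (inj₂ (a , b)) → return (inj₂ (~trans (∙-·ʳ c u x) (~trans (*-congˡ a) (zeroʳ _)) , scale us nz b)) }

  Lex-lin : ∀ us {k} (c : Fin k → Carrier) (f : Fin k → V) → (∀ i → Nn (c i)) → (∀ i → Lex us (f i)) → Lex us (sumV (λ i → c i ·V f i))
  Lex-lin us {zero} c f p q = Lex-perp us (All.universal (λ u → ∙-0ʳ u) us)
  Lex-lin us {suc k} c f p q = Lex-+ us (Lex-· us (p zero) (q zero)) (Lex-lin us (c ∘ suc) (f ∘ suc) (p ∘ suc) (q ∘ suc))

  Lex-total : ∀ us x → ¬ ¬ (Lex us x ⊎ Lex us (negV x))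
  Lex-total [] x = return (inj₁ tt)
  Lex-total (u ∷ us) x = em {A = u ∙ x ~ 0#} >>= λ
    { (yes z) → Lex-total us x >>= λ { (inj₁ p) → return (inj₁ (return (inj₂ (z , p))))
                                     ; (inj₂ p) → return (inj₂ (return (inj₂ (~trans (∙-negʳ u x) (~trans (-‿cong z) -0#≈0#) , p)))) }
    ; (no nz) → return (by-sign nz (Nn-total (u ∙ x))) }
    where
    by-sign : ¬ (u ∙ x ~ 0#) → Nn (u ∙ x) ⊎ Nn (- (u ∙ x)) → Lex (u ∷ us) x ⊎ Lex (u ∷ us) (negV x)
    by-sign nz (inj₁ p) = inj₁ (return (inj₁ (p , nz)))
    by-sign nz (inj₂ p) = inj₂ (return (inj₁ (Nn-resp (~sym (∙-negʳ u x)) p , λ z → nz (~trans (~sym (-‿involutive _)) (~trans (-‿cong (~trans (~sym (∙-negʳ u x)) z)) -0#≈0#)))))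

  Lex-antisym : ∀ us x → Lex us x → Lex us (negV x) → ¬ ¬ All (λ u → u ∙ x ~ 0#) us
  Lex-antisym [] x p q = return []
  Lex-antisym (u ∷ us) x p q = p >>= λ
    { (inj₁ (a , b)) → q >>= λ
       { (inj₁ (c , d)) → ⊥-elim (b (Nn-antisym a (Nn-resp (∙-negʳ u x) c)))
       ; (inj₂ (c , d)) → ⊥-elim (b (~trans (~sym (-‿involutive _)) (~trans (-‿cong (~trans (~sym (∙-negʳ u x)) c)) -0#≈0#))) }
    ; (inj₂ (a , b)) → q >>= λ
       { (inj₁ (c , d)) → ⊥-elim (d (~trans (∙-negʳ u x) (~trans (-‿cong a) -0#≈0#)))
       ; (inj₂ (c , d)) → Lex-antisym us x b d >>= λ r → return (a ∷ r) } }

  -- If no root is orthogonal to us, the roots that are lexicographically positive on us form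
  -- a positive system gΦ⁺ stable under w, so g⁻¹wg preserves Φ⁺ and w = 1.
  fixed⇒perp-root : ∀ us w → All (λ u → act w u ~V u) us → ¬ (w ≋ []) → ¬ ¬ ∃ λ b → All (λ u → u ∙ Φ b ~ 0#) us
  fixed⇒perp-root us w fixed w≢1 none = ¬¬-Fin (λ j → Lex-total us (Φ j)) (λ T → w≢1 (conclude T))
    where
    module _ (T : ∀ j → Lex us (Φ j) ⊎ Lex us (negV (Φ j))) where
      sg : Fin M → Bool
      sg j with T j
      ... | inj₁ _ = true
      ... | inj₂ _ = false
      sg-true : ∀ j → sg j ≡ true → Lex us (Φ j)
      sg-true j e with T j
      ... | inj₁ p = p
      sg-false : ∀ j → sg j ≡ false → Lex us (negV (Φ j))
      sg-false j e with T j
      ... | inj₂ p = p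
      excl : ∀ j → Lex us (Φ j) → Lex us (negV (Φ j)) → ⊥
      excl j p q = Lex-antisym us (Φ j) p q (λ a → none (j , a))
      -- The roots of vΦ⁺ with the wrong sign. As long as a simple root vσ_i of this chamber is
      -- wrong, passing to v s_i removes it from the set and adds nothing.
      D? : List (Fin n) → Fin M → Bool
      D? v k = not (sg k) ∧ pos (walk v k)
      chamber : ∀ v → Acc ℕ._<_ (count (D? v)) → ∃ λ v → ∀ i → sg (sact v (simp i)) ≡ true
      chamber v (acc rs) with Finₚ.any? (λ i → sg (sact v (simp i)) Bool.≟ false)
      ... | no all = v , λ i → ¬-not (λ q → all (i , q))
      ... | yes (i , q) = chamber (v ++ i ∷ []) (rs (count-< (D? (v ++ i ∷ [])) (D? v) sub (sact v (simp i)) out inn))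
        where
        walk′ : ∀ k → walk (v ++ i ∷ []) k ≡ s i (walk v k)
        walk′ k = walk-++ v (i ∷ []) k
        sub : ∀ k → D? (v ++ i ∷ []) k ≡ true → D? v k ≡ true
        sub k e = cong₂ _∧_ (∧-conicalˡ (not (sg k)) _ e) (Pos⇒ flipped)
          where
          sgf : sg k ≡ false
          sgf = not-injective (∧-conicalˡ (not (sg k)) _ e)
          p : Pos (s i (walk v k))
          p = trans (cong pos (sym (walk′ k))) (∧-conicalʳ (not (sg k)) _ e)
          -- The only root entering the positive system at this step is -vσ_i. It cannot be wrong
          -- too, since the sign would then contradict that of vσ_i.
          flipped : ¬ Neg (walk v k)
          flipped r = excl k (Lex-resp us (All.universal (λ u → ∙-cong (~Vrefl {u}) (λ l → ~trans (~sym (Φ-neg~ (sact v (simp i)) l)) (~reflexive (cong (λ x → Φ x l) (sym k≡))))) us) (sg-false (sact v (simp i)) q)) (sg-false k sgf)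
            where
            k≡ : k ≡ neg (sact v (simp i))
            k≡ = trans (sym (sact-walk v k)) (trans (cong (sact v) (trans (sym (neg-neg (walk v k))) (cong neg
                (trans (sym (s-s i (neg (walk v k)))) (trans (cong (s i) (trans (ref-neg (simp i) (walk v k)) (cong neg
                  (Pos-neg-flip p (trans (cong pos (s-s i (walk v k))) r))))) (trans (ref-neg (simp i) (simp i)) (neg-neg (simp i)))))))) (sact-neg v (simp i)))
        out : D? (v ++ i ∷ []) (sact v (simp i)) ≡ false
        out = trans (cong (λ x → not (sg (sact v (simp i))) ∧ pos x) (trans (walk′ (sact v (simp i))) (cong (s i) (walk-sact v (simp i)))))
          (trans (cong₂ (λ a b → not a ∧ b) q (Pos⇒Neg-neg (Pos-simp i))) refl)
        inn : D? v (sact v (simp i)) ≡ true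
        inn = cong₂ (λ a b → not a ∧ b) q (trans (cong pos (walk-sact v (simp i))) (Pos-simp i))
      conclude : w ≋ []
      conclude = let v , all = chamber [] (<-wellFounded _) in final v all
        where
        module _ (v : List (Fin n)) (all : ∀ i → sg (sact v (simp i)) ≡ true) where
          g = map simp v
          w′ : Word
          w′ = reverse g ++ w ++ g
          w′-walk : ∀ j → actI w′ j ≡ walk v (actI w (sact v j))
          w′-walk j = trans (actI-++ (reverse g) (w ++ g) j) (trans (cong (actI (reverse g)) (actI-++ w g j)) (sym (walk-rev v (actI w (sact v j)))))
          keeps : ∀ i → Pos (actI w′ (simp i))
          keeps i = Pos⇒ λ r → excl k Lk (Lnk r)
            where
            k = actI w (sact v (simp i))
            j = actI w′ (simp i)
            k≡ : k ≡ sact v j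
            k≡ = trans (sym (sact-walk v k)) (cong (sact v) (sym (w′-walk (simp i))))
            -- w is an isometry fixing every u, so u ∙ wβ = u ∙ β and lexicographic signs are
            -- invariant under w.
            Lk : Lex us (Φ k)
            Lk = Lex-resp us (All.map (λ {u} e → ~sym (~trans (∙-cong (~Vsym e) (↑V (Φ-act w (sact v (simp i))))) (act-iso w u (Φ (sact v (simp i)))))) fixed) (sg-true (sact v (simp i)) (all i))
            Lnk : Neg j → Lex us (negV (Φ k))
            Lnk r = Lex-resp us (All.universal (λ u → ∙-cong (~Vrefl {u}) eq) us) (Lex-lin us (λ l → - cf j l) (λ l → Φ (sact v (simp l))) (Neg-Nn j r) (λ l → sg-true (sact v (simp l)) (all l)))
              where
              eq : sumV (λ l → (- cf j l) ·V Φ (sact v (simp l))) ~V negV (Φ k)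
              eq = ~Vtrans (sumV-cong (λ l → ·V-cong {c = - cf j l} {u = Φ (sact v (simp l))} ~refl (↑V (Φ-act g (simp l)))))
                (~Vtrans (~Vsym (actV-lin (map Φ g) (λ l → - cf j l) σ)) (~Vtrans (act-cong g (~Vtrans (~Vsym (linΠ-neg (cf j))) (negV-cong (~Vsym (↑V (Φ-lin j))))))
                  (~Vtrans (actV-neg (map Φ g) (Φ j)) (negV-cong (~Vtrans (~Vsym (↑V (Φ-act g j))) (λ l → ~reflexive (cong (λ x → Φ x l) (sym k≡))))))))
          final : w ≋ []
          final j = trans (sym (cong (actI w) (sact-walk v j))) (trans (sym (sact-walk v (actI w (sact v (walk v j)))))
            (trans (cong (sact v) (trans (sym (w′-walk (walk v j))) (word-Pos-pres⇒id w′ keeps (walk v j)))) (sact-walk v j)))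

  G : V → V
  G = act γW
  G-iso : ∀ u v → G u ∙ G v ~ u ∙ v
  G-iso = act-iso γW

  -- Sol u j says u = (1 − γ)⁻¹ Φ j. The Euler-type form χ(j,k) = u ∙ Φ k satisfies
  -- χ(j,k) + χ(k,j) = Φ j ∙ Φ k and χ(j,k) = − χ(k, γ⁻¹ j); Z j k states χ(j,k) = 0.
  Sol : V → Fin M → Set
  Sol u j = (u +V negV (G u)) ~V Φ j

  Z : Fin M → Fin M → Set
  Z j k = ∀ u → Sol u j → u ∙ Φ k ~ 0#

  Sol-G : ∀ {u j} → Sol u j → G u ~V (u +V negV (Φ j))
  Sol-G {u} e i = ~trans (solve 2 (λ u g → g := u :+ (:- (u :+ (:- g)))) ~refl (u i) (G u i)) (+-congˡ (-‿cong (e i)))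

  G-+ : ∀ u v → G (u +V v) ~V (G u +V G v)
  G-+ = actV-+ (map Φ γW)
  G-neg : ∀ u → G (negV u) ~V negV (G u)
  G-neg = actV-neg (map Φ γW)
  G-· : ∀ c u → G (c ·V u) ~V (c ·V G u)
  G-· = actV-· (map Φ γW)

  Sol-uniq : ∀ {u v j} → Sol u j → Sol v j → u ~V v
  Sol-uniq {u} {v} p q i = ~trans (solve 2 (λ u v → u := (u :+ (:- v)) :+ v) ~refl (u i) (v i)) (~trans (+-congʳ (γ-fix (u +V negV v) fix i)) (+-identityˡ _))
    where
    fix : G (u +V negV v) ~V (u +V negV v)
    fix l = ~trans (G-+ u (negV v) l) (~trans (+-congˡ (G-neg v l)) (~trans (+-cong (Sol-G p l) (-‿cong (Sol-G q l)))
      (solve 3 (λ u v f → (u :+ (:- f)) :+ (:- (v :+ (:- f))) := u :+ (:- v)) ~refl (u l) (v l) _)))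

  private
    E : Fin n → V
    E = δ
    E-span : ∀ x → x ~V sumV (λ i → x i ·V E i)
    E-span x l = ~sym (~trans (sumV-at l (λ i → x i ·V E i)) (~trans (sumK-single (λ i → x i * E i l) l (λ j ne → ~trans (*-congˡ (~reflexive (δ-other ne))) (zeroʳ _))) (~trans (*-congˡ (~reflexive (δ-self l))) (*-identityʳ _))))

  -- The system (1 - γ)u = Φ j is homogenised by one extra unknown: n equations in n + 1 unknowns. A
  -- nontrivial solution whose extra unknown is 0 would be a fixed vector of γ, so one can divide by
  -- it.
  Sol-exists : ∀ j → ¬ ¬ ∃ λ u → Sol u j
  Sol-exists j = homogeneous (suc n) rows (ℕₚ.≤-reflexive (cong suc (Listₚ.length-tabulate row))) >>= λ { (y , nz , sol) → return (build y nz (Allₚ.tabulate⁻ {f = row} sol)) }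
    where
    open OrderedField F using (⁻¹-inverse) renaming (_⁻¹ to infix 21 _⁻¹)
    row : Fin n → Fin (suc n) → Carrier
    row l zero = Φ j l
    row l (suc i) = E i l + (- G (E i) l)
    rows = tabulate row
    build : ∀ y → (∃ λ i → ¬ (y i ~ 0#)) → (∀ l → sumK (λ i → row l i * y i) ~ 0#) → ∃ λ u → Sol u j
    build y (i , nz) sol = ((- (y zero) ⁻¹) ·V x) , good
      where
      x : V
      x = y ∘ suc
      xe : ∀ l → sumK (λ i → row l (suc i) * x i) ~ x l + (- G x l)
      xe l = ~trans (sumK-cong (λ i → solve 3 (λ e g x → (e :+ (:- g)) :* x := x :* e :+ (:- :1) :* (x :* g)) ~refl (E i l) (G (E i) l) (x i)))
        (~trans (sumK-+ (λ i → x i * E i l) (λ i → (- 1#) * (x i * G (E i) l))) (+-cong (~trans (~sym (sumV-at l (λ i → x i ·V E i))) (~sym (E-span x l)))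
          (~trans (sumK-* (- 1#) (λ i → x i * G (E i) l)) (~trans (solve 1 (λ a → (:- :1) :* a := :- a) ~refl _) (-‿cong (~trans (~sym (sumV-at l (λ i → x i ·V G (E i)))) (~sym (~trans (act-cong γW (E-span x) l) (actV-lin (map Φ γW) x E l)))))))))
      eq : ∀ l → x l + (- G x l) ~ - (Φ j l * y zero)
      eq l = ~trans (~sym (xe l)) (~trans (solve 2 (λ a b → b := (a :+ b) :+ (:- a)) ~refl (Φ j l * y zero) _) (~trans (+-congʳ (sol l)) (+-identityˡ _)))
      y₀≁0 : ¬ (y zero ~ 0#)
      y₀≁0 z = nz (all0 i)
        where
        x0 : x ~V 0V
        x0 = γ-fix x (λ l → ~trans (solve 2 (λ x g → g := x :+ (:- (x :+ (:- g)))) ~refl (x l) (G x l)) (~trans (+-congˡ (-‿cong (~trans (eq l) (~trans (-‿cong (~trans (*-congˡ z) (zeroʳ _))) -0#≈0#)))) (~trans (+-congˡ -0#≈0#) (+-identityʳ _))))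
        all0 : ∀ i → y i ~ 0#
        all0 zero = z
        all0 (suc i) = x0 i
      good : Sol ((- (y zero) ⁻¹) ·V x) j
      good l = ~trans (+-congˡ (-‿cong (G-· (- (y zero) ⁻¹) x l))) (~trans (solve 3 (λ c x g → c :* x :+ (:- (c :* g)) := c :* (x :+ (:- g))) ~refl (- (y zero) ⁻¹) (x l) (G x l))
        (~trans (*-congˡ (eq l)) (~trans (solve 3 (λ c f y → (:- c) :* (:- (f :* y)) := f :* (y :* c)) ~refl ((y zero) ⁻¹) (Φ j l) (y zero)) (~trans (*-congˡ (return (⁻¹-inverse (y zero) (λ e → y₀≁0 (↑ e))))) (*-identityʳ _)))))

  -- Substituting Φ j = u - γu and Φ k = v - γv, and using that γ is an isometry, both sides become
  -- 2 u∙v - u∙γv - γu∙v.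
  χ-sym : ∀ {u v j k} → Sol u j → Sol v k → u ∙ Φ k + v ∙ Φ j ~ Φ j ∙ Φ k
  χ-sym {u} {v} {j} {k} p q = begin
    u ∙ Φ k + v ∙ Φ j ≈⟨ +-cong (uk q) (~trans (uk′ p) (+-cong (∙-comm v u) (-‿cong (∙-comm v (G u))))) ⟩
    (u ∙ v + (- (u ∙ G v))) + (u ∙ v + (- (G u ∙ v))) ≈⟨ solve 3 (λ a b c → (a :+ (:- b)) :+ (a :+ (:- c)) := (a :+ (:- b)) :+ (:- (c :+ (:- a)))) ~refl (u ∙ v) (u ∙ G v) (G u ∙ v) ⟩
    (u ∙ v + (- (u ∙ G v))) + (- (G u ∙ v + (- (u ∙ v)))) ≈⟨ +-congˡ (-‿cong (+-congˡ (-‿cong (~sym (G-iso u v))))) ⟩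
    (u ∙ v + (- (u ∙ G v))) + (- (G u ∙ v + (- (G u ∙ G v)))) ≈⟨ ~sym (+-cong (uk q) (-‿cong (expand (G u) q))) ⟩
    u ∙ Φ k + (- (G u ∙ Φ k)) ≈⟨ +-congˡ (~sym (∙-negˡ (G u) (Φ k))) ⟩
    u ∙ Φ k + negV (G u) ∙ Φ k ≈⟨ ~sym (∙-+ˡ u (negV (G u)) (Φ k)) ⟩
    (u +V negV (G u)) ∙ Φ k ≈⟨ ∙-cong p (~Vrefl {Φ k}) ⟩
    Φ j ∙ Φ k ∎
    where
    open ~-Reasoning
    expand : ∀ x {v k} → Sol v k → x ∙ Φ k ~ x ∙ v + (- (x ∙ G v))
    expand x {v} q = ~trans (∙-cong (~Vrefl {x}) (~Vsym q)) (~trans (∙-+ʳ x v (negV (G v))) (+-congˡ (∙-negʳ x (G v))))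
    uk : Sol v k → u ∙ Φ k ~ u ∙ v + (- (u ∙ G v))
    uk = expand u
    uk′ : Sol u j → v ∙ Φ j ~ v ∙ u + (- (v ∙ G u))
    uk′ = expand v

  χ-self : ∀ {u j} → Sol u j → two * (u ∙ Φ j) ~ Φ j ∙ Φ j
  χ-self {u} {j} p = ~trans (solve 1 (λ x → (:1 :+ :1) :* x := x :+ x) ~refl (u ∙ Φ j)) (χ-sym p p)

  χ-self≁0 : ∀ {u j} → Sol u j → ¬ (u ∙ Φ j ~ 0#)
  χ-self≁0 {u} {j} p z = Φ-NZ j (~trans (~sym (χ-self p)) (~trans (*-congˡ z) (zeroʳ _)))

  G-Φ : ∀ j → G (Φ (γ⁻ j)) ~V Φ j
  G-Φ j = ~Vtrans (~Vsym (↑V (Φ-act γW (γ⁻ j)))) (λ l → ~reflexive (cong (λ x → Φ x l) (γγ⁻ j)))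

  -- u ∙ (v - γv) = -(γv ∙ (u - γu)) because γ is an isometry; the right side is -(γv ∙ Φ j), and
  -- applying γ⁻¹ to both factors finishes.
  χ-serre : ∀ {u v j k} → Sol u j → Sol v k → u ∙ Φ k ~ - (v ∙ Φ (γ⁻ j))
  χ-serre {u} {v} {j} {k} p q = begin
    u ∙ Φ k ≈⟨ ∙-cong (~Vrefl {u}) (~Vsym q) ⟩
    u ∙ (v +V negV (G v)) ≈⟨ ~trans (∙-+ʳ u v _) (+-congˡ (∙-negʳ u (G v))) ⟩
    u ∙ v + (- (u ∙ G v)) ≈⟨ solve 2 (λ a b → a :+ (:- b) := :- (b :+ (:- a))) ~refl (u ∙ v) (u ∙ G v) ⟩
    - (u ∙ G v + (- (u ∙ v))) ≈⟨ -‿cong (+-cong (∙-comm u (G v)) (-‿cong (~trans (∙-comm u v) (~sym (G-iso v u))))) ⟩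
    - (G v ∙ u + (- (G v ∙ G u))) ≈⟨ -‿cong (~sym (~trans (∙-+ʳ (G v) u _) (+-congˡ (∙-negʳ (G v) (G u))))) ⟩
    - (G v ∙ (u +V negV (G u))) ≈⟨ -‿cong (∙-cong (~Vrefl {G v}) p) ⟩
    - (G v ∙ Φ j) ≈⟨ -‿cong (∙-cong (~Vrefl {G v}) (~Vsym (G-Φ j))) ⟩
    - (G v ∙ G (Φ (γ⁻ j))) ≈⟨ -‿cong (G-iso v (Φ (γ⁻ j))) ⟩
    - (v ∙ Φ (γ⁻ j)) ∎
    where open ~-Reasoning

  neg-0 : ∀ {x} → - x ~ 0# → x ~ 0#
  neg-0 e = ~trans (~sym (-‿involutive _)) (~trans (-‿cong e) -0#≈0#)

  Z-serre : ∀ {j k} → Z j k → Z k (γ⁻ j)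
  Z-serre {j} {k} z v q = ~-stable (Sol-exists j >>= λ (u , p) → return (neg-0 (~trans (~sym (χ-serre p q)) (z u p))))
  Z-serre⁻ : ∀ {j k} → Z k (γ⁻ j) → Z j k
  Z-serre⁻ {j} {k} z u p = ~-stable (Sol-exists k >>= λ (v , q) → return (~trans (χ-serre p q) (~trans (-‿cong (z v q)) -0#≈0#)))
  Z-γ⁻ : ∀ {j k} → Z j k → Z (γ⁻ j) (γ⁻ k)
  Z-γ⁻ z = Z-serre (Z-serre z)
  Z-γ⁻⁻ : ∀ {j k} → Z (γ⁻ j) (γ⁻ k) → Z j k
  Z-γ⁻⁻ z = Z-serre⁻ (Z-serre⁻ z)

  Sol-neg : ∀ {u j} → Sol u j → Sol (negV u) (neg j)
  Sol-neg {u} {j} p l = ~trans (+-congˡ (-‿cong (G-neg u l))) (~trans (solve 2 (λ u g → (:- u) :+ (:- (:- g)) := :- (u :+ (:- g))) ~refl (u l) (G u l)) (~trans (-‿cong (p l)) (~sym (Φ-neg~ j l))))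
  Z-negʳ : ∀ {j k} → Z j k → Z j (neg k)
  Z-negʳ {j} {k} z u p = ~trans (∙-cong (~Vrefl {u}) (Φ-neg~ k)) (~trans (∙-negʳ u (Φ k)) (~trans (-‿cong (z u p)) -0#≈0#))
  Z-negˡ : ∀ {j k} → Z j k → Z (neg j) k
  Z-negˡ {j} {k} z u p = neg-0 (~trans (~sym (∙-negˡ u (Φ k))) (z (negV u) (subst (Sol (negV u)) (neg-neg j) (Sol-neg p))))
  Z-negʳ⁻ : ∀ {j k} → Z j (neg k) → Z j k
  Z-negʳ⁻ {j} {k} z = subst (Z j) (neg-neg k) (Z-negʳ z)
  Z-negˡ⁻ : ∀ {j k} → Z (neg j) k → Z j k
  Z-negˡ⁻ {j} {k} z = subst (λ x → Z x k) (neg-neg j) (Z-negˡ z)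
  Z-swap : ∀ {j k} → Z j k → Φ j ∙ Φ k ~ 0# → Z k j
  Z-swap {j} {k} z e v q = ~-stable (Sol-exists j >>= λ (u , p) → return (~trans (~sym (+-identityˡ _)) (~trans (+-congʳ (~sym (z u p))) (~trans (χ-sym p q) e))))

-- Reduced factorizations of γ and their completion.

module Exceptional (F : OrderedField) (n : ℕ) (D : BipRootSystem F n) where
  open Carter F n D public

  -- For x orthogonal to B and Gx orthogonal to A (n − 1 conditions), γ = A a B gives (1 − γ)x ∈ K Φ_a.
  factor⇒Z : ∀ A a B → (A ++ a ∷ B) ≋ γW → length (A ++ a ∷ B) ≡ n → All (Z a) B
  factor⇒Z A a B e len = All.tabulate λ {b} b∈ u p → ~-stable (common-perp L lenL >>= λ (x , nz , perp) → return (at x nz perp b b∈ u p))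
    where
    -- γx is orthogonal to a′ exactly when x is orthogonal to γ⁻¹a′, so all n - 1 conditions become
    -- conditions on x.
    gA = map (λ a′ → Φ (γ⁻ a′)) A
    L = map Φ B ++ gA
    lenL : length L ℕ.< n
    lenL = ℕₚ.≤-reflexive (trans (cong suc (trans (Listₚ.length-++ (map Φ B)) (trans (cong₂ ℕ._+_ (Listₚ.length-map Φ B) (Listₚ.length-map (λ a′ → Φ (γ⁻ a′)) A)) (ℕₚ.+-comm (length B) (length A)))))
      (trans (sym (ℕₚ.+-suc (length A) (length B))) (trans (sym (Listₚ.length-++ A)) len)))
    at : ∀ x → NZ x → All (λ a → x ∙ a ~ 0#) L → ∀ b → b ∈ B → ∀ u → Sol u a → u ∙ Φ b ~ 0#
    at x nz perp b b∈ u p = cancel c≁0 (~trans (~sym (∙-·ˡ c u (Φ b))) (~trans (∙-cong (~Vsym x≡) (~Vrefl {Φ b})) (All.lookup (Allₚ.map⁻ (Allₚ.++⁻ˡ (map Φ B) perp)) b∈)))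
      where
      c = coef (Φ a) x
      Bx : act B x ~V x
      Bx = actV-fix (map Φ B) (Allₚ.++⁻ˡ (map Φ B) perp)
      y = Refl (Φ a) x
      Gx≡ : G x ~V act A y
      Gx≡ = ~Vtrans (~Vsym (↑V (≋⇒≈ {A ++ a ∷ B} {γW} e x))) (~Vtrans (λ l → ~reflexive (cong (λ v → v l) (act-++ A (a ∷ B) x))) (act-cong A (Refl-cong (Φ a) Bx)))
      AGx : act (reverse A) (G x) ~V G x
      AGx = actV-fix (map Φ (reverse A)) (Allₚ.map⁺ (All.tabulate (λ {a′} m → ~trans (∙-cong (~Vrefl {G x}) (~Vsym (G-Φ a′))) (~trans (G-iso x (Φ (γ⁻ a′))) (All.lookup (Allₚ.map⁻ (Allₚ.++⁻ʳ (map Φ B) perp)) (Anyₚ.reverse⁻ m))))))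
      Gx≡y : G x ~V y
      Gx≡y = ~Vtrans (~Vsym AGx) (~Vtrans (act-cong (reverse A) Gx≡) (act-rev A y))
      c≁0 : ¬ (c ~ 0#)
      c≁0 z = nz (~trans (∙-cong (γ-fix x (~Vtrans Gx≡y (λ l → ~trans (+-congˡ (-‿cong (~trans (*-congʳ z) (zeroˡ _)))) (~trans (+-congˡ -0#≈0#) (+-identityʳ _))))) (~Vrefl {x})) (∙-0ˡ x))
      x≡ : x ~V (c ·V u)
      x≡ i = ~trans (solve 2 (λ x v → x := (x :+ (:- v)) :+ v) ~refl (x i) (c * u i)) (~trans (+-congʳ (γ-fix (x +V negV (c ·V u)) fix i)) (+-identityˡ _))
        where
        fix : G (x +V negV (c ·V u)) ~V (x +V negV (c ·V u))
        fix l = ~trans (G-+ x (negV (c ·V u)) l) (~trans (+-cong (Gx≡y l) (~trans (G-neg (c ·V u) l) (-‿cong (~trans (G-· c u l) (*-congˡ (Sol-G p l))))))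
          (solve 4 (λ x c f u → (x :+ (:- (c :* f))) :+ (:- (c :* (u :+ (:- f)))) := x :+ (:- (c :* u))) ~refl (x l) c (Φ a l) (u l)))

  factorization⇒AllPairs-Z : ∀ P → P ≋ γW → length P ≡ n → AllPairs Z P
  factorization⇒AllPairs-Z P = go [] P
    where
    go : ∀ A P → (A ++ P) ≋ γW → length (A ++ P) ≡ n → AllPairs Z P
    go A [] e len = []
    go A (a ∷ P) e len = factor⇒Z A a P e len ∷ go (A ++ a ∷ []) P (λ j → trans (cong (λ w → actI w j) (Listₚ.++-assoc A (a ∷ []) P)) (e j)) (trans (cong length (Listₚ.++-assoc A (a ∷ []) P)) len)

  -- Let u = (1 - γ)⁻¹Φ a. Letters to the right of a fix u; R(a) sends it to u - Φ a = γu, since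
  -- 2χ(a, a) = Φ a ∙ Φ a; a letter p to the left fixes γu, because γu ∙ Φ p = -χ(p, a) = 0.
  exceptional-act : ∀ {P} → AllPairs Z P → ∀ {a} → a ∈ P → ∀ u → Sol u a → act P u ~V G u
  exceptional-act {p ∷ P} (z ∷ zs) (here refl) u q = ~Vtrans (Refl-cong (Φ p) (actV-fix (map Φ P) (Allₚ.map⁺ (All.map (λ z → z u q) z))))
      (λ l → ~trans (+-congˡ (-‿cong (~trans (*-congʳ one) (*-identityˡ _)))) (~sym (Sol-G q l)))
    where
    open OrderedField F using (⁻¹-inverse)
    one : coef (Φ p) u ~ 1#
    one = ~trans (*-congʳ (χ-self q)) (return (⁻¹-inverse (Φ p ∙ Φ p) (Φ-NZ₀ p)))
  exceptional-act {p ∷ P} (z ∷ zs) {a} (there a∈) u q = ~Vtrans (Refl-cong (Φ p) (exceptional-act zs a∈ u q)) (Refl-fix (Φ p) (G u) (~-stable (Sol-exists p >>= λ (v , r) → return (perp v r))))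
    where
    perp : ∀ v → Sol v p → G u ∙ Φ p ~ 0#
    perp v r = begin
      G u ∙ Φ p ≈⟨ ∙-cong (Sol-G q) (~Vrefl {Φ p}) ⟩
      (u +V negV (Φ a)) ∙ Φ p ≈⟨ ~trans (∙-+ˡ u (negV (Φ a)) (Φ p)) (+-congˡ (∙-negˡ (Φ a) (Φ p))) ⟩
      u ∙ Φ p + (- (Φ a ∙ Φ p)) ≈⟨ +-congˡ (-‿cong (~sym (χ-sym q r))) ⟩
      u ∙ Φ p + (- (u ∙ Φ p + v ∙ Φ a)) ≈⟨ +-congˡ (-‿cong (~trans (+-congˡ (All.lookup z a∈ v r)) (+-identityʳ _))) ⟩
      u ∙ Φ p + (- (u ∙ Φ p)) ≈⟨ -‿inverseʳ _ ⟩
      0# ∎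
      where open ~-Reasoning

  -- By `exceptional-act`, P⁻¹γ fixes (1 - γ)⁻¹Φ a for each a in P. As it is not the identity, some
  -- root is orthogonal to all these vectors.
  exceptional-extend : ∀ P → AllPairs Z P → ¬ (P ≋ γW) → ¬ ¬ ∃ λ b → All (λ a → Z a b) P
  exceptional-extend P ex P≢γ = ¬¬-Fin Sol-exists >>= λ U →
      fixed⇒perp-root (map (proj₁ ∘ U) P) (reverse P ++ γW) (Allₚ.map⁺ (All.tabulate (λ {a} a∈ →
          ~Vtrans (λ l → ~reflexive (cong (λ v → v l) (act-++ (reverse P) γW (proj₁ (U a))))) (~Vtrans (act-cong (reverse P) (~Vsym (exceptional-act ex a∈ (proj₁ (U a)) (proj₂ (U a))))) (act-rev P (proj₁ (U a)))))))
        (λ e → P≢γ (λ j → trans (cong (actI P) (sym (trans (sym (actI-++ (reverse P) γW j)) (e j)))) (actI-rev′ P (γI j)))) >>= λ (b , perp) →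
      return (b , All.map (λ {a} z u q → ~trans (∙-cong (Sol-uniq q (proj₂ (U a))) (~Vrefl {Φ b})) z) (Allₚ.map⁻ perp))

  -- The matrix of χ on the sequence is triangular with nonzero diagonal.
  exceptional-indep : ∀ {P} → AllPairs Z P → ∀ (c : Fin (length P) → Carrier) → sumV (λ i → c i ·V Φ (lookup P i)) ~V 0V → ∀ i → c i ~ 0#
  exceptional-indep {[]} [] c e ()
  exceptional-indep {p ∷ P} (z ∷ zs) c e = λ { zero → c₀ ; (suc i) → exceptional-indep zs (c ∘ suc) rest i }
    where
    c₀ : c zero ~ 0#
    c₀ = ~-stable (Sol-exists p >>= λ (u , q) → return (cancel (χ-self≁0 q) (begin
      (u ∙ Φ p) * c zero ≈⟨ *-comm _ _ ⟩
      c zero * (u ∙ Φ p) ≈⟨ ~sym (+-identityʳ _) ⟩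
      c zero * (u ∙ Φ p) + 0# ≈⟨ +-congˡ (~sym (sumK-0 (λ i → ~trans (*-congˡ (All.lookup z (∈ₚ.∈-lookup i) u q)) (zeroʳ _)))) ⟩
      c zero * (u ∙ Φ p) + sumK (λ i → c (suc i) * (u ∙ Φ (lookup P i))) ≈⟨ ~sym (∙-lin u c (λ i → Φ (lookup (p ∷ P) i))) ⟩
      u ∙ sumV (λ i → c i ·V Φ (lookup (p ∷ P) i)) ≈⟨ ∙-cong (~Vrefl {u}) e ⟩
      u ∙ 0V ≈⟨ ∙-0ʳ u ⟩
      0# ∎)))
      where open ~-Reasoning
    rest : sumV (λ i → c (suc i) ·V Φ (lookup P i)) ~V 0V
    rest l = ~trans (~sym (+-identityˡ _)) (~trans (+-congʳ (~sym (~trans (*-congʳ c₀) (zeroˡ _)))) (e l))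

  exceptional-length : ∀ P → AllPairs Z P → length P ℕ.≤ n
  exceptional-length P ex = ℕₚ.≮⇒≥ λ lt → homogeneous (length P) rows (ℕₚ.≤-trans (ℕₚ.≤-reflexive (cong suc (Listₚ.length-tabulate row))) lt) (λ { (c , (i , nz) , sol) →
      nz (exceptional-indep ex c (λ l → ~trans (sumV-at l (λ i → c i ·V Φ (lookup P i))) (~trans (sumK-cong (λ i → *-comm (c i) _)) (Allₚ.tabulate⁻ {f = row} sol l))) i) })
    where
    row : Fin n → Fin (length P) → Carrier
    row l i = Φ (lookup P i) l
    rows = tabulate row

  search : ∀ k {Q : Word → Set} → (∀ w → Dec (Q w)) → Dec (∃ λ w → (length w ≡ k) × Q w)
  search zero Q? = map′ (λ q → [] , refl , q) (λ { ([] , _ , q) → q }) (Q? [])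
  search (suc k) Q? = map′ (λ { (a , w , e , q) → a ∷ w , cong suc e , q }) (λ { (a ∷ w , e , q) → a , w , ℕₚ.suc-injective e , q })
    (Finₚ.any? (λ a → search k (λ w → Q? (a ∷ w))))

  -- Roots are appended under a double negation; the bounded `search` decides the resulting
  -- existence statement and so returns an actual word. Independence stops the process at length n.
  exceptional-complete : ∀ P → AllPairs Z P → ∃ λ Q → (length Q ≡ n ℕ.∸ length P) × (P ++ Q) ≋ γW
  exceptional-complete P ex = decidable-stable (search (n ℕ.∸ length P) (λ Q → (P ++ Q) ≋? γW)) (go (n ℕ.∸ length P) P ex refl)
    where
    snoc : ∀ P → AllPairs Z P → ∀ b → All (λ a → Z a b) P → AllPairs Z (P ++ b ∷ [])
    snoc P ex b z = AllPairsₚ.++⁺ ex ([] ∷ []) (All.map (λ z → z ∷ []) z)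
    lenb : ∀ P b → length (P ++ b ∷ []) ≡ suc (length P)
    lenb P b = trans (Listₚ.length-++ P) (ℕₚ.+-comm (length P) 1)
    longer : ∀ P → AllPairs Z P → ∀ b → All (λ a → Z a b) P → length P ℕ.< n
    longer P ex b z = ℕₚ.≤-trans (ℕₚ.≤-reflexive (sym (lenb P b))) (exceptional-length (P ++ b ∷ []) (snoc P ex b z))
    go : ∀ k P → AllPairs Z P → n ℕ.∸ length P ≡ k → ¬ ¬ ∃ λ Q → (length Q ≡ k) × (P ++ Q) ≋ γW
    go zero P ex e with P ≋? γW
    ... | yes p = return ([] , refl , λ j → trans (cong (λ w → actI w j) (Listₚ.++-identityʳ P)) (p j))
    ... | no np = exceptional-extend P ex np >>= λ (b , z) → ⊥-elim (ℕₚ.<-irrefl refl (ℕₚ.≤-trans (longer P ex b z) (ℕₚ.m∸n≡0⇒m≤n e)))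
    go (suc k) P ex e with P ≋? γW
    ... | yes p = ⊥-elim (ℕₚ.0≢1+n (trans (sym (ℕₚ.m≤n⇒m∸n≡0 (γ-shortest P p))) e))
    ... | no np = exceptional-extend P ex np >>= λ (b , z) → go k (P ++ b ∷ []) (snoc P ex b z) (trans (cong (n ℕ.∸_) (lenb P b)) (trans (sym (ℕₚ.pred[m∸n]≡m∸[1+n] n (length P))) (cong ℕ.pred e))) >>= λ (Q , l , q) →
        return (b ∷ Q , cong suc l , λ j → trans (cong (λ w → actI w j) (sym (Listₚ.++-assoc P (b ∷ []) Q))) (q j))

-- The sequence ρ and the γ-orbits of positive roots, with list utilities.

applyUpTo-+ : ∀ {A : Set} (f : ℕ → A) k l → applyUpTo f (k ℕ.+ l) ≡ applyUpTo f k ++ applyUpTo (λ x → f (k ℕ.+ x)) l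
applyUpTo-+ f zero l = refl
applyUpTo-+ f (suc k) l = cong (f 0 ∷_) (applyUpTo-+ (f ∘ suc) k l)

applyUpTo-cong : ∀ {A : Set} {f g : ℕ → A} → (∀ k → f k ≡ g k) → ∀ k → applyUpTo f k ≡ applyUpTo g k
applyUpTo-cong p zero = refl
applyUpTo-cong p (suc k) = cong₂ _∷_ (p 0) (applyUpTo-cong (p ∘ suc) k)

applyUpTo-split : ∀ {A : Set} (f : ℕ → A) k v {x w} → applyUpTo f k ≡ v ++ x ∷ w → (v ≡ applyUpTo f (length v)) × (x ≡ f (length v)) × (length v ℕ.< k)
applyUpTo-split f (suc k) [] e = refl , sym (Listₚ.∷-injectiveˡ e) , ℕ.s≤s ℕ.z≤n
applyUpTo-split f (suc k) (y ∷ v) e with Listₚ.∷-injective e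
... | refl , e′ with applyUpTo-split (f ∘ suc) k v e′
... | p , q , lt = cong (y ∷_) p , q , ℕ.s≤s lt
applyUpTo-split f zero [] ()
applyUpTo-split f zero (y ∷ v) ()

tabulate-applyUpTo : ∀ {A : Set} {k} (f : Fin k → A) (g : ℕ → A) → (∀ i → f i ≡ g (toℕ i)) → tabulate f ≡ applyUpTo g k
tabulate-applyUpTo {k = zero} f g p = refl
tabulate-applyUpTo {k = suc k} f g p = cong₂ _∷_ (p zero) (tabulate-applyUpTo (f ∘ suc) (g ∘ suc) (p ∘ suc))

least : (f : ℕ → Bool) → ∀ e → f e ≡ true → ∃ λ e → f e ≡ true × (∀ d → d ℕ.< e → f d ≡ false)
least f zero p = 0 , p , λ _ ()
least f (suc e) p with f 0 in eq
... | true = 0 , eq , λ _ ()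
... | false with least (f ∘ suc) e p
... | e′ , q , m = suc e′ , q , λ { zero _ → eq ; (suc d) (ℕ.s≤s lt) → m d lt }

module Sequence (F : OrderedField) (n : ℕ) (D : BipRootSystem F n) where
  open Exceptional F n D public

  abstract
    cyc : ℕ → Fin n
    cyc k = fromℕ< (m%n<n k n)
    cyc-def : ∀ k → cyc k ≡ fromℕ< (m%n<n k n)
    cyc-def k = refl
    toℕ-cyc-% : ∀ k → toℕ (cyc k) ≡ k % n
    toℕ-cyc-% k = Finₚ.toℕ-fromℕ< (m%n<n k n)
  toℕ-cyc : ∀ k → k ℕ.< n → toℕ (cyc k) ≡ k
  toℕ-cyc k lt = trans (toℕ-cyc-% k) (m<n⇒m%n≡m lt)
  cyc-toℕ : ∀ i → cyc (toℕ i) ≡ i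
  cyc-toℕ i = Finₚ.toℕ-injective (toℕ-cyc (toℕ i) (Finₚ.toℕ<n i))
  cyc-+n : ∀ k → cyc (n ℕ.+ k) ≡ cyc k
  cyc-+n k = Finₚ.toℕ-injective (trans (toℕ-cyc-% (n ℕ.+ k)) (trans (cong (_% n) (ℕₚ.+-comm n k)) (trans ([m+n]%n≡m%n k n) (sym (toℕ-cyc-% k)))))

  cyc-≢ : ∀ k l → k ℕ.< l → l ℕ.< k ℕ.+ n → ¬ cyc k ≡ cyc l
  cyc-≢ k l lt ln e = by-size (ℕₚ.<-≤-connex (k % n ℕ.+ d) n)
    where
    d = l ℕ.∸ k
    k+d : k ℕ.+ d ≡ l
    k+d = ℕₚ.m+[n∸m]≡n (ℕₚ.<⇒≤ lt)
    d>0 : 0 ℕ.< d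
    d>0 = ℕₚ.m<n⇒0<n∸m lt
    d<n : d ℕ.< n
    d<n = ℕₚ.+-cancelˡ-< k d n (subst (ℕ._< k ℕ.+ n) (sym k+d) ln)
    k%≡ : k % n ≡ (k % n ℕ.+ d) % n
    k%≡ = trans (trans (sym (toℕ-cyc-% k)) (trans (cong toℕ e) (toℕ-cyc-% l))) (trans (cong (_% n) (sym k+d))
      (trans (%-distribˡ-+ k d n) (cong (λ x → (k % n ℕ.+ x) % n) (m<n⇒m%n≡m d<n))))
    by-size : (k % n ℕ.+ d ℕ.< n) ⊎ (n ℕ.≤ k % n ℕ.+ d) → ⊥
    by-size (inj₁ x<n) = ℕₚ.<-irrefl (trans k%≡ (m<n⇒m%n≡m x<n)) (ℕₚ.m<m+n (k % n) d>0)
    by-size (inj₂ n≤x) = ℕₚ.<-irrefl (ℕₚ.+-cancelˡ-≡ (k % n) d n (trans (sym (ℕₚ.m∸n+n≡m n≤x)) (cong (ℕ._+ n) (sym back)))) d<n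
      where
      y<n : k % n ℕ.+ d ℕ.∸ n ℕ.< n
      y<n = ℕₚ.+-cancelʳ-< n (k % n ℕ.+ d ℕ.∸ n) n (subst (ℕ._< n ℕ.+ n) (sym (ℕₚ.m∸n+n≡m n≤x)) (ℕₚ.+-mono-< (m%n<n k n) d<n))
      back : k % n ≡ k % n ℕ.+ d ℕ.∸ n
      back = trans k%≡ (trans (sym (m≤n⇒[n∸m]%m≡n%m n≤x)) (m<n⇒m%n≡m y<n))

  pre : ℕ → List (Fin n)
  pre = applyUpTo cyc
  γL≡pre : γL ≡ pre n
  γL≡pre = tabulate-applyUpTo id cyc (λ i → sym (cyc-toℕ i))

  -- Counted from zero: `ρI k` is ρ_{k+1}.
  ρI : ℕ → Fin M
  ρI k = sact (pre k) (simp (cyc k))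

  ρI-+n : ∀ k → ρI (n ℕ.+ k) ≡ γI (ρI k)
  ρI-+n k = trans (cong₂ (λ L i → sact L (simp i)) (trans (applyUpTo-+ cyc n k) (cong₂ _++_ (sym γL≡pre) (applyUpTo-cong cyc-+n k))) (cyc-+n k)) (sact-++ γL (pre k) (simp (cyc k)))

  ρI-iter : ∀ e k → ρI (e ℕ.* n ℕ.+ k) ≡ iter γI e (ρI k)
  ρI-iter zero k = refl
  ρI-iter (suc e) k = trans (cong ρI (ℕₚ.+-assoc n (e ℕ.* n) k)) (trans (ρI-+n (e ℕ.* n ℕ.+ k)) (trans (cong γI (ρI-iter e k)) (sym (iter-comm γI e (ρI k)))))

  post : ℕ → List (Fin n)
  post k = applyUpTo (λ x → cyc (suc k ℕ.+ x)) (n ℕ.∸ suc k)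
  γL-split : ∀ k → k ℕ.< n → γL ≡ pre k ++ cyc k ∷ post k
  γL-split k lt = trans γL≡pre (trans (cong pre (sym (ℕₚ.m+[n∸m]≡n lt))) (trans (applyUpTo-+ cyc (suc k) (n ℕ.∸ suc k))
    (trans (cong (_++ post k) (sym (Listₚ.applyUpTo-∷ʳ cyc k))) (Listₚ.++-assoc (pre k) (cyc k ∷ []) (post k)))))

  pre-< : ∀ k → k ℕ.≤ n → All (λ a → toℕ a ℕ.< k) (pre k)
  pre-< k le = All.tabulate λ m → let j , lt , e = ∈ₚ.∈-applyUpTo⁻ cyc m in subst (ℕ._< k) (sym (trans (cong toℕ e) (toℕ-cyc j (ℕₚ.≤-trans lt le)))) lt
  mid-> : ∀ k c → k ℕ.+ c ℕ.≤ n → All (λ a → (k ℕ.≤ toℕ a) × (toℕ a ℕ.< k ℕ.+ c)) (applyUpTo (λ x → cyc (k ℕ.+ x)) c)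
  mid-> k c le = All.tabulate λ m → let j , lt , e = ∈ₚ.∈-applyUpTo⁻ (λ x → cyc (k ℕ.+ x)) m
                                        lt′ = ℕₚ.+-monoʳ-< k lt
                                        e′ = sym (trans (cong toℕ e) (toℕ-cyc (k ℕ.+ j) (ℕₚ.≤-trans lt′ le)))
                                    in subst (k ℕ.≤_) e′ (ℕₚ.m≤m+n k j) , subst (ℕ._< k ℕ.+ c) e′ lt′
  post-> : ∀ k → k ℕ.< n → All (λ a → k ℕ.< toℕ a) (post k)
  post-> k lt = All.map proj₁ (mid-> (suc k) (n ℕ.∸ suc k) (ℕₚ.≤-reflexive (ℕₚ.m+[n∸m]≡n lt)))

  cf-sact : ∀ L i j → All (λ a → ¬ a ≡ i) L → cf (sact L j) i ~ cf j i
  cf-sact [] i j [] = ~refl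
  cf-sact (a ∷ L) i j (ne ∷ nes) = ~trans (cf-s a (sact L j) i (λ q → ne (sym q))) (cf-sact L i j nes)
  cf-walk : ∀ L i j → All (λ a → ¬ a ≡ i) L → cf (walk L j) i ~ cf j i
  cf-walk L i j nes = ~trans (~sym (cf-sact L i (walk L j) nes)) (~reflexive (cong (λ k → cf k i) (sact-walk L j)))
  cf-simp : ∀ i l → cf (simp i) l ~ δ i l
  cf-simp i = cf-uniq (simp i) (δ i) (↑V (σ-lin i))
  Pos-by-cf : ∀ j i → cf j i ~ 1# → Pos j
  Pos-by-cf j i e = Pos⇒ λ q → 1≁0 (Nn-antisym Nn-1 (Nn-resp (-‿cong e) (Neg-Nn j q i)))
  -- Letters other than s_i keep the coefficient at σ_i equal to 1, and one positive coefficient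
  -- decides the sign of a root.
  Pos-sact : ∀ L i → All (λ a → ¬ a ≡ i) L → Pos (sact L (simp i))
  Pos-sact L i nes = Pos-by-cf (sact L (simp i)) i (~trans (cf-sact L i (simp i) nes) (~trans (cf-simp i i) (~reflexive (δ-self i))))
  Pos-walk : ∀ L i → All (λ a → ¬ a ≡ i) L → Pos (walk L (simp i))
  Pos-walk L i nes = Pos-by-cf (walk L (simp i)) i (~trans (cf-walk L i (simp i) nes) (~trans (cf-simp i i) (~reflexive (δ-self i))))

  pre-≢ : ∀ k → k ℕ.< n → All (λ a → ¬ a ≡ cyc k) (pre k)
  pre-≢ k lt = All.map (λ {a} p e → ℕₚ.<-irrefl (trans (cong toℕ e) (toℕ-cyc k lt)) p) (pre-< k (ℕₚ.<⇒≤ lt))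
  post-≢ : ∀ k → k ℕ.< n → All (λ a → ¬ a ≡ cyc k) (post k)
  post-≢ k lt = All.map (λ {a} p e → ℕₚ.<-irrefl (sym (trans (cong toℕ e) (toℕ-cyc k lt))) p) (post-> k lt)

  Pos-ρI : ∀ k → k ℕ.< n → Pos (ρI k)
  Pos-ρI k lt = Pos-sact (pre k) (cyc k) (pre-≢ k lt)
  γ⁻ρI : ∀ k → k ℕ.< n → γ⁻ (ρI k) ≡ neg (walk (post k) (simp (cyc k)))
  γ⁻ρI k lt = trans (cong (λ L → walk L (ρI k)) (γL-split k lt)) (trans (walk-++ (pre k) (cyc k ∷ post k) (ρI k))
    (trans (cong (λ j → walk (post k) (s (cyc k) j)) (walk-sact (pre k) (simp (cyc k)))) (walk-neg (post k) (simp (cyc k)))))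
  Neg-γ⁻ρI : ∀ k → k ℕ.< n → Neg (γ⁻ (ρI k))
  Neg-γ⁻ρI k lt = trans (cong pos (γ⁻ρI k lt)) (Pos⇒Neg-neg (Pos-walk (post k) (cyc k) (post-≢ k lt)))
  -- The sign change along the letters of γ singles out the position. With `Neg-γ⁻ρI`, the first n
  -- terms are exactly the positive roots made negative by γ⁻¹.
  ρI-hit : ∀ α → Pos α → Neg (γ⁻ α) → ∃ λ k → k ℕ.< n × α ≡ ρI k
  ρI-hit α p q =
    let v₁ , i , v₂ , e , h = sign-change γL α p q
        e₁ , e₂ , lt = applyUpTo-split cyc n v₁ (trans (sym γL≡pre) e)
    in length v₁ , lt , trans (sym (sact-walk v₁ α)) (trans (cong (sact v₁) h) (cong₂ (λ L i → sact L (simp i)) e₁ e₂))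
  -- After cancelling the common prefix, equality would give -σ_k = v σ_l with v a word avoiding
  -- s_l; but such an image of σ_l is positive.
  ρI-<-≢ : ∀ k l → k ℕ.< l → l ℕ.< k ℕ.+ n → ¬ ρI k ≡ ρI l
  ρI-<-≢ k l lt ln e = Pos-Neg (trans (cong pos eq) (Pos-sact mid (cyc l) mid≢)) (Pos⇒Neg-neg (Pos-simp (cyc k)))
    where
    c = l ℕ.∸ suc k
    l≡ : suc k ℕ.+ c ≡ l
    l≡ = ℕₚ.m+[n∸m]≡n lt
    mid = applyUpTo (λ x → cyc (suc k ℕ.+ x)) c
    mid≢ : All (λ a → ¬ a ≡ cyc l) mid
    mid≢ = All.tabulate λ m → let x , x<c , q = ∈ₚ.∈-applyUpTo⁻ (λ x → cyc (suc k ℕ.+ x)) m in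
      λ a≡ → cyc-≢ (suc k ℕ.+ x) l (subst (suc k ℕ.+ x ℕ.<_) l≡ (ℕₚ.+-monoʳ-< (suc k) x<c))
        (ℕₚ.<-≤-trans ln (ℕₚ.+-monoˡ-≤ n (ℕₚ.≤-trans (ℕₚ.n≤1+n k) (ℕₚ.m≤m+n (suc k) x)))) (trans (sym q) a≡)
    pre-l : pre l ≡ pre k ++ cyc k ∷ mid
    pre-l = trans (cong pre (sym l≡)) (trans (applyUpTo-+ cyc (suc k) c) (trans (cong (_++ mid) (sym (Listₚ.applyUpTo-∷ʳ cyc k))) (Listₚ.++-assoc (pre k) (cyc k ∷ []) mid)))
    eq : neg (simp (cyc k)) ≡ sact mid (simp (cyc l))
    eq = trans (cong (s (cyc k)) (sact-inj (pre k) (trans e (trans (cong (λ L → sact L (simp (cyc l))) pre-l) (sact-++ (pre k) (cyc k ∷ mid) (simp (cyc l))))))) (s-s (cyc k) _)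
  ρI-inj : ∀ k l → k ℕ.< n → l ℕ.< n → ρI k ≡ ρI l → k ≡ l
  ρI-inj k l p q e = ℕₚ.≤-antisym (ℕₚ.≮⇒≥ λ lt → ρI-<-≢ l k lt (ℕₚ.<-≤-trans p (ℕₚ.m≤n+m n l)) (sym e)) (ℕₚ.≮⇒≥ λ lt → ρI-<-≢ k l lt (ℕₚ.<-≤-trans q (ℕₚ.m≤n+m n k)) e)

  ρf : Fin n → Fin M
  ρf i = ρI (toℕ i)
  ρf-inj : ∀ {i j} → ρf i ≡ ρf j → i ≡ j
  ρf-inj {i} {j} e = Finₚ.toℕ-injective (ρI-inj (toℕ i) (toℕ j) (Finₚ.toℕ<n i) (Finₚ.toℕ<n j) e)
  Pos-ρf : ∀ i → Pos (ρf i)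
  Pos-ρf i = Pos-ρI (toℕ i) (Finₚ.toℕ<n i)
  ρf-hit : ∀ α → Pos α → Neg (γ⁻ α) → ∃ λ i → α ≡ ρf i
  ρf-hit α p q = let k , lt , e = ρI-hit α p q in cyc k , trans e (cong ρI (sym (toℕ-cyc k lt)))

  -- The γ-orbit of ρ_i stays positive for L i steps and then reaches −ρ_{i*}, where i* = star i.
  private
    run : ∀ i → ∃ λ e → not (pos (iter γI e (ρf i))) ≡ true × (∀ d → d ℕ.< e → not (pos (iter γI d (ρf i))) ≡ false)
    run i = let e , q = γI-Neg (ρf i) in least (λ e → not (pos (iter γI e (ρf i)))) e (cong not q)
  abstract
    L : Fin n → ℕ
    L i = proj₁ (run i)
    L-Neg : ∀ i → Neg (iter γI (L i) (ρf i))
    L-Neg i = not-injective (proj₁ (proj₂ (run i)))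
    L-Pos : ∀ i {d} → d ℕ.< L i → Pos (iter γI d (ρf i))
    L-Pos i lt = not-injective (proj₂ (proj₂ (run i)) _ lt)
  L>0 : ∀ i → 0 ℕ.< L i
  L>0 i = ℕₚ.n≢0⇒n>0 λ eq → Pos-Neg (Pos-ρf i) (subst (λ e → Neg (iter γI e (ρf i))) eq (L-Neg i))

  γI-inj : ∀ {x y} → γI x ≡ γI y → x ≡ y
  γI-inj = sact-inj γL
  γ⁻-iter : ∀ e x → γ⁻ (iter γI (suc e) x) ≡ iter γI e x
  γ⁻-iter e x = trans (cong γ⁻ (iter-comm γI e x)) (γ⁻γ (iter γI e x))
  γI-neg : ∀ j → γI (neg j) ≡ neg (γI j)
  γI-neg = sact-neg γL
  γ⁻-neg : ∀ j → γ⁻ (neg j) ≡ neg (γ⁻ j)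
  γ⁻-neg = walk-neg γL
  iter-neg : ∀ e j → iter γI e (neg j) ≡ neg (iter γI e j)
  iter-neg zero j = refl
  iter-neg (suc e) j = trans (cong (iter γI e) (γI-neg j)) (iter-neg e (γI j))

  star-spec : ∀ i → ∃ λ j → iter γI (L i) (ρf i) ≡ neg (ρf j)
  star-spec i = j , trans (sym (neg-neg x)) (cong neg e)
    where
    x = iter γI (L i) (ρf i)
    l = ℕ.pred (L i)
    L≡ : L i ≡ suc l
    L≡ = sym (ℕₚ.suc-pred (L i) {{ℕ.>-nonZero (L>0 i)}})
    γ⁻x : γ⁻ x ≡ iter γI l (ρf i)
    γ⁻x = trans (cong (λ l → γ⁻ (iter γI l (ρf i))) L≡) (γ⁻-iter l (ρf i))
    hit = ρf-hit (neg x) (Neg⇒Pos-neg (L-Neg i)) (trans (cong pos (trans (γ⁻-neg x) (cong neg γ⁻x))) (Pos⇒Neg-neg (L-Pos i (ℕₚ.≤-reflexive (sym L≡)))))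
    j = proj₁ hit
    e = proj₂ hit
  abstract
    star : Fin n → Fin n
    star i = proj₁ (star-spec i)
    star-eq : ∀ i → iter γI (L i) (ρf i) ≡ neg (ρf (star i))
    star-eq i = proj₂ (star-spec i)

  -- If e < f, cancelling γ^e leaves ρ_i inside the run of j but not at its start, so γ⁻¹ρ_i would
  -- be positive.
  separate : ∀ i j {e f} → e ℕ.≤ f → f ℕ.≤ L j → iter γI e (ρf i) ≡ iter γI f (ρf j) → (i ≡ j) × (e ≡ f)
  separate i j {e} {f} e≤f f≤L p = go (f ℕ.∸ e) refl
    where
    go : ∀ c → f ℕ.∸ e ≡ c → (i ≡ j) × (e ≡ f)
    go zero eq = ρf-inj (iter-inj γI γI-inj e (trans p (cong (λ x → iter γI x (ρf j)) (sym e≡f)))) , e≡f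
      where
      e≡f : e ≡ f
      e≡f = ℕₚ.≤-antisym e≤f (ℕₚ.m∸n≡0⇒m≤n eq)
    go (suc d) eq = ⊥-elim (Pos-Neg (L-Pos j (ℕₚ.≤-trans (ℕₚ.≤-trans (ℕₚ.≤-reflexive (sym eq)) (ℕₚ.m∸n≤m f e)) f≤L)) (trans (cong pos (sym ρi≡)) (Neg-γ⁻ρI (toℕ i) (Finₚ.toℕ<n i))))
      where
      f≡ : f ≡ e ℕ.+ suc d
      f≡ = trans (sym (ℕₚ.m+[n∸m]≡n e≤f)) (cong (e ℕ.+_) eq)
      ρi≡ : γ⁻ (ρf i) ≡ iter γI d (ρf j)
      ρi≡ = trans (cong γ⁻ (iter-inj γI γI-inj e (trans p (trans (cong (λ x → iter γI x (ρf j)) f≡) (iter-+ γI e (suc d) (ρf j)))))) (γ⁻-iter d (ρf j))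

  star-inj : ∀ {i j} → star i ≡ star j → i ≡ j
  star-inj {i} {j} e = [ (λ le → proj₁ (separate i j le ℕₚ.≤-refl (trans (star-eq i) (trans (cong (neg ∘ ρf) e) (sym (star-eq j))))))
    , (λ le → sym (proj₁ (separate j i le ℕₚ.≤-refl (trans (star-eq j) (trans (cong (neg ∘ ρf) (sym e)) (sym (star-eq i))))))) ]′ (ℕₚ.≤-total (L i) (L j))

  γ⁻-inj : ∀ {x y} → γ⁻ x ≡ γ⁻ y → x ≡ y
  γ⁻-inj = walk-inj γL
  γI-γ⁻-iter : ∀ e α → iter γI e (iter γ⁻ e α) ≡ α
  γI-γ⁻-iter zero α = refl
  γI-γ⁻-iter (suc e) α = trans (iter-comm γI e _) (trans (cong γI (γI-γ⁻-iter e (γ⁻ α))) (γγ⁻ α))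

  -- Going back by γ⁻¹, the last positive root before the first negative one is some ρ_i. Its run
  -- has not ended before α, as all roots in between are positive.
  cover : ∀ α → Pos α → ∃ λ i → ∃ λ e → e ℕ.< L i × α ≡ iter γI e (ρf i)
  cover α p = go (proj₁ lst) (proj₁ (proj₂ lst)) (proj₂ (proj₂ lst))
    where
    lst = least (λ e → not (pos (iter γ⁻ e α))) (proj₁ (γ⁻-Neg α)) (cong not (proj₂ (γ⁻-Neg α)))
    go : ∀ e → not (pos (iter γ⁻ e α)) ≡ true → (∀ d → d ℕ.< e → not (pos (iter γ⁻ d α)) ≡ false) → ∃ λ i → ∃ λ e → e ℕ.< L i × α ≡ iter γI e (ρf i)
    go zero q _ = ⊥-elim (Pos-Neg p (not-injective q))
    go (suc e) q m = i , e , ℕₚ.≰⇒> shorter , trans (sym (γI-γ⁻-iter e α)) (cong (iter γI e) hit)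
      where
      h = ρf-hit (iter γ⁻ e α) (not-injective (m e (ℕₚ.n<1+n e))) (trans (cong pos (sym (iter-comm γ⁻ e α))) (not-injective q))
      i = proj₁ h
      hit = proj₂ h
      shorter : ¬ (L i ℕ.≤ e)
      shorter le = Pos-Neg (not-injective (m (e ℕ.∸ L i) (ℕ.s≤s (ℕₚ.m∸n≤m e (L i))))) (trans (cong pos (sym back)) (L-Neg i))
        where
        back : iter γI (L i) (ρf i) ≡ iter γ⁻ (e ℕ.∸ L i) α
        back = trans (cong (iter γI (L i)) (trans (sym hit) (trans (cong (λ x → iter γ⁻ x α) (sym (ℕₚ.m+[n∸m]≡n le))) (iter-+ γ⁻ (L i) (e ℕ.∸ L i) α))))
          (γI-γ⁻-iter (L i) (iter γ⁻ (e ℕ.∸ L i) α))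

-- The bipartition: coefficients through χ, exit times along edges, connectedness.

AllPairs-tabulate⁻ : ∀ {A : Set} {R : A → A → Set} {k} (f : Fin k → A) → AllPairs R (tabulate f) → ∀ a b → toℕ a ℕ.< toℕ b → R (f a) (f b)
AllPairs-tabulate⁻ {k = suc k} f (p ∷ ps) zero (suc b) lt = Allₚ.tabulate⁻ {f = f ∘ suc} p b
AllPairs-tabulate⁻ {k = suc k} f (p ∷ ps) (suc a) (suc b) (ℕ.s≤s lt) = AllPairs-tabulate⁻ (f ∘ suc) ps a b lt

toℕ-≢ : ∀ {k} {a b : Fin k} → ¬ a ≡ b → toℕ a ℕ.< toℕ b ⊎ toℕ b ℕ.< toℕ a
toℕ-≢ {a = a} {b} ne = [ inj₁ , (λ le → inj₂ (ℕₚ.≤∧≢⇒< le (λ e → ne (sym (Finₚ.toℕ-injective e))))) ]′ (ℕₚ.<-≤-connex (toℕ a) (toℕ b))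

module Bipartite (F : OrderedField) (n : ℕ) (D : BipRootSystem F n) where
  open Sequence F n D public

  Plus Minus : Fin n → Set
  Plus i = toℕ i ℕ.< r
  Minus i = r ℕ.≤ toℕ i

  Same : Fin n → Fin n → Set
  Same i j = (Plus i × Plus j) ⊎ (Minus i × Minus j)
  Same-sym : ∀ {i j} → Same i j → Same j i
  Same-sym (inj₁ (a , b)) = inj₁ (b , a)
  Same-sym (inj₂ (a , b)) = inj₂ (b , a)

  orth : ∀ {i j} → Same i j → ¬ i ≡ j → σ i ∙ σ j ~ 0#
  orth (inj₁ (a , b)) ne = ↑ (orth₊ _ _ a b ne)
  orth (inj₂ (a , b)) ne = ↑ (orth₋ _ _ a b ne)

  Z-simp-< : ∀ a b → toℕ a ℕ.< toℕ b → Z (simp a) (simp b)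
  Z-simp-< = AllPairs-tabulate⁻ simp (subst (AllPairs Z) (Listₚ.map-tabulate id simp) (factorization⇒AllPairs-Z γW (λ _ → refl) length-γW))

  Z-simp-same : ∀ {a b} → Same a b → ¬ a ≡ b → Z (simp a) (simp b)
  Z-simp-same {a} {b} sm ne = [ Z-simp-< a b , (λ gt → Z-swap (Z-simp-< b a gt) (orth (Same-sym sm) (λ e → ne (sym e)))) ]′ (toℕ-≢ ne)

  private
    -- R(ρ_k)⋯R(ρ_1) = s_1⋯s_k. For k = n this is a second factorization of γ, with the ρ in
    -- decreasing order, whence `Z-window`.
    W : ℕ → Word
    W zero = []
    W (suc k) = ρI k ∷ W k
    length-W : ∀ k → length (W k) ≡ k
    length-W zero = refl
    length-W (suc k) = cong suc (length-W k)
    W-pre : ∀ k j → actI (W k) j ≡ sact (pre k) j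
    W-pre zero j = refl
    W-pre (suc k) j = trans (cong (ref (ρI k)) (W-pre k j)) (trans (ref-actI (map simp (pre k)) (simp (cyc k)) (sact (pre k) j))
      (trans (cong (λ x → sact (pre k) (s (cyc k) x)) (actI-rev (map simp (pre k)) j))
        (trans (sym (sact-++ (pre k) (cyc k ∷ []) j)) (cong (λ L → sact L j) (Listₚ.applyUpTo-∷ʳ cyc k)))))
    W-all : ∀ x k → All (Z x) (W k) → ∀ a → a ℕ.< k → Z x (ρI a)
    W-all x (suc k) (p ∷ ps) a (ℕ.s≤s le) = [ (λ lt → W-all x k ps a lt) , (λ e → subst (λ a → Z x (ρI a)) (sym e) p) ]′ (ℕₚ.m≤n⇒m<n∨m≡n le)
    W-pairs : ∀ k → AllPairs Z (W k) → ∀ b a → b ℕ.< k → a ℕ.< b → Z (ρI b) (ρI a)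
    W-pairs (suc k) (p ∷ ps) b a (ℕ.s≤s le) lt = [ (λ bk → W-pairs k ps b a bk lt) ,
      (λ e → subst (λ b → Z (ρI b) (ρI a)) (sym e) (W-all (ρI k) k p a (subst (a ℕ.<_) e lt))) ]′ (ℕₚ.m≤n⇒m<n∨m≡n le)

  Z-window : ∀ b a → toℕ a ℕ.< toℕ b → Z (ρf b) (ρf a)
  Z-window b a lt = W-pairs n (factorization⇒AllPairs-Z (W n) (λ j → trans (W-pre n j) (cong (λ L → sact L j) (sym γL≡pre))) (length-W n)) (toℕ b) (toℕ a) (Finₚ.toℕ<n b) lt

  sact-perp : ∀ L i → All (λ a → σ a ∙ σ i ~ 0#) L → sact L (simp i) ≡ simp i
  sact-perp [] i [] = refl
  sact-perp (a ∷ L) i (p ∷ ps) = trans (cong (s a) (sact-perp L i ps)) (ref-perp p)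
  walk-perp : ∀ L i → All (λ a → σ a ∙ σ i ~ 0#) L → walk L (simp i) ≡ simp i
  walk-perp [] i [] = refl
  walk-perp (a ∷ L) i (p ∷ ps) = trans (cong (walk L) (ref-perp p)) (walk-perp L i ps)

  ρf-plus : ∀ i → Plus i → ρf i ≡ simp i
  ρf-plus i p = trans (cong (λ l → sact (pre (toℕ i)) (simp l)) (cyc-toℕ i)) (sact-perp (pre (toℕ i)) i
    (All.map (λ {a} lt → orth (inj₁ (ℕₚ.<-trans lt p , p)) (λ e → ℕₚ.<-irrefl (cong toℕ e) lt)) (pre-< (toℕ i) (ℕₚ.<⇒≤ (Finₚ.toℕ<n i)))))
  γ⁻ρf-minus : ∀ j → Minus j → γ⁻ (ρf j) ≡ neg (simp j)
  γ⁻ρf-minus j q = trans (γ⁻ρI (toℕ j) (Finₚ.toℕ<n j)) (cong neg (trans (cong (λ l → walk (post (toℕ j)) (simp l)) (cyc-toℕ j)) (walk-perp (post (toℕ j)) j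
    (All.map (λ {a} lt → orth (inj₂ (ℕₚ.≤-trans q (ℕₚ.<⇒≤ lt) , q)) (λ e → ℕₚ.<-irrefl (sym (cong toℕ e)) lt)) (post-> (toℕ j) (Finₚ.toℕ<n j))))))
  Z-ρf-same : ∀ {a b} → Same a b → ¬ a ≡ b → Z (ρf a) (ρf b)
  Z-ρf-same {a} {b} (inj₁ (p , q)) ne = subst₂ Z (sym (ρf-plus a p)) (sym (ρf-plus b q)) (Z-simp-same (inj₁ (p , q)) ne)
  Z-ρf-same {a} {b} (inj₂ (p , q)) ne = Z-γ⁻⁻ (subst₂ Z (sym (γ⁻ρf-minus a p)) (sym (γ⁻ρf-minus b q)) (Z-negˡ (Z-negʳ (Z-simp-same (inj₂ (p , q)) ne))))

  -- In the factorization of γ, an i in Π₊ can be commuted to the front, so χ(σ_i, σ_a) = 0 for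
  -- every a ≠ i and only the i-th coefficient survives. `χ-minus` is the mirror image in the second
  -- argument, for Π₋.
  χ-plus : ∀ i → Plus i → ∀ {v} → Sol v (simp i) → ∀ β → v ∙ Φ β ~ cf β i * (v ∙ σ i)
  χ-plus i p {v} q β = ~trans (∙-cong (~Vrefl {v}) (↑V (Φ-lin β))) (~trans (∙-lin v (cf β) σ) (sumK-single (λ a → cf β a * (v ∙ σ a)) i (λ a ne → ~trans (*-congˡ (z a ne)) (zeroʳ _))))
    where
    z : ∀ a → ¬ a ≡ i → v ∙ σ a ~ 0#
    z a ne = [ (λ gt → Z-simp-< i a gt v q) , (λ lt → Z-simp-same (inj₁ (p , ℕₚ.<-trans lt p)) (λ e → ne (sym e)) v q) ]′ (toℕ-≢ (λ e → ne (sym e)))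

  χ-minus : ∀ j → Minus j → ∀ {u v β} → Sol v (simp j) → Sol u β → u ∙ σ j ~ cf β j * (v ∙ σ j)
  χ-minus j m {u} {v} {β} q p = begin
    u ∙ σ j ≈⟨ toG p ⟩
    negV (G v) ∙ Φ β ≈⟨ ∙-cong (~Vrefl {negV (G v)}) (↑V (Φ-lin β)) ⟩
    negV (G v) ∙ linΠ (cf β) ≈⟨ ∙-lin (negV (G v)) (cf β) σ ⟩
    sumK (λ a → cf β a * (negV (G v) ∙ σ a)) ≈⟨ sumK-single (λ a → cf β a * (negV (G v) ∙ σ a)) j (λ a ne → ~trans (*-congˡ (z a ne)) (zeroʳ _)) ⟩
    cf β j * (negV (G v) ∙ σ j) ≈⟨ *-congˡ (~sym (toG q)) ⟩
    cf β j * (v ∙ σ j) ∎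
    where
    open ~-Reasoning
    toG : ∀ {u β} → Sol u β → u ∙ σ j ~ negV (G v) ∙ Φ β
    toG {u} {β} p = ~trans (χ-serre p q) (~trans (-‿cong (~trans (~sym (G-iso v (Φ (γ⁻ β)))) (∙-cong (~Vrefl {G v}) (G-Φ β)))) (~sym (∙-negˡ (G v) (Φ β))))
    z : ∀ a → ¬ a ≡ j → negV (G v) ∙ σ a ~ 0#
    z a ne = ~-stable (Sol-exists (simp a) >>= λ (w , qw) → return (~trans (~sym (toG qw))
      ([ (λ lt → Z-simp-< a j lt w qw) , (λ gt → Z-simp-same (inj₂ (ℕₚ.≤-trans m (ℕₚ.<⇒≤ gt) , m)) ne w qw) ]′ (toℕ-≢ ne))))

  χ-self-Nn : ∀ {v j} → Sol v j → Nn (v ∙ Φ j)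
  χ-self-Nn {v} {j} q = Nn-cancel Nn-two two≁0 (Nn-resp (~sym (χ-self q)) (∙-Nn (Φ j)))

  -- χ(ρ_k, β) is a positive multiple of the coefficient of β at σ_k.
  χ-ρf-Nn : ∀ k {u β} → Pos β → Sol u (ρf k) → Nn (u ∙ Φ β)
  χ-ρf-Nn k {u} {β} pβ p = [ plus , minus ]′ (ℕₚ.<-≤-connex (toℕ k) r)
    where
    plus : Plus k → Nn (u ∙ Φ β)
    plus pl = Nn-resp (~sym (χ-plus k pl q β)) (Nn-* (Pos-Nn β pβ k) (χ-self-Nn q))
      where
      q : Sol u (simp k)
      q = subst (Sol u) (ρf-plus k pl) p
    minus : Minus k → Nn (u ∙ Φ β)
    minus m = Sol-exists β >>= λ (w , qw) → Sol-exists (simp k) >>= λ (v , qv) → Nn-resp (~sym (~trans (χ-serre p qw) (~trans (-‿cong (~trans (~reflexive (cong (λ x → w ∙ Φ x) (γ⁻ρf-minus k m)))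
        (~trans (∙-cong (~Vrefl {w}) (Φ-neg~ (simp k))) (∙-negʳ w (σ k))))) (~trans (-‿involutive _) (χ-minus k m qv qw))))) (Nn-* (Pos-Nn β pβ k) (χ-self-Nn qv))

  Z-both⇒perp : ∀ {j k} → Z j k → Z k j → Φ j ∙ Φ k ~ 0#
  Z-both⇒perp {j} {k} a b = ~-stable (Sol-exists j >>= λ (u , p) → Sol-exists k >>= λ (v , q) → return (~trans (~sym (χ-sym p q)) (~trans (+-cong (a u p) (b v q)) (+-identityˡ _))))

  -- The product of all reflections of Π₊ is an isometry carrying -σ_i to ρ_i and σ_j to ρ_j.
  ρf-perp⇒perp : ∀ i j → Plus i → Minus j → Φ (ρf i) ∙ Φ (ρf j) ~ 0# → σ i ∙ σ j ~ 0#
  ρf-perp⇒perp i j p m e = neg-0 (begin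
    - (σ i ∙ σ j) ≈⟨ ~sym (∙-negˡ (σ i) (σ j)) ⟩
    negV (σ i) ∙ σ j ≈⟨ ∙-cong (~Vsym (Φ-neg~ (simp i))) (~Vrefl {σ j}) ⟩
    Φ (neg (simp i)) ∙ σ j ≈⟨ ~sym (act-iso (map simp (pre r)) (Φ (neg (simp i))) (σ j)) ⟩
    act (map simp (pre r)) (Φ (neg (simp i))) ∙ act (map simp (pre r)) (σ j) ≈⟨ ~sym (∙-cong (↑V (Φ-act (map simp (pre r)) (neg (simp i)))) (↑V (Φ-act (map simp (pre r)) (simp j)))) ⟩
    Φ (sact (pre r) (neg (simp i))) ∙ Φ (sact (pre r) (simp j)) ≈⟨ ~reflexive (cong₂ (λ x y → Φ x ∙ Φ y) fi fj) ⟩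
    Φ (ρf i) ∙ Φ (ρf j) ≈⟨ e ⟩
    0# ∎)
    where
    open ~-Reasoning
    c = r ℕ.∸ suc (toℕ i)
    r≡ : suc (toℕ i) ℕ.+ c ≡ r
    r≡ = ℕₚ.m+[n∸m]≡n p
    mid = applyUpTo (λ x → cyc (suc (toℕ i) ℕ.+ x)) c
    pre-r : pre r ≡ pre (toℕ i) ++ i ∷ mid
    pre-r = trans (cong pre (sym r≡)) (trans (applyUpTo-+ cyc (suc (toℕ i)) c) (trans (cong (_++ mid) (sym (Listₚ.applyUpTo-∷ʳ cyc (toℕ i))))
      (trans (Listₚ.++-assoc (pre (toℕ i)) (cyc (toℕ i) ∷ []) mid) (cong (λ l → pre (toℕ i) ++ l ∷ mid) (cyc-toℕ i)))))
    mid-perp : All (λ a → σ a ∙ σ i ~ 0#) mid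
    mid-perp = All.map (λ {a} (gt , lt) → orth (inj₁ (subst (toℕ a ℕ.<_) r≡ lt , p)) (λ e → ℕₚ.<-irrefl (sym (cong toℕ e)) gt)) (mid-> (suc (toℕ i)) c (ℕₚ.≤-trans (ℕₚ.≤-reflexive r≡) r≤n))
    pre-perp : All (λ a → σ a ∙ σ i ~ 0#) (pre (toℕ i))
    pre-perp = All.map (λ {a} lt → orth (inj₁ (ℕₚ.<-trans lt p , p)) (λ e → ℕₚ.<-irrefl (cong toℕ e) lt)) (pre-< (toℕ i) (ℕₚ.<⇒≤ (Finₚ.toℕ<n i)))
    sr : sact (pre r) (simp i) ≡ neg (simp i)
    sr = trans (cong (λ L → sact L (simp i)) pre-r) (trans (sact-++ (pre (toℕ i)) (i ∷ mid) (simp i)) (trans (cong (λ x → sact (pre (toℕ i)) (s i x)) (sact-perp mid i mid-perp))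
      (trans (sact-neg (pre (toℕ i)) (simp i)) (cong neg (sact-perp (pre (toℕ i)) i pre-perp)))))
    fi : sact (pre r) (neg (simp i)) ≡ ρf i
    fi = trans (sact-neg (pre r) (simp i)) (trans (cong neg sr) (trans (neg-neg (simp i)) (sym (ρf-plus i p))))
    d = toℕ j ℕ.∸ r
    j≡ : r ℕ.+ d ≡ toℕ j
    j≡ = ℕₚ.m+[n∸m]≡n m
    mid′ = applyUpTo (λ x → cyc (r ℕ.+ x)) d
    mid′-perp : All (λ a → σ a ∙ σ j ~ 0#) mid′
    mid′-perp = All.map (λ {a} (ge , lt) → orth (inj₂ (ge , m)) (λ e → ℕₚ.<-irrefl (cong toℕ e) (subst (toℕ a ℕ.<_) j≡ lt))) (mid-> r d (ℕₚ.≤-trans (ℕₚ.≤-reflexive j≡) (ℕₚ.<⇒≤ (Finₚ.toℕ<n j))))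
    fj : sact (pre r) (simp j) ≡ ρf j
    fj = sym (trans (cong₂ (λ L l → sact L (simp l)) (trans (cong pre (sym j≡)) (applyUpTo-+ cyc r d)) (cyc-toℕ j)) (trans (sact-++ (pre r) mid′ (simp j)) (cong (sact (pre r)) (sact-perp mid′ j mid′-perp))))

  Z-iter : ∀ e {x y} → Z (iter γI e x) (iter γI e y) → Z x y
  Z-iter zero z = z
  Z-iter (suc e) {x} {y} z = subst₂ Z (γ⁻γ x) (γ⁻γ y) (Z-γ⁻ (Z-iter e z))

  G-iter : ℕ → V → V
  G-iter e u = iter G e u
  Sol-γI : ∀ {u j} → Sol u j → Sol (G u) (γI j)
  Sol-γI {u} {j} p l = ~trans (~trans (+-congˡ (~sym (G-neg (G u) l))) (~sym (G-+ u (negV (G u)) l))) (~trans (act-cong γW p l) (~sym (↑ (Φ-act γW j l))))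
  Sol-iter : ∀ e {u j} → Sol u j → Sol (G-iter e u) (iter γI e j)
  Sol-iter zero p = p
  Sol-iter (suc e) p = Sol-iter e (Sol-γI p)
  χ-iter : ∀ e u k → G-iter e u ∙ Φ (iter γI e k) ~ u ∙ Φ k
  χ-iter zero u k = ~refl
  χ-iter (suc e) u k = ~trans (χ-iter e (G u) (γI k)) (~trans (∙-cong (~Vrefl {G u}) (↑V (Φ-act γW k))) (G-iso u (Φ k)))

  -- At the end of a run χ changes sign, so a root following it inside the window and still positive
  -- has χ both ≥ 0 and ≤ 0.
  run-end : ∀ i β → Pos β → Pos (iter γI (L i) β) → Z (ρf i) β
  run-end i β pβ pβ′ u p = Nn-antisym (χ-ρf-Nn i pβ p) (Nn-resp (~trans (∙-negˡ (G-iter (L i) u) _) (-‿cong (χ-iter (L i) u β)))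
      (χ-ρf-Nn (star i) pβ′ q))
    where
    q : Sol (negV (G-iter (L i) u)) (ρf (star i))
    q = subst (Sol (negV (G-iter (L i) u))) (trans (cong neg (star-eq i)) (neg-neg (ρf (star i)))) (Sol-neg (Sol-iter (L i) p))

  -- The window gives χ(ρ_j, ρ_i) = 0 anyway; once both values vanish, so does their sum, the inner
  -- product.
  Z-ρf-ρf⇒perp : ∀ i j → Plus i → Minus j → Z (ρf i) (ρf j) → σ i ∙ σ j ~ 0#
  Z-ρf-ρf⇒perp i j p m z = ρf-perp⇒perp i j p m (Z-both⇒perp z (Z-window j i (ℕₚ.<-≤-trans p m)))
  Z-ρf-γρf⇒perp : ∀ i j → Plus i → Minus j → Z (ρf j) (γI (ρf i)) → σ i ∙ σ j ~ 0#
  Z-ρf-γρf⇒perp i j p m z = Z-both⇒perp (Z-simp-< i j (ℕₚ.<-≤-trans p m)) (Z-negˡ⁻ (subst₂ Z (γ⁻ρf-minus j m) (trans (γ⁻γ (ρf i)) (ρf-plus i p)) (Z-γ⁻ z)))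

  Z-star : ∀ a b → ¬ a ≡ b → ¬ (Plus a × Minus b) → Z (ρf a) (ρf b)
  Z-star a b ne h = [ (λ lt → Z-ρf-same (same lt) ne) , (λ gt → Z-window a b gt) ]′ (toℕ-≢ ne)
    where
    same : toℕ a ℕ.< toℕ b → Same a b
    same lt = [ (λ pa → inj₁ (pa , ℕₚ.≰⇒> (λ mb → h (pa , mb)))) , (λ ma → inj₂ (ma , ℕₚ.≤-trans ma (ℕₚ.<⇒≤ lt))) ]′ (ℕₚ.<-≤-connex (toℕ a) r)

  -- If one run ended while ρ_j, respectively γρ_i, is still carried to a positive root, `run-end`
  -- would make σ_i and σ_j orthogonal; hence L j ≤ L i ≤ L j + 1. In either case the sides of i*
  -- and j* are forced: otherwise χ would vanish on the exit roots and, pulled back by γ, at the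
  -- start.
  module Edge (i j : Fin n) (p : Plus i) (m : Minus j) (adj : ¬ (σ i ∙ σ j ~ 0#)) where
    i≢j : ¬ i ≡ j
    i≢j e = ℕₚ.<-irrefl (cong toℕ e) (ℕₚ.<-≤-trans p m)
    L-lower : L j ℕ.≤ L i
    L-lower = ℕₚ.≮⇒≥ λ lt → adj (Z-ρf-ρf⇒perp i j p m (run-end i (ρf j) (Pos-ρf j) (L-Pos j lt)))
    L-upper : L i ℕ.≤ suc (L j)
    L-upper = ℕₚ.≮⇒≥ λ lt → adj (Z-ρf-γρf⇒perp i j p m (run-end j (γI (ρf i)) (L-Pos i {1} (ℕₚ.≤-trans (ℕ.s≤s (L>0 j)) (ℕₚ.<⇒≤ lt))) (L-Pos i lt)))
    pm? : ∀ a b → Dec (Plus a × Minus b)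
    pm? a b = (toℕ a ℕₚ.<? r) ×-dec (r ℕₚ.≤? toℕ b)
    Z-neg-neg : ∀ {a b} → Z a b → Z (neg a) (neg b)
    Z-neg-neg z = Z-negˡ (Z-negʳ z)
    colour-eq : L i ≡ L j → Plus (star i) × Minus (star j)
    colour-eq e = decidable-stable (pm? (star i) (star j)) λ h → adj (Z-ρf-ρf⇒perp i j p m (Z-iter (L i)
      (subst₂ Z (sym (star-eq i)) (trans (sym (star-eq j)) (cong (λ l → iter γI l (ρf j)) (sym e))) (Z-neg-neg (Z-star (star i) (star j) (λ q → i≢j (star-inj {i} {j} q)) h)))))
    colour-suc : L i ≡ suc (L j) → Plus (star j) × Minus (star i)
    colour-suc e = decidable-stable (pm? (star j) (star i)) λ h → adj (Z-ρf-γρf⇒perp i j p m (Z-iter (L j)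
      (subst₂ Z (sym (star-eq j)) (trans (sym (star-eq i)) (cong (λ l → iter γI l (ρf i)) e)) (Z-neg-neg (Z-star (star j) (star i) (λ q → i≢j (sym (star-inj {j} {i} q))) h)))))
    edge : (L i ≡ L j × (Plus (star i) × Minus (star j))) ⊎ (L i ≡ suc (L j) × (Plus (star j) × Minus (star i)))
    edge = go (ℕₚ.m≤n⇒m<n∨m≡n L-lower)
      where
      go : (L j ℕ.< L i) ⊎ (L j ≡ L i) → (L i ≡ L j × (Plus (star i) × Minus (star j))) ⊎ (L i ≡ suc (L j) × (Plus (star j) × Minus (star i)))
      go (inj₁ lt) = inj₂ (e , colour-suc e)
        where
        e : L i ≡ suc (L j)
        e = ℕₚ.≤-antisym {L i} {suc (L j)} L-upper lt
      go (inj₂ e) = inj₁ (sym e , colour-eq (sym e))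

  -- Irreducibility makes the Dynkin graph connected.
  connected : (S : Fin n → Bool) → (∀ i j → S i ≡ true → S j ≡ false → σ i ∙ σ j ~ 0#) → ∀ i j → S i ≡ S j
  connected S sep i j = conclude (irreducible P P-sep)
    where
    Supp : Bool → Fin M → Set
    Supp b k = ∀ l → ¬ S l ≡ b → cf k l ~ 0#
    sep′ : ∀ a l → ¬ S a ≡ S l → σ a ∙ σ l ~ 0#
    sep′ a l ne = go (S a) (S l) refl refl ne
      where
      go : ∀ x y → S a ≡ x → S l ≡ y → ¬ x ≡ y → σ a ∙ σ l ~ 0#
      go true true _ _ ne = ⊥-elim (ne refl)
      go false false _ _ ne = ⊥-elim (ne refl)
      go true false e f _ = sep a l e f
      go false true e f _ = ~trans (∙-comm (σ a) (σ l)) (sep l a f e)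
    Supp-perp : ∀ {b k} → Supp b k → ∀ a → ¬ S a ≡ b → σ a ∙ Φ k ~ 0#
    Supp-perp {b} {k} sp a ne = ~trans (∙-cong (~Vrefl {σ a}) (↑V (Φ-lin k))) (~trans (∙-lin (σ a) (cf k) σ) (sumK-0 term))
      where
      term : ∀ l → cf k l * (σ a ∙ σ l) ~ 0#
      term l = [ (λ e → ~trans (*-congˡ (sep′ a l (λ q → ne (trans q e)))) (zeroʳ _)) , (λ ne′ → ~trans (*-congʳ (sp l ne′)) (zeroˡ _)) ]′ (dec⊎ (S l Bool.≟ b))
        where
        dec⊎ : ∀ {A : Set} → Dec A → A ⊎ ¬ A
        dec⊎ (yes a) = inj₁ a
        dec⊎ (no a) = inj₂ a
    Supp-orth : ∀ {k k′} → Supp true k → Supp false k′ → Φ k ∙ Φ k′ ~ 0#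
    Supp-orth {k} {k′} s₁ s₂ = ~trans (∙-comm (Φ k) (Φ k′)) (~trans (∙-cong (~Vrefl {Φ k′}) (↑V (Φ-lin k))) (~trans (∙-lin (Φ k′) (cf k) σ) (sumK-0 term)))
      where
      term : ∀ l → cf k l * (Φ k′ ∙ σ l) ~ 0#
      term l = go (S l) refl
        where
        go : ∀ x → S l ≡ x → cf k l * (Φ k′ ∙ σ l) ~ 0#
        go true e = ~trans (*-congˡ (~trans (∙-comm (Φ k′) (σ l)) (Supp-perp s₂ l (λ q → case-tf (trans (sym e) q))))) (zeroʳ _)
          where
          case-tf : ¬ true ≡ false
          case-tf ()
        go false e = ~trans (*-congʳ (s₁ l (λ q → case-ft (trans (sym e) q)))) (zeroˡ _)
          where
          case-ft : ¬ false ≡ true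
          case-ft ()
    Supp-sact : ∀ v i → Supp (S i) (sact v (simp i))
    Supp-sact [] i l ne = ~trans (cf-simp i l) (~reflexive (δ-other (λ e → ne (cong S (sym e)))))
    Supp-sact (a ∷ v) i l ne = go (S a Bool.≟ S i)
      where
      go : Dec (S a ≡ S i) → cf (s a (sact v (simp i))) l ~ 0#
      go (yes e) = ~trans (cf-s a (sact v (simp i)) l (λ q → ne (trans (cong S q) e))) (Supp-sact v i l ne)
      -- A letter from the other side of the separation is orthogonal to the root and acts
      -- trivially.
      go (no na) = ~trans (~reflexive (cong (λ k → cf k l) (ref-perp (Supp-perp (Supp-sact v i) a na)))) (Supp-sact v i l ne)
    Supp-neg : ∀ {b k} → Supp b k → Supp b (neg k)
    Supp-neg {b} {k} sp l ne = ~trans (cf-uniq (neg k) (λ i → - cf k i) (~Vtrans (Φ-neg~ k) (~Vtrans (negV-cong (↑V (Φ-lin k))) (linΠ-neg (cf k)))) l) (~trans (-‿cong (sp l ne)) -0#≈0#)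
    vertex : ∀ k → ∃ λ i → Supp (S i) k
    vertex k = go (Pos⊎Neg k)
      where
      go : Pos k ⊎ Neg k → ∃ λ i → Supp (S i) k
      go (inj₁ p) = let v , i , e = Pos⇒conj-simp k p in i , subst (Supp (S i)) (sym e) (Supp-sact v i)
      go (inj₂ q) = let v , i , e = Pos⇒conj-simp (neg k) (Neg⇒Pos-neg q) in i , subst (Supp (S i)) (trans (cong neg (sym e)) (neg-neg k)) (Supp-neg (Supp-sact v i))
    P : Fin M → Bool
    P k = S (proj₁ (vertex k))
    P-Supp : ∀ k → Supp (P k) k
    P-Supp k = proj₂ (vertex k)
    P-simp : ∀ i → P (simp i) ≡ S i
    P-simp i = decidable-stable (P (simp i) Bool.≟ S i) (λ ne → 1≁0 (~trans (~sym (~trans (cf-simp i i) (~reflexive (δ-self i)))) (P-Supp (simp i) i (λ e → ne (sym e)))))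
    P-sep : ∀ j k → P j ≡ true → P k ≡ false → Φ j ∙ Φ k R₀.≈ 0#
    P-sep j k e f = ∙0-strict j k (Supp-orth (subst (λ b → Supp b j) e (P-Supp j)) (subst (λ b → Supp b k) f (P-Supp k)))
    agree : ∀ b → (∀ k → P k ≡ b) → S i ≡ S j
    agree b all = trans (sym (P-simp i)) (trans (all (simp i)) (trans (sym (all (simp j))) (P-simp j)))
    conclude : (∀ k → P k ≡ true) ⊎ (∀ k → P k ≡ false) → S i ≡ S j
    conclude (inj₁ all) = agree true all
    conclude (inj₂ all) = agree false all

-- Uniform exit times and the period of ρ.

does-true : ∀ {A : Set} (d : Dec A) → does d ≡ true → A
does-true (yes a) _ = a

injective⇒surjective : ∀ {k} (f : Fin k → Fin k) → (∀ {i j} → f i ≡ f j → i ≡ j) → ∀ y → ∃ λ x → f x ≡ y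
injective⇒surjective {suc k} f inj y = decidable-stable (Finₚ.any? (λ x → f x Finₚ.≟ y)) λ none →
  let avoid = λ x (e : y ≡ f x) → none (x , sym e)
      a , b , lt , e = Finₚ.pigeonhole (ℕₚ.n<1+n k) (λ x → Fin.punchOut (avoid x))
  in ℕₚ.<-irrefl (cong toℕ (inj (Finₚ.punchOut-injective (avoid a) (avoid b) e))) lt

module Periodicity (F : OrderedField) (n : ℕ) (D : BipRootSystem F n) where
  open Bipartite F n D public

  private
    profD : ∀ {A B : Set} → Dec A → Dec B → ℕ → ℕ × Bool
    profD (yes _) (yes _) l = l , true
    profD (yes _) (no _) l = l , false
    profD (no _) (yes _) l = suc l , false
    profD (no _) (no _) l = l , true
    profD-pp : ∀ {A B : Set} (d : Dec A) (e : Dec B) l → A → B → profD d e l ≡ (l , true)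
    profD-pp (yes _) (yes _) l a b = refl
    profD-pp (no na) _ l a b = ⊥-elim (na a)
    profD-pp (yes _) (no nb) l a b = ⊥-elim (nb b)
    profD-pm : ∀ {A B : Set} (d : Dec A) (e : Dec B) l → A → ¬ B → profD d e l ≡ (l , false)
    profD-pm (yes _) (no _) l a b = refl
    profD-pm (no na) _ l a b = ⊥-elim (na a)
    profD-pm (yes _) (yes b) l a nb = ⊥-elim (nb b)
    profD-mp : ∀ {A B : Set} (d : Dec A) (e : Dec B) l → ¬ A → B → profD d e l ≡ (suc l , false)
    profD-mp (no _) (yes _) l a b = refl
    profD-mp (yes a) _ l na b = ⊥-elim (na a)
    profD-mp (no _) (no nb) l a b = ⊥-elim (nb b)
    profD-mm : ∀ {A B : Set} (d : Dec A) (e : Dec B) l → ¬ A → ¬ B → profD d e l ≡ (l , true)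
    profD-mm (no _) (no _) l a b = refl
    profD-mm (yes a) _ l na b = ⊥-elim (na a)
    profD-mm (no _) (yes b) l a nb = ⊥-elim (nb b)

  Plus? : ∀ i → Dec (Plus i)
  Plus? i = toℕ i ℕₚ.<? r
  Minus⇒¬Plus : ∀ {i} → Minus i → ¬ Plus i
  Minus⇒¬Plus m p = ℕₚ.<-irrefl refl (ℕₚ.<-≤-trans p m)
  ¬Plus⇒Minus : ∀ {i} → ¬ Plus i → Minus i
  ¬Plus⇒Minus = ℕₚ.≮⇒≥

  -- The shape of the end of the run of i: when it happens (in half-turns, relative to i's colour) and
  -- whether * preserves the colour; adjacent vertices agree.
  prof : Fin n → ℕ × Bool
  prof i = profD (Plus? i) (Plus? (star i)) (L i)

  private
    prof-edge : ∀ i j → Plus i → Minus j → ¬ (σ i ∙ σ j ~ 0#) → prof i ≡ prof j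
    prof-edge i j p m adj = go (Edge.edge i j p m adj)
      where
      go : (L i ≡ L j × (Plus (star i) × Minus (star j))) ⊎ (L i ≡ suc (L j) × (Plus (star j) × Minus (star i))) → prof i ≡ prof j
      go (inj₁ (e , p′ , m′)) = trans (profD-pp (Plus? i) (Plus? (star i)) (L i) p p′) (trans (cong (_, true) e)
        (sym (profD-mm (Plus? j) (Plus? (star j)) (L j) (Minus⇒¬Plus {j} m) (Minus⇒¬Plus {star j} m′))))
      go (inj₂ (e , p′ , m′)) = trans (profD-pm (Plus? i) (Plus? (star i)) (L i) p (Minus⇒¬Plus {star i} m′)) (trans (cong (_, false) e)
        (sym (profD-mp (Plus? j) (Plus? (star j)) (L j) (Minus⇒¬Plus {j} m) p′)))

  -- No edge joins a level set of f to its complement, so connectedness applies to the indicator of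
  -- that level set.
  edge-constant : ∀ {A : Set} (_≟_ : (x y : A) → Dec (x ≡ y)) (f : Fin n → A) → (∀ i j → Plus i → Minus j → ¬ (σ i ∙ σ j ~ 0#) → f i ≡ f j) → ∀ i j → f j ≡ f i
  edge-constant _≟_ f edge i j = does-true (dec j) (trans (sym (connected S sep i j)) (dec-true (dec i) refl))
    where
    dec : ∀ k → Dec (f k ≡ f i)
    dec k = f k ≟ f i
    S : Fin n → Bool
    S k = does (dec k)
    clash : ∀ {b} → b ≡ true → b ≡ false → ⊥
    clash {true} _ ()
    clash {false} () _
    differ : ∀ a b → S a ≡ true → S b ≡ false → ¬ f a ≡ f b
    differ a b p q e = clash (dec-true (dec b) (trans (sym e) (does-true (dec a) p))) q
    sep : ∀ a b → S a ≡ true → S b ≡ false → σ a ∙ σ b ~ 0#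
    sep a b p q = go (ℕₚ.<-≤-connex (toℕ a) r) (ℕₚ.<-≤-connex (toℕ b) r)
      where
      ne : ¬ f a ≡ f b
      ne = differ a b p q
      a≢b : ¬ a ≡ b
      a≢b e = ne (cong f e)
      go : Plus a ⊎ Minus a → Plus b ⊎ Minus b → σ a ∙ σ b ~ 0#
      go (inj₁ x) (inj₁ y) = orth {a} {b} (inj₁ (x , y)) a≢b
      go (inj₂ x) (inj₂ y) = orth {a} {b} (inj₂ (x , y)) a≢b
      go (inj₁ x) (inj₂ y) = ~-stable λ adj → ne (edge a b x y adj)
      go (inj₂ x) (inj₁ y) = ~-stable λ adj → ne (sym (edge b a y x (λ z → adj (~trans (∙-comm (σ a) (σ b)) z))))

  prof-const : ∀ i j → prof j ≡ prof i
  prof-const = edge-constant (≡-dec ℕₚ._≟_ Bool._≟_) prof prof-edge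

  -- Named after the parity of the Coxeter number, h = 2l or h = 2l + 1.
  data Shape : Set where
    even : ∀ l → (∀ i → L i ≡ l) → (∀ i → Plus i → Plus (star i)) → (∀ i → Minus i → Minus (star i)) → Shape
    odd : ∀ l → (∀ i → Plus i → L i ≡ suc l) → (∀ i → Minus i → L i ≡ l) → (∀ i → Plus i → Minus (star i)) → (∀ i → Minus i → Plus (star i)) → Shape

  private
    read-p : ∀ {A B : Set} (d : Dec A) (e : Dec B) l {l₀ b} → A → profD d e l ≡ (l₀ , b) → (l ≡ l₀) × ((B × b ≡ true) ⊎ (¬ B × b ≡ false))
    read-p (yes _) (yes b) l a refl = refl , inj₁ (b , refl)
    read-p (yes _) (no nb) l a refl = refl , inj₂ (nb , refl)
    read-p (no na) _ l a _ = ⊥-elim (na a)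
    read-m : ∀ {A B : Set} (d : Dec A) (e : Dec B) l {l₀ b} → ¬ A → profD d e l ≡ (l₀ , b) → (B × suc l ≡ l₀ × b ≡ false) ⊎ (¬ B × l ≡ l₀ × b ≡ true)
    read-m (no _) (yes b) l a refl = inj₁ (b , refl , refl)
    read-m (no _) (no nb) l a refl = inj₂ (nb , refl , refl)
    read-m (yes a) _ l na _ = ⊥-elim (na a)

  private
    readP : ∀ i l b → Plus i → prof i ≡ (l , b) → (L i ≡ l) × ((Plus (star i) × b ≡ true) ⊎ (¬ Plus (star i) × b ≡ false))
    readP i l b p e = read-p (Plus? i) (Plus? (star i)) (L i) {l} {b} p e
    readM : ∀ i l b → Minus i → prof i ≡ (l , b) → (Plus (star i) × suc (L i) ≡ l × b ≡ false) ⊎ (¬ Plus (star i) × L i ≡ l × b ≡ true)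
    readM i l b m e = read-m (Plus? i) (Plus? (star i)) (L i) {l} {b} (Minus⇒¬Plus {i} m) e
    only-left : ∀ {A B : Set} → (A × true ≡ true) ⊎ (B × true ≡ false) → A
    only-left (inj₁ (a , _)) = a
    only-left (inj₂ (_ , ()))
    only-right : ∀ {A B : Set} → (A × false ≡ true) ⊎ (B × false ≡ false) → B
    only-right (inj₁ (_ , ()))
    only-right (inj₂ (b , _)) = b
    only-left′ : ∀ {A A′ B B′ : Set} → (A × A′ × false ≡ false) ⊎ (B × B′ × false ≡ true) → A × A′
    only-left′ (inj₁ (a , a′ , _)) = a , a′
    only-left′ (inj₂ (_ , _ , ()))
    only-right′ : ∀ {A A′ B B′ : Set} → (A × A′ × true ≡ false) ⊎ (B × B′ × true ≡ true) → B × B′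
    only-right′ (inj₁ (_ , _ , ()))
    only-right′ (inj₂ (b , b′ , _)) = b , b′
    colour : ∀ i → Plus i ⊎ Minus i
    colour i = ℕₚ.<-≤-connex (toℕ i) r
    shape-true : ∀ l → (∀ i → prof i ≡ (l , true)) → Shape
    shape-true l c = even l (λ i → h i (colour i)) (λ i p → only-left (proj₂ (readP i l true p (c i)))) (λ i m → ¬Plus⇒Minus {star i} (proj₁ (only-right′ (readM i l true m (c i)))))
      where
      h : ∀ i → Plus i ⊎ Minus i → L i ≡ l
      h i (inj₁ p) = proj₁ (readP i l true p (c i))
      h i (inj₂ m) = proj₂ (only-right′ (readM i l true m (c i)))
    shape-false : ∀ l → (∀ i → prof i ≡ (suc l , false)) → Shape
    shape-false l c = odd l (λ i p → proj₁ (readP i (suc l) false p (c i))) (λ i m → ℕₚ.suc-injective (proj₂ (only-left′ (readM i (suc l) false m (c i)))))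
      (λ i p → ¬Plus⇒Minus {star i} (only-right (proj₂ (readP i (suc l) false p (c i))))) (λ i m → proj₁ (only-left′ (readM i (suc l) false m (c i))))
    not-zero : ∀ i → ¬ prof i ≡ (0 , false)
    not-zero i c = h (colour i)
      where
      h : Plus i ⊎ Minus i → ⊥
      h (inj₁ p) = ℕₚ.<-irrefl (sym (proj₁ (readP i 0 false p c))) (L>0 i)
      h (inj₂ m) = ℕₚ.1+n≢0 (proj₂ (only-left′ (readM i 0 false m c)))
    shape-of : ∀ x → (∀ i → prof i ≡ x) → Shape
    shape-of (l , true) c = shape-true l c
    shape-of (zero , false) c = ⊥-elim (not-zero (cyc 0) (c (cyc 0)))
    shape-of (suc l , false) c = shape-false l c

  shape : Shape
  shape = shape-of (prof (cyc 0)) (prof-const (cyc 0))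

  star-surj : ∀ i → ∃ λ j → star j ≡ i
  star-surj = injective⇒surjective star star-inj

  private
    embed : (P Q : ℕ) → (f : ∀ i → toℕ i ℕ.< P → Fin n) → P ℕ.≤ n → (∀ i p → toℕ (f i p) ℕ.< Q) → (∀ i j p q → f i p ≡ f j q → i ≡ j) → P ℕ.≤ Q
    embed P Q f le bd inj = Finₚ.injective⇒≤ {f = g} g-inj
      where
      v : Fin P → Fin n
      v k = fromℕ< (ℕₚ.<-≤-trans (Finₚ.toℕ<n k) le)
      v≡ : ∀ k → toℕ (v k) ≡ toℕ k
      v≡ k = Finₚ.toℕ-fromℕ< _
      vp : ∀ k → toℕ (v k) ℕ.< P
      vp k = subst (ℕ._< P) (sym (v≡ k)) (Finₚ.toℕ<n k)
      g : Fin P → Fin Q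
      g k = fromℕ< (bd (v k) (vp k))
      g-inj : ∀ {k l} → g k ≡ g l → k ≡ l
      g-inj {k} {l} e = Finₚ.toℕ-injective (trans (sym (v≡ k)) (trans (cong toℕ (inj (v k) (v l) (vp k) (vp l) (Finₚ.toℕ-injective
        (trans (sym (Finₚ.toℕ-fromℕ< (bd (v k) (vp k)))) (trans (cong toℕ e) (Finₚ.toℕ-fromℕ< (bd (v l) (vp l)))))))) (v≡ l)))

  -- The injection i ↦ i* exchanges Π₊ and Π₋, so the two have equal size.
  odd⇒n≡r+r : (∀ i → Plus i → Minus (star i)) → (∀ i → Minus i → Plus (star i)) → n ≡ r ℕ.+ r
  odd⇒n≡r+r pm mp = trans (sym (ℕₚ.m+[n∸m]≡n r≤n)) (cong (r ℕ.+_) (ℕₚ.≤-antisym n-r≤r r≤n-r))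
    where
    low : ∀ j → Minus j → toℕ j ℕ.∸ r ℕ.< n ℕ.∸ r
    low j m = ℕₚ.∸-monoˡ-< (Finₚ.toℕ<n j) m
    shift : Fin n → Fin n
    shift j = fromℕ< (ℕₚ.≤-<-trans (ℕₚ.m∸n≤m (toℕ j) r) (Finₚ.toℕ<n j))
    shift≡ : ∀ j → toℕ (shift j) ≡ toℕ j ℕ.∸ r
    shift≡ j = Finₚ.toℕ-fromℕ< _
    shift-inj : ∀ i j → Minus i → Minus j → shift i ≡ shift j → i ≡ j
    shift-inj i j a b e = Finₚ.toℕ-injective (ℕₚ.∸-cancelʳ-≡ a b (trans (sym (shift≡ i)) (trans (cong toℕ e) (shift≡ j))))
    r≤n-r : r ℕ.≤ n ℕ.∸ r
    r≤n-r = embed r (n ℕ.∸ r) (λ i p → shift (star i)) r≤n (λ i p → subst (ℕ._< n ℕ.∸ r) (sym (shift≡ (star i))) (low (star i) (pm i p)))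
      (λ i j p q e → star-inj (shift-inj (star i) (star j) (pm i p) (pm j q) e))
    up-lt : ∀ i → toℕ i ℕ.< n ℕ.∸ r → r ℕ.+ toℕ i ℕ.< n
    up-lt i p = subst (r ℕ.+ toℕ i ℕ.<_) (ℕₚ.m+[n∸m]≡n r≤n) (ℕₚ.+-monoʳ-< r p)
    up : ∀ i → toℕ i ℕ.< n ℕ.∸ r → Fin n
    up i p = fromℕ< (up-lt i p)
    up≡ : ∀ i p → toℕ (up i p) ≡ r ℕ.+ toℕ i
    up≡ i p = Finₚ.toℕ-fromℕ< _
    up-minus : ∀ i p → Minus (up i p)
    up-minus i p = subst (r ℕ.≤_) (sym (up≡ i p)) (ℕₚ.m≤m+n r (toℕ i))
    n-r≤r : n ℕ.∸ r ℕ.≤ r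
    n-r≤r = embed (n ℕ.∸ r) r (λ i p → star (up i p)) (ℕₚ.m∸n≤m n r) (λ i p → mp (up i p) (up-minus i p))
      (λ i j p q e → Finₚ.toℕ-injective (ℕₚ.+-cancelˡ-≡ r (toℕ i) (toℕ j) (trans (sym (up≡ i p)) (trans (cong toℕ (star-inj e)) (up≡ j q)))))

  -- N₀ positive roots, enumerated by ρ_0, …, ρ_{N₀−1}; the next n roots are the negatives of ρ_0, …, ρ_{n−1}
  -- up to a permutation preserving the colours.
  record Period : Set where
    field
      N₀ : ℕ
      below : ∀ e i → e ℕ.* n ℕ.+ toℕ i ℕ.< N₀ → e ℕ.< L i
      below⁻ : ∀ e i → e ℕ.< L i → e ℕ.* n ℕ.+ toℕ i ℕ.< N₀
      turn : ∀ k → ∃ λ i → Same k i × ρI (N₀ ℕ.+ toℕ k) ≡ neg (ρf i)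
      turn⁻ : ∀ i → ∃ λ k → Same k i × ρI (N₀ ℕ.+ toℕ k) ≡ neg (ρf i)
      -- The block -Π₋ sits at the last n - r indices before 2N, counted mod 2N; applying γ moves it
      -- to indices 2N + j with j in Π₋, the ones described here.
      double : ∀ j → Minus j → ∃ λ i → Minus i × ρI (N₀ ℕ.+ N₀ ℕ.+ toℕ j) ≡ ρf i

  private
    period′ : Period
    period′ = go shape
      where
      open ℕₚ.≤-Reasoning
      row-< : ∀ e l (i : Fin n) → e ℕ.< l → e ℕ.* n ℕ.+ toℕ i ℕ.< l ℕ.* n
      row-< e l i lt = begin-strict
        e ℕ.* n ℕ.+ toℕ i <⟨ ℕₚ.+-monoʳ-< (e ℕ.* n) (Finₚ.toℕ<n i) ⟩
        e ℕ.* n ℕ.+ n ≡⟨ ℕₚ.+-comm (e ℕ.* n) n ⟩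
        suc e ℕ.* n ≤⟨ ℕₚ.*-monoˡ-≤ n lt ⟩
        l ℕ.* n ∎
      row-<⁻ : ∀ e l (i : Fin n) → e ℕ.* n ℕ.+ toℕ i ℕ.< l ℕ.* n → e ℕ.< l
      row-<⁻ e l i lt = ℕₚ.*-cancelʳ-< n e l (ℕₚ.≤-<-trans (ℕₚ.m≤m+n (e ℕ.* n) (toℕ i)) lt)
      go : Shape → Period
      go (even l L≡ pp mm) = record
        { N₀ = l ℕ.* n
        ; below = λ e i lt → subst (e ℕ.<_) (sym (L≡ i)) (row-<⁻ e l i lt)
        ; below⁻ = λ e i lt → row-< e l i (subst (e ℕ.<_) (L≡ i) lt)
        ; turn = λ k → star k , same k , hit k
        ; turn⁻ = λ i → let j , e = star-surj i in j , subst (Same j) e (same j) , trans (hit j) (cong (neg ∘ ρf) e)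
        ; double = λ j m → star (star j) , mm (star j) (mm j m) , dbl j }
        where
        same : ∀ k → Same k (star k)
        same k = [ (λ p → inj₁ (p , pp k p)) , (λ m → inj₂ (m , mm k m)) ]′ (ℕₚ.<-≤-connex (toℕ k) r)
        run-l : ∀ k → iter γI l (ρf k) ≡ neg (ρf (star k))
        run-l k = trans (cong (λ e → iter γI e (ρf k)) (sym (L≡ k))) (star-eq k)
        hit : ∀ k → ρI (l ℕ.* n ℕ.+ toℕ k) ≡ neg (ρf (star k))
        hit k = trans (ρI-iter l (toℕ k)) (run-l k)
        dbl : ∀ j → ρI (l ℕ.* n ℕ.+ l ℕ.* n ℕ.+ toℕ j) ≡ ρf (star (star j))
        dbl j = trans (cong ρI (ℕₚ.+-assoc (l ℕ.* n) (l ℕ.* n) (toℕ j))) (trans (ρI-iter l (l ℕ.* n ℕ.+ toℕ j)) (trans (cong (iter γI l) (hit j))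
          (trans (iter-neg l (ρf (star j))) (trans (cong neg (run-l (star j))) (neg-neg (ρf (star (star j))))))))
      go (odd l Lp Lm pm mp) = record
        { N₀ = l ℕ.* n ℕ.+ r
        ; below = below
        ; below⁻ = below⁻
        ; turn = turn
        ; turn⁻ = turn⁻
        ; double = λ j m → star (star j) , pm (star j) (mp j m) , dbl j m }
        where
        n≡ : n ≡ r ℕ.+ r
        n≡ = odd⇒n≡r+r pm mp
        below : ∀ e i → e ℕ.* n ℕ.+ toℕ i ℕ.< l ℕ.* n ℕ.+ r → e ℕ.< L i
        below e i lt = h (colour i)
          where
          h : Plus i ⊎ Minus i → e ℕ.< L i
          h (inj₁ p) = subst (e ℕ.<_) (sym (Lp i p)) (ℕₚ.*-cancelʳ-< n e (suc l) (begin-strict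
            e ℕ.* n ≤⟨ ℕₚ.m≤m+n (e ℕ.* n) (toℕ i) ⟩
            e ℕ.* n ℕ.+ toℕ i <⟨ lt ⟩
            l ℕ.* n ℕ.+ r ≤⟨ ℕₚ.+-monoʳ-≤ (l ℕ.* n) r≤n ⟩
            l ℕ.* n ℕ.+ n ≡⟨ ℕₚ.+-comm (l ℕ.* n) n ⟩
            suc l ℕ.* n ∎))
          h (inj₂ m) = subst (e ℕ.<_) (sym (Lm i m)) (ℕₚ.*-cancelʳ-< n e l (ℕₚ.+-cancelʳ-< r (e ℕ.* n) (l ℕ.* n) (ℕₚ.≤-<-trans (ℕₚ.+-monoʳ-≤ (e ℕ.* n) m) lt)))
        below⁻ : ∀ e i → e ℕ.< L i → e ℕ.* n ℕ.+ toℕ i ℕ.< l ℕ.* n ℕ.+ r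
        below⁻ e i lt = h (colour i)
          where
          h : Plus i ⊎ Minus i → e ℕ.* n ℕ.+ toℕ i ℕ.< l ℕ.* n ℕ.+ r
          h (inj₁ p) = ℕₚ.+-mono-≤-< (ℕₚ.*-monoˡ-≤ n (ℕₚ.≤-pred (subst (e ℕ.<_) (Lp i p) lt))) p
          h (inj₂ m) = ℕₚ.<-≤-trans (row-< e l i (subst (e ℕ.<_) (Lm i m) lt)) (ℕₚ.m≤m+n (l ℕ.* n) r)
        run-p : ∀ k → Plus k → iter γI (suc l) (ρf k) ≡ neg (ρf (star k))
        run-p k p = trans (cong (λ e → iter γI e (ρf k)) (sym (Lp k p))) (star-eq k)
        run-m : ∀ k → Minus k → iter γI l (ρf k) ≡ neg (ρf (star k))
        run-m k m = trans (cong (λ e → iter γI e (ρf k)) (sym (Lm k m))) (star-eq k)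
        -- N₀ = ln + r is the middle of a row, and n = 2r. Adding k < r stays in row l and reaches
        -- column r + k in Π₋; adding k ≥ r wraps around to column k - r of row l + 1, in Π₊.
        hit-m : ∀ (k j : Fin n) → Minus j → toℕ j ≡ r ℕ.+ toℕ k → ρI (l ℕ.* n ℕ.+ r ℕ.+ toℕ k) ≡ neg (ρf (star j))
        hit-m k j m e = trans (cong ρI (trans (ℕₚ.+-assoc (l ℕ.* n) r (toℕ k)) (cong (l ℕ.* n ℕ.+_) (sym e)))) (trans (ρI-iter l (toℕ j)) (run-m j m))
        hit-p : ∀ (k j : Fin n) → Plus j → r ℕ.+ toℕ j ≡ toℕ k → ρI (l ℕ.* n ℕ.+ r ℕ.+ toℕ k) ≡ neg (ρf (star j))
        hit-p k j p e = trans (cong ρI eq) (trans (ρI-iter (suc l) (toℕ j)) (run-p j p))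
          where
          eq : l ℕ.* n ℕ.+ r ℕ.+ toℕ k ≡ suc l ℕ.* n ℕ.+ toℕ j
          eq = trans (ℕₚ.+-assoc (l ℕ.* n) r (toℕ k)) (trans (cong (λ x → l ℕ.* n ℕ.+ (r ℕ.+ x)) (sym e)) (trans (cong (l ℕ.* n ℕ.+_) (sym (ℕₚ.+-assoc r r (toℕ j))))
            (trans (cong (λ x → l ℕ.* n ℕ.+ (x ℕ.+ toℕ j)) (sym n≡)) (trans (sym (ℕₚ.+-assoc (l ℕ.* n) n (toℕ j))) (cong (ℕ._+ toℕ j) (ℕₚ.+-comm (l ℕ.* n) n))))))
        up : ∀ k → Plus k → ∃ λ j → toℕ j ≡ r ℕ.+ toℕ k
        up k p = fromℕ< lt , Finₚ.toℕ-fromℕ< lt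
          where
          lt : r ℕ.+ toℕ k ℕ.< n
          lt = subst (r ℕ.+ toℕ k ℕ.<_) (sym n≡) (ℕₚ.+-monoʳ-< r p)
        down : ∀ k → Minus k → ∃ λ j → Plus j × r ℕ.+ toℕ j ≡ toℕ k
        down k m = fromℕ< lt , subst (ℕ._< r) (sym (Finₚ.toℕ-fromℕ< lt)) small , trans (cong (r ℕ.+_) (Finₚ.toℕ-fromℕ< lt)) (ℕₚ.m+[n∸m]≡n m)
          where
          lt : toℕ k ℕ.∸ r ℕ.< n
          lt = ℕₚ.≤-<-trans (ℕₚ.m∸n≤m (toℕ k) r) (Finₚ.toℕ<n k)
          small : toℕ k ℕ.∸ r ℕ.< r
          small = ℕₚ.+-cancelˡ-< r (toℕ k ℕ.∸ r) r (subst₂ ℕ._<_ (sym (ℕₚ.m+[n∸m]≡n m)) n≡ (Finₚ.toℕ<n k))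
        up-minus : ∀ {j k} → toℕ j ≡ r ℕ.+ toℕ k → Minus j
        up-minus {j} {k} e = subst (r ℕ.≤_) (sym e) (ℕₚ.m≤m+n r (toℕ k))
        turn : ∀ k → ∃ λ i → Same k i × ρI (l ℕ.* n ℕ.+ r ℕ.+ toℕ k) ≡ neg (ρf i)
        turn k = h (colour k)
          where
          h : Plus k ⊎ Minus k → ∃ λ i → Same k i × ρI (l ℕ.* n ℕ.+ r ℕ.+ toℕ k) ≡ neg (ρf i)
          h (inj₁ p) = let j , e = up k p ; m = up-minus {j} {k} e in star j , inj₁ (p , mp j m) , hit-m k j m e
          h (inj₂ m) = let j , p , e = down k m in star j , inj₂ (m , pm j p) , hit-p k j p e
        turn⁻ : ∀ i → ∃ λ k → Same k i × ρI (l ℕ.* n ℕ.+ r ℕ.+ toℕ k) ≡ neg (ρf i)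
        turn⁻ i = h (colour j)
          where
          j = proj₁ (star-surj i)
          e : star j ≡ i
          e = proj₂ (star-surj i)
          h : Plus j ⊎ Minus j → ∃ λ k → Same k i × ρI (l ℕ.* n ℕ.+ r ℕ.+ toℕ k) ≡ neg (ρf i)
          h (inj₁ p) = let k , e′ = up j p in k , inj₂ (up-minus {k} {j} e′ , subst Minus e (pm j p)) , trans (hit-p k j p (sym e′)) (cong (neg ∘ ρf) e)
          h (inj₂ m) = let k , p , e′ = down j m in k , inj₁ (p , subst Plus e (mp j m)) , trans (hit-m k j m (sym e′)) (cong (neg ∘ ρf) e)
        dbl : ∀ j → Minus j → ρI (l ℕ.* n ℕ.+ r ℕ.+ (l ℕ.* n ℕ.+ r) ℕ.+ toℕ j) ≡ ρf (star (star j))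
        dbl j m = trans (cong ρI eq) (trans (ρI-iter (suc l) (l ℕ.* n ℕ.+ toℕ j)) (trans (cong (iter γI (suc l)) (trans (ρI-iter l (toℕ j)) (run-m j m)))
          (trans (iter-neg (suc l) (ρf (star j))) (trans (cong neg (run-p (star j) (mp j m))) (neg-neg (ρf (star (star j))))))))
          where
          eq : l ℕ.* n ℕ.+ r ℕ.+ (l ℕ.* n ℕ.+ r) ℕ.+ toℕ j ≡ suc l ℕ.* n ℕ.+ (l ℕ.* n ℕ.+ toℕ j)
          eq = trans (solve′ (l ℕ.* n) r (toℕ j)) (cong (λ x → x ℕ.+ l ℕ.* n ℕ.+ (l ℕ.* n ℕ.+ toℕ j)) (sym n≡))
            where
            open import Data.Nat.Solver using (module +-*-Solver)
            solve′ : ∀ a b c → a ℕ.+ b ℕ.+ (a ℕ.+ b) ℕ.+ c ≡ b ℕ.+ b ℕ.+ a ℕ.+ (a ℕ.+ c)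
            solve′ = +-*-Solver.solve 3 (λ a b c → a +-*-Solver.:+ b +-*-Solver.:+ (a +-*-Solver.:+ b) +-*-Solver.:+ c +-*-Solver.:= b +-*-Solver.:+ b +-*-Solver.:+ a +-*-Solver.:+ (a +-*-Solver.:+ c)) refl

  abstract
    period : Period
    period = period′

-- Almost positive roots, their keys, and invariance under 𝓡.

module Classes (F : OrderedField) (n : ℕ) (D : BipRootSystem F n) where
  open Periodicity F n D public
  open Period period public
  open WithRS F n D public using (N)

  index : ∀ k → k ≡ k / n ℕ.* n ℕ.+ toℕ (cyc k)
  index k = trans (m≡m%n+[m/n]*n k n) (trans (ℕₚ.+-comm (k % n) (k / n ℕ.* n)) (cong (k / n ℕ.* n ℕ.+_) (sym (toℕ-cyc-% k))))

  ρI-decomp : ∀ k → ρI k ≡ iter γI (k / n) (ρf (cyc k))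
  ρI-decomp k = trans (cong ρI (index k)) (ρI-iter (k / n) (toℕ (cyc k)))
  row<L : ∀ k → k ℕ.< N₀ → k / n ℕ.< L (cyc k)
  row<L k lt = below (k / n) (cyc k) (subst (ℕ._< N₀) (index k) lt)

  Pos-ρ : ∀ k → k ℕ.< N₀ → Pos (ρI k)
  Pos-ρ k lt = subst Pos (sym (ρI-decomp k)) (L-Pos (cyc k) (row<L k lt))

  ρ-injective : ∀ k l → k ℕ.< N₀ → l ℕ.< N₀ → ρI k ≡ ρI l → k ≡ l
  ρ-injective k l p q e = go (ℕₚ.≤-total (k / n) (l / n))
    where
    e′ : iter γI (k / n) (ρf (cyc k)) ≡ iter γI (l / n) (ρf (cyc l))
    e′ = trans (sym (ρI-decomp k)) (trans e (ρI-decomp l))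
    same : cyc k ≡ cyc l → k / n ≡ l / n → k ≡ l
    same a b = trans (index k) (trans (cong₂ (λ x y → y ℕ.* n ℕ.+ toℕ x) a b) (sym (index l)))
    go : (k / n ℕ.≤ l / n) ⊎ (l / n ℕ.≤ k / n) → k ≡ l
    go (inj₁ le) = let a , b = separate (cyc k) (cyc l) le (ℕₚ.<⇒≤ (row<L l q)) e′ in same a b
    go (inj₂ le) = let a , b = separate (cyc l) (cyc k) le (ℕₚ.<⇒≤ (row<L k p)) (sym e′) in same (sym a) (sym b)

  ρ-onto : ∀ α → Pos α → ∃ λ k → k ℕ.< N₀ × α ≡ ρI k
  ρ-onto α p = let i , e , lt , q = cover α p in e ℕ.* n ℕ.+ toℕ i , below⁻ e i lt , trans q (sym (ρI-iter e (toℕ i)))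

  n≤N₀ : n ℕ.≤ N₀
  n≤N₀ = ℕₚ.≮⇒≥ λ lt → ℕₚ.<-irrefl (toℕ-cyc N₀ lt) (below⁻ 0 (cyc N₀) (L>0 (cyc N₀)))

  γ⁻ρ : ∀ k → n ℕ.≤ k → γ⁻ (ρI k) ≡ ρI (k ℕ.∸ n)
  γ⁻ρ k le = trans (cong γ⁻ (trans (cong ρI (sym (ℕₚ.m+[n∸m]≡n le))) (ρI-+n (k ℕ.∸ n)))) (γ⁻γ (ρI (k ℕ.∸ n)))

  private
    root : Fin (N₀ ℕ.+ N₀) → Fin M
    root x = [ (λ k → ρI (toℕ k)) , (λ k → neg (ρI (toℕ k))) ]′ (Fin.splitAt N₀ x)
    code′ : ∀ j → ∃ λ x → root x ≡ j
    code′ j = go (Pos⊎Neg j)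
      where
      at : ∀ y → root (Fin.join N₀ N₀ y) ≡ [ (λ k → ρI (toℕ k)) , (λ k → neg (ρI (toℕ k))) ]′ y
      at y = cong [ (λ k → ρI (toℕ k)) , (λ k → neg (ρI (toℕ k))) ]′ (Finₚ.splitAt-join N₀ N₀ y)
      go : Pos j ⊎ Neg j → ∃ λ x → root x ≡ j
      go (inj₁ p) = let k , lt , e = ρ-onto j p in Fin.join N₀ N₀ (inj₁ (fromℕ< lt)) , trans (at (inj₁ (fromℕ< lt))) (trans (cong ρI (Finₚ.toℕ-fromℕ< lt)) (sym e))
      go (inj₂ q) = let k , lt , e = ρ-onto (neg j) (Neg⇒Pos-neg q) in Fin.join N₀ N₀ (inj₂ (fromℕ< lt)) , trans (at (inj₂ (fromℕ< lt)))
        (trans (cong (λ x → neg (ρI x)) (Finₚ.toℕ-fromℕ< lt)) (trans (cong neg (sym e)) (neg-neg j)))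
    root-inj : ∀ {x y} → root x ≡ root y → x ≡ y
    root-inj {x} {y} e = trans (sym (Finₚ.join-splitAt N₀ N₀ x)) (trans (cong (Fin.join N₀ N₀) (go (Fin.splitAt N₀ x) (Fin.splitAt N₀ y) e)) (Finₚ.join-splitAt N₀ N₀ y))
      where
      f = [ (λ k → ρI (toℕ k)) , (λ k → neg (ρI (toℕ k))) ]′
      inj : ∀ (k l : Fin N₀) → ρI (toℕ k) ≡ ρI (toℕ l) → k ≡ l
      inj k l e = Finₚ.toℕ-injective (ρ-injective (toℕ k) (toℕ l) (Finₚ.toℕ<n k) (Finₚ.toℕ<n l) e)
      go : ∀ (u v : Fin N₀ ⊎ Fin N₀) → f u ≡ f v → u ≡ v
      go (inj₁ k) (inj₁ l) e = cong inj₁ (inj k l e)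
      go (inj₂ k) (inj₂ l) e = cong inj₂ (inj k l (neg-inj e))
      go (inj₁ k) (inj₂ l) e = ⊥-elim (Pos-Neg (subst Pos e (Pos-ρ (toℕ k) (Finₚ.toℕ<n k))) (Pos⇒Neg-neg (Pos-ρ (toℕ l) (Finₚ.toℕ<n l))))
      go (inj₂ k) (inj₁ l) e = ⊥-elim (Pos-Neg (subst Pos (sym e) (Pos-ρ (toℕ l) (Finₚ.toℕ<n l))) (Pos⇒Neg-neg (Pos-ρ (toℕ k) (Finₚ.toℕ<n k))))

  -- `root` lists the positive roots by position, then their negatives. Being injective and onto, it
  -- counts Φ and identifies N = M / 2 with N₀.
  M≡N₀+N₀ : M ≡ N₀ ℕ.+ N₀
  M≡N₀+N₀ = ℕₚ.≤-antisym (Finₚ.injective⇒≤ {f = λ j → proj₁ (code′ j)} (λ {j} {k} e → trans (sym (proj₂ (code′ j))) (trans (cong root e) (proj₂ (code′ k)))))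
    (Finₚ.injective⇒≤ {f = root} root-inj)

  N≡N₀ : N ≡ N₀
  N≡N₀ = trans (cong (_/ 2) (trans M≡N₀+N₀ (trans (cong (N₀ ℕ.+_) (sym (ℕₚ.+-identityʳ N₀))) (ℕₚ.*-comm 2 N₀)))) (m*n/n≡m N₀ 2)

  -- Almost positive roots with a key refining the order ≺ up to the commuting blocks −Π₋ and −Π₊.
  data Cls (j : Fin M) : ℕ → Set where
    n⁻ : ∀ i → Minus i → j ≡ neg (simp i) → Cls j 0
    ps : ∀ k → k ℕ.< N₀ → j ≡ ρI k → Cls j (suc k)
    n⁺ : ∀ i → Plus i → j ≡ neg (simp i) → Cls j (suc N₀)

  Neg-neg-simp : ∀ {j} i → j ≡ neg (simp i) → Neg j
  Neg-neg-simp i e = subst Neg (sym e) (Pos⇒Neg-neg (Pos-simp i))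
  Pos-ρ′ : ∀ {j} k → k ℕ.< N₀ → j ≡ ρI k → Pos j
  Pos-ρ′ k lt e = subst Pos (sym e) (Pos-ρ k lt)

  neg-simp-uniq : ∀ {j i i′} → j ≡ neg (simp i) → j ≡ neg (simp i′) → i ≡ i′
  neg-simp-uniq e f = simp-inj (neg-inj (trans (sym e) f))
  Plus-Minus : ∀ {i i′} → i ≡ i′ → Plus i → Minus i′ → ⊥
  Plus-Minus {i} {i′} e p m = ℕₚ.<-irrefl (cong toℕ e) (ℕₚ.<-≤-trans p m)

  Cls-key : ∀ {j κ κ′} → Cls j κ → Cls j κ′ → κ ≡ κ′
  Cls-key (n⁻ i m e) (n⁻ i′ m′ e′) = refl
  Cls-key (n⁺ i m e) (n⁺ i′ m′ e′) = refl
  Cls-key (ps k lt e) (ps k′ lt′ e′) = cong suc (ρ-injective k k′ lt lt′ (trans (sym e) e′))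
  Cls-key (n⁻ i m e) (n⁺ i′ p e′) = ⊥-elim (Plus-Minus (neg-simp-uniq e′ e) p m)
  Cls-key (n⁺ i p e) (n⁻ i′ m e′) = ⊥-elim (Plus-Minus (neg-simp-uniq e e′) p m)
  Cls-key (n⁻ i m e) (ps k lt e′) = ⊥-elim (Pos-Neg (Pos-ρ′ k lt e′) (Neg-neg-simp i e))
  Cls-key (n⁺ i m e) (ps k lt e′) = ⊥-elim (Pos-Neg (Pos-ρ′ k lt e′) (Neg-neg-simp i e))
  Cls-key (ps k lt e′) (n⁻ i m e) = ⊥-elim (Pos-Neg (Pos-ρ′ k lt e′) (Neg-neg-simp i e))
  Cls-key (ps k lt e′) (n⁺ i m e) = ⊥-elim (Pos-Neg (Pos-ρ′ k lt e′) (Neg-neg-simp i e))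

  Cls-≢ : ∀ {x y κ λ′} → Cls x κ → Cls y λ′ → ¬ κ ≡ λ′ → ¬ x ≡ y
  Cls-≢ cx cy ne e = ne (Cls-key (subst (λ z → Cls z _) e cx) cy)

  FlipI : Fin M → Set
  FlipI j = (∃ λ i → Plus i × j ≡ simp i) ⊎ (∃ λ i → Minus i × j ≡ neg (simp i))
  FlipI? : ∀ j → Dec (FlipI j)
  FlipI? j = Finₚ.any? (λ i → Plus? i ×-dec (j Finₚ.≟ simp i)) ⊎-dec Finₚ.any? (λ i → (r ℕₚ.≤? toℕ i) ×-dec (j Finₚ.≟ neg (simp i)))
  abstract
    next : Fin M → Fin M
    next j with FlipI? j
    ... | yes _ = neg j
    ... | no _ = γ⁻ j
    next-flip : ∀ j → FlipI j → next j ≡ neg j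
    next-flip j f with FlipI? j
    ... | yes _ = refl
    ... | no nf = ⊥-elim (nf f)
    next-shift : ∀ j → ¬ FlipI j → next j ≡ γ⁻ j
    next-shift j nf with FlipI? j
    ... | yes f = ⊥-elim (nf f)
    ... | no _ = refl

  -- 𝓡 on classes, recording the keys before and after.
  data Tr (x : Fin M) : ℕ → ℕ → Set where
    -- The bounds on k locate the images: 𝓡(-Π₋) occupies the last n - r positive positions, and
    -- 𝓡(-Π₊) (constructor `E′`) the r positions just before them.
    A : ∀ i k → Minus i → x ≡ neg (simp i) → k ℕ.< N₀ → N₀ ℕ.+ r ℕ.≤ k ℕ.+ n → next x ≡ ρI k → next x ≡ neg x → Tr x 0 (suc k)
    B : ∀ i → Plus i → x ≡ simp i → next x ≡ neg x → Tr x (suc (toℕ i)) (suc N₀)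
    C : ∀ i → Minus i → x ≡ ρf i → next x ≡ neg (simp i) → next x ≡ γ⁻ x → Tr x (suc (toℕ i)) 0
    D′ : ∀ k → n ℕ.≤ k → k ℕ.< N₀ → x ≡ ρI k → next x ≡ γ⁻ x → Tr x (suc k) (suc (k ℕ.∸ n))
    E′ : ∀ i k → Plus i → x ≡ neg (simp i) → k ℕ.< N₀ → N₀ ℕ.≤ k ℕ.+ n → k ℕ.+ n ℕ.< N₀ ℕ.+ r → next x ≡ ρI k → next x ≡ γ⁻ x → Tr x (suc N₀) (suc k)

  Tr⇒Cls : ∀ {x κ κ′} → Tr x κ κ′ → Cls (next x) κ′
  Tr⇒Cls (A i k m e lt _ q _) = ps k lt q
  Tr⇒Cls (B i p e q) = n⁺ i p (trans q (cong neg e))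
  Tr⇒Cls (C i m e q _) = n⁻ i m q
  Tr⇒Cls (D′ k le lt e q) = ps (k ℕ.∸ n) (ℕₚ.≤-<-trans (ℕₚ.m∸n≤m k n) lt) (trans q (trans (cong γ⁻ e) (γ⁻ρ k le)))
  Tr⇒Cls (E′ i k p e lt _ _ q _) = ps k lt q

  private
    back : ∀ k → k ℕ.< n → (N₀ ℕ.+ k ℕ.∸ n) ℕ.+ n ≡ N₀ ℕ.+ k
    back k lt = ℕₚ.m∸n+n≡m (ℕₚ.≤-trans n≤N₀ (ℕₚ.m≤m+n N₀ k))
    back-< : ∀ k → k ℕ.< n → N₀ ℕ.+ k ℕ.∸ n ℕ.< N₀
    back-< k lt = ℕₚ.+-cancelʳ-< n (N₀ ℕ.+ k ℕ.∸ n) N₀ (subst (ℕ._< N₀ ℕ.+ n) (sym (back k lt)) (ℕₚ.+-monoʳ-< N₀ lt))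
    back-γ : ∀ k → k ℕ.< n → ρI (N₀ ℕ.+ k ℕ.∸ n) ≡ γ⁻ (ρI (N₀ ℕ.+ k))
    back-γ k lt = sym (γ⁻ρ (N₀ ℕ.+ k) (ℕₚ.≤-trans n≤N₀ (ℕₚ.m≤m+n N₀ k)))
    plus-of : ∀ {k i} → Same k i → Plus i → Plus k
    plus-of (inj₁ (p , _)) _ = p
    plus-of {k} {i} (inj₂ (_ , m)) p = ⊥-elim (Plus-Minus {i} {i} refl p m)
    minus-of : ∀ {k i} → Same k i → Minus i → Minus k
    minus-of (inj₂ (m , _)) _ = m
    minus-of {k} {i} (inj₁ (_ , p)) m = ⊥-elim (Plus-Minus {i} {i} refl p m)

  Cls⇒Tr : ∀ {x κ} → Cls x κ → ∃ λ κ′ → Tr x κ κ′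
  Cls⇒Tr {x} (n⁻ i m e) = _ , A i (N₀ ℕ.+ toℕ k ℕ.∸ n) m e (back-< (toℕ k) (Finₚ.toℕ<n k)) (ℕₚ.≤-trans (ℕₚ.+-monoʳ-≤ N₀ (minus-of (proj₁ (proj₂ t)) m)) (ℕₚ.≤-reflexive (sym (back (toℕ k) (Finₚ.toℕ<n k)))))
      (trans nx (trans (cong neg e) (trans (neg-neg (simp i)) (sym (trans (back-γ (toℕ k) (Finₚ.toℕ<n k)) (trans (cong γ⁻ (proj₂ (proj₂ t)))
        (trans (γ⁻-neg (ρf i)) (trans (cong neg (γ⁻ρf-minus i m)) (neg-neg (simp i)))))))))) nx
    where
    t = turn⁻ i
    k = proj₁ t
    nx : next x ≡ neg x
    nx = next-flip x (inj₂ (i , m , e))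
  Cls⇒Tr {x} (n⁺ i p e) = _ , E′ i (N₀ ℕ.+ toℕ k ℕ.∸ n) p e (back-< (toℕ k) (Finₚ.toℕ<n k)) (ℕₚ.≤-trans (ℕₚ.m≤m+n N₀ (toℕ k)) (ℕₚ.≤-reflexive (sym (back (toℕ k) (Finₚ.toℕ<n k)))))
      (ℕₚ.≤-<-trans (ℕₚ.≤-reflexive (back (toℕ k) (Finₚ.toℕ<n k))) (ℕₚ.+-monoʳ-< N₀ (plus-of (proj₁ (proj₂ t)) p)))
      (trans nx (sym (trans (back-γ (toℕ k) (Finₚ.toℕ<n k)) (cong γ⁻ (trans (proj₂ (proj₂ t)) (trans (cong neg (ρf-plus i p)) (sym e))))))) nx
    where
    t = turn⁻ i
    k = proj₁ t
    nf : ¬ FlipI x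
    nf (inj₁ (i′ , _ , e′)) = Pos-Neg (subst Pos (sym e′) (Pos-simp i′)) (Neg-neg-simp i e)
    nf (inj₂ (i′ , m , e′)) = Plus-Minus (neg-simp-uniq e e′) p m
    nx : next x ≡ γ⁻ x
    nx = next-shift x nf
  Cls⇒Tr {x} (ps k lt e) = go (ℕₚ.<-≤-connex k n)
    where
    nf : ¬ k ℕ.< r → ¬ FlipI x
    nf k≮r (inj₁ (i , p , e′)) = k≮r (subst (ℕ._< r) (ρ-injective (toℕ i) k (ℕₚ.<-≤-trans (Finₚ.toℕ<n i) n≤N₀) lt (trans (ρf-plus i p) (trans (sym e′) e))) p)
    nf k≮r (inj₂ (i , m , e′)) = Pos-Neg (Pos-ρ′ k lt e) (Neg-neg-simp i e′)
    go : (k ℕ.< n) ⊎ (n ℕ.≤ k) → ∃ λ κ′ → Tr x (suc k) κ′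
    go (inj₁ k<n) = go′ (ℕₚ.<-≤-connex (toℕ i) r)
      where
      i = cyc k
      i≡ : toℕ i ≡ k
      i≡ = toℕ-cyc k k<n
      e′ : x ≡ ρf i
      e′ = trans e (cong ρI (sym i≡))
      go′ : Plus i ⊎ Minus i → ∃ λ κ′ → Tr x (suc k) κ′
      go′ (inj₁ p) = _ , subst (λ k → Tr x (suc k) (suc N₀)) i≡ (B i p (trans e′ (ρf-plus i p)) (next-flip x (inj₁ (i , p , trans e′ (ρf-plus i p)))))
      go′ (inj₂ m) = _ , subst (λ k → Tr x (suc k) 0) i≡ (C i m e′ (trans nx (trans (cong γ⁻ e′) (γ⁻ρf-minus i m))) nx)
        where
        nx : next x ≡ γ⁻ x
        nx = next-shift x (nf (λ k<r → Plus-Minus {i} {i} refl (subst (ℕ._< r) (sym i≡) k<r) m))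
    go (inj₂ n≤k) = _ , D′ k n≤k lt e (next-shift x (nf (λ k<r → ℕₚ.<-irrefl refl (ℕₚ.<-≤-trans k<r (ℕₚ.≤-trans r≤n n≤k)))))

  -- Both -1 and γ⁻¹ are injective; a flipped and a shifted root have images with different keys.
  next-inj : ∀ {x y κ λ′} → Cls x κ → Cls y λ′ → next x ≡ next y → x ≡ y
  next-inj {x} {y} cx cy e = go (proj₂ (Cls⇒Tr cx)) (proj₂ (Cls⇒Tr cy))
    where
    both-shift : ∀ {x y} → next x ≡ γ⁻ x → next y ≡ γ⁻ y → next x ≡ next y → x ≡ y
    both-shift a b e = γ⁻-inj (trans (sym a) (trans e b))
    both-flip : ∀ {x y} → next x ≡ neg x → next y ≡ neg y → next x ≡ next y → x ≡ y
    both-flip a b e = neg-inj (trans (sym a) (trans e b))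
    clash : ∀ {κ κ′ lx ly} → Tr x κ lx → Tr y κ′ ly → ¬ lx ≡ ly → x ≡ y
    clash tx ty ne = ⊥-elim (ne (Cls-key (Tr⇒Cls tx) (subst (λ z → Cls z _) (sym e) (Tr⇒Cls ty))))
    far : ∀ {k l} → k ℕ.+ n ℕ.< N₀ ℕ.+ r → N₀ ℕ.+ r ℕ.≤ l ℕ.+ n → ¬ suc k ≡ suc l
    far a b q = ℕₚ.<-irrefl (cong (ℕ._+ n) (ℕₚ.suc-injective q)) (ℕₚ.<-≤-trans a b)
    far′ : ∀ {k l} → n ℕ.≤ k → k ℕ.< N₀ → N₀ ℕ.+ r ℕ.≤ l ℕ.+ n → ¬ suc (k ℕ.∸ n) ≡ suc l
    far′ le lt b = far (ℕₚ.≤-<-trans (ℕₚ.≤-reflexive (ℕₚ.m∸n+n≡m le)) (ℕₚ.<-≤-trans lt (ℕₚ.m≤m+n N₀ r))) b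
    top : ∀ {k} → k ℕ.< N₀ → ¬ suc k ≡ suc N₀
    top lt q = ℕₚ.<-irrefl (ℕₚ.suc-injective q) lt
    go : ∀ {κ κ′ lx ly} → Tr x κ lx → Tr y κ′ ly → x ≡ y
    go (A _ _ _ _ _ _ _ a) (A _ _ _ _ _ _ _ b) = both-flip a b e
    go (A _ _ _ _ _ _ _ a) (B _ _ _ b) = both-flip a b e
    go (B _ _ _ a) (A _ _ _ _ _ _ _ b) = both-flip a b e
    go (B _ _ _ a) (B _ _ _ b) = both-flip a b e
    go (C _ _ _ _ a) (C _ _ _ _ b) = both-shift a b e
    go (C _ _ _ _ a) (D′ _ _ _ _ b) = both-shift a b e
    go (C _ _ _ _ a) (E′ _ _ _ _ _ _ _ _ b) = both-shift a b e
    go (D′ _ _ _ _ a) (C _ _ _ _ b) = both-shift a b e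
    go (D′ _ _ _ _ a) (D′ _ _ _ _ b) = both-shift a b e
    go (D′ _ _ _ _ a) (E′ _ _ _ _ _ _ _ _ b) = both-shift a b e
    go (E′ _ _ _ _ _ _ _ _ a) (C _ _ _ _ b) = both-shift a b e
    go (E′ _ _ _ _ _ _ _ _ a) (D′ _ _ _ _ b) = both-shift a b e
    go (E′ _ _ _ _ _ _ _ _ a) (E′ _ _ _ _ _ _ _ _ b) = both-shift a b e
    go tx@(A _ _ _ _ _ _ _ _) ty@(C _ _ _ _ _) = clash tx ty λ ()
    go tx@(C _ _ _ _ _) ty@(A _ _ _ _ _ _ _ _) = clash tx ty λ ()
    go tx@(B _ _ _ _) ty@(C _ _ _ _ _) = clash tx ty λ ()
    go tx@(C _ _ _ _ _) ty@(B _ _ _ _) = clash tx ty λ ()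
    go tx@(A _ k _ _ _ h _ _) ty@(D′ l le lt _ _) = clash tx ty (λ q → far′ le lt h (sym q))
    go tx@(D′ l le lt _ _) ty@(A _ k _ _ _ h _ _) = clash tx ty (far′ le lt h)
    go tx@(A _ k _ _ _ h _ _) ty@(E′ _ l _ _ _ _ h′ _ _) = clash tx ty (λ q → far h′ h (sym q))
    go tx@(E′ _ l _ _ _ _ h′ _ _) ty@(A _ k _ _ _ h _ _) = clash tx ty (far h′ h)
    go tx@(B _ _ _ _) ty@(D′ l le lt _ _) = clash tx ty (λ q → top (ℕₚ.≤-<-trans (ℕₚ.m∸n≤m l n) lt) (sym q))
    go tx@(D′ l le lt _ _) ty@(B _ _ _ _) = clash tx ty (top (ℕₚ.≤-<-trans (ℕₚ.m∸n≤m l n) lt))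
    go tx@(B _ _ _ _) ty@(E′ _ l _ _ lt _ _ _ _) = clash tx ty (λ q → top lt (sym q))
    go tx@(E′ _ l _ _ lt _ _ _ _) ty@(B _ _ _ _) = clash tx ty (top lt)

  -- Noncrossing in the order given by the keys κ, λ of x, y (in both orders if the keys agree).
  NCk : ℕ → ℕ → Fin M → Fin M → Set
  NCk κ λ′ x y = (κ ℕ.≤ λ′ → Z y x) × (λ′ ℕ.≤ κ → Z x y)

  NCk-sym : ∀ {κ λ′ x y} → NCk κ λ′ x y → NCk λ′ κ y x
  NCk-sym (a , b) = b , a

  _⟺_ : Set → Set → Set
  P ⟺ Q = (P → Q) × (Q → P)

  private
    lt-lt : ∀ {κ λ′ κ₁ λ₁ x y x₁ y₁} → κ ℕ.< λ′ → κ₁ ℕ.< λ₁ → Z y x ⟺ Z y₁ x₁ → NCk κ λ′ x y ⟺ NCk κ₁ λ₁ x₁ y₁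
    lt-lt a b (f , g) = (λ (p , _) → (λ _ → f (p (ℕₚ.<⇒≤ a))) , (λ le → ⊥-elim (ℕₚ.<-irrefl refl (ℕₚ.<-≤-trans b le)))) ,
                        (λ (p , _) → (λ _ → g (p (ℕₚ.<⇒≤ b))) , (λ le → ⊥-elim (ℕₚ.<-irrefl refl (ℕₚ.<-≤-trans a le))))
    lt-gt : ∀ {κ λ′ κ₁ λ₁ x y x₁ y₁} → κ ℕ.< λ′ → λ₁ ℕ.< κ₁ → Z y x ⟺ Z x₁ y₁ → NCk κ λ′ x y ⟺ NCk κ₁ λ₁ x₁ y₁
    lt-gt a b (f , g) = (λ (p , _) → (λ le → ⊥-elim (ℕₚ.<-irrefl refl (ℕₚ.<-≤-trans b le))) , (λ _ → f (p (ℕₚ.<⇒≤ a)))) ,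
                        (λ (_ , p) → (λ _ → g (p (ℕₚ.<⇒≤ b))) , (λ le → ⊥-elim (ℕₚ.<-irrefl refl (ℕₚ.<-≤-trans a le))))
    both : ∀ {κ λ′ κ₁ λ₁ x y x₁ y₁} → Z x y → Z y x → Z x₁ y₁ → Z y₁ x₁ → NCk κ λ′ x y ⟺ NCk κ₁ λ₁ x₁ y₁
    both a b c d = (λ _ → (λ _ → d) , (λ _ → c)) , (λ _ → (λ _ → b) , (λ _ → a))
    flip-flip : ∀ {x y x₁ y₁} → x₁ ≡ neg x → y₁ ≡ neg y → Z y x ⟺ Z y₁ x₁
    flip-flip a b = (λ z → subst₂ Z (sym b) (sym a) (Z-negˡ (Z-negʳ z))) , (λ z → Z-negˡ⁻ (Z-negʳ⁻ (subst₂ Z b a z)))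
    flip-shift : ∀ {x y x₁ y₁} → x₁ ≡ neg x → y₁ ≡ γ⁻ y → Z y x ⟺ Z x₁ y₁
    flip-shift a b = (λ z → subst₂ Z (sym a) (sym b) (Z-negˡ (Z-serre z))) , (λ z → Z-serre⁻ (Z-negˡ⁻ (subst₂ Z a b z)))
    shift-shift : ∀ {x y x₁ y₁} → x₁ ≡ γ⁻ x → y₁ ≡ γ⁻ y → Z y x ⟺ Z y₁ x₁
    shift-shift a b = (λ z → subst₂ Z (sym b) (sym a) (Z-γ⁻ z)) , (λ z → Z-γ⁻⁻ (subst₂ Z b a z))
    Z-nn : ∀ {x y i i′} → x ≡ neg (simp i) → y ≡ neg (simp i′) → Same i i′ → ¬ x ≡ y → Z x y
    Z-nn {i = i} {i′} a b sm ne = subst₂ Z (sym a) (sym b) (Z-negˡ (Z-negʳ (Z-simp-same sm (λ e → ne (trans a (trans (cong (neg ∘ simp) e) (sym b)))))))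
    flip⇒ : ∀ {x y x₁ y₁} → x₁ ≡ neg x → y₁ ≡ neg y → Z x y → Z x₁ y₁
    flip⇒ a b z = subst₂ Z (sym a) (sym b) (Z-negˡ (Z-negʳ z))
    shift⇒ : ∀ {x y x₁ y₁} → x₁ ≡ γ⁻ x → y₁ ≡ γ⁻ y → Z x y → Z x₁ y₁
    shift⇒ a b z = subst₂ Z (sym a) (sym b) (Z-γ⁻ z)
    swap⟺ : ∀ {κ λ′ κ₁ λ₁ x y x₁ y₁} → NCk κ λ′ x y ⟺ NCk κ₁ λ₁ x₁ y₁ → NCk λ′ κ y x ⟺ NCk λ₁ κ₁ y₁ x₁
    swap⟺ (f , g) = (λ p → NCk-sym (f (NCk-sym p))) , (λ p → NCk-sym (g (NCk-sym p)))
    ∸n< : ∀ {k l} → n ℕ.≤ k → k ℕ.< l ℕ.+ n → k ℕ.∸ n ℕ.< l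
    ∸n< {k} {l} le lt = ℕₚ.+-cancelʳ-< n (k ℕ.∸ n) l (ℕₚ.≤-<-trans (ℕₚ.≤-reflexive (ℕₚ.m∸n+n≡m le)) lt)

  -- Roots with different keys keep their order if 𝓡 acts on both by -1 or on both by γ⁻¹, and these
  -- maps preserve χ = 0. If one root is negated and the other shifted, the order is reversed, which
  -- matches χ(y, x) = -χ(x, γ⁻¹y). Two roots in a common block satisfy both conditions before and
  -- after.
  NCk-next : ∀ {x y κ κ₁ λ′ λ₁} → ¬ x ≡ y → Tr x κ κ₁ → Tr y λ′ λ₁ → NCk κ λ′ x y ⟺ NCk κ₁ λ₁ (next x) (next y)
  NCk-next ne (A i k m e lt h q a) (A i′ k′ m′ e′ lt′ h′ q′ a′) = both z (Z-nn e′ e (inj₂ (m′ , m)) (λ p → ne (sym p))) (flip⇒ a a′ z) (flip⇒ a′ a (Z-nn e′ e (inj₂ (m′ , m)) (λ p → ne (sym p))))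
    where z = Z-nn e e′ (inj₂ (m , m′)) ne
  NCk-next ne (A i k m e lt h q a) (B i′ p e′ a′) = lt-lt (ℕ.s≤s ℕ.z≤n) (ℕ.s≤s lt) (flip-flip a a′)
  NCk-next ne (A i k m e lt h q a) (C i′ m′ e′ q′ a′) = lt-gt (ℕ.s≤s ℕ.z≤n) (ℕ.s≤s ℕ.z≤n) (flip-shift a a′)
  NCk-next ne (A i k m e lt h q a) (D′ l le lt′ e′ a′) = lt-gt (ℕ.s≤s ℕ.z≤n) (ℕ.s≤s (∸n< le (ℕₚ.<-≤-trans lt′ (ℕₚ.≤-trans (ℕₚ.m≤m+n N₀ r) h)))) (flip-shift a a′)
  NCk-next ne (A i k m e lt h q a) (E′ i′ l p e′ lt′ h₁ h₂ q′ a′) = lt-gt (ℕ.s≤s ℕ.z≤n) (ℕ.s≤s (ℕₚ.+-cancelʳ-< n l k (ℕₚ.<-≤-trans h₂ h))) (flip-shift a a′)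
  NCk-next ne (B i p e a) (B i′ p′ e′ a′) = both z z′ (flip⇒ a a′ z) (flip⇒ a′ a z′)
    where
    i≢ : ¬ i ≡ i′
    i≢ q = ne (trans e (trans (cong simp q) (sym e′)))
    z = subst₂ Z (sym e) (sym e′) (Z-simp-same (inj₁ (p , p′)) i≢)
    z′ = subst₂ Z (sym e′) (sym e) (Z-simp-same (inj₁ (p′ , p)) (λ q → i≢ (sym q)))
  NCk-next ne (B i p e a) (C i′ m e′ q a′) = lt-gt (ℕ.s≤s (ℕₚ.<-≤-trans p m)) (ℕ.s≤s ℕ.z≤n) (flip-shift a a′)
  NCk-next ne (B i p e a) (D′ l le lt e′ a′) = lt-gt (ℕ.s≤s (ℕₚ.<-≤-trans (Finₚ.toℕ<n i) le)) (ℕ.s≤s (ℕₚ.≤-<-trans (ℕₚ.m∸n≤m l n) lt)) (flip-shift a a′)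
  NCk-next ne (B i p e a) (E′ i′ l p′ e′ lt h₁ h₂ q a′) = lt-gt (ℕ.s≤s (ℕₚ.<-≤-trans (Finₚ.toℕ<n i) n≤N₀)) (ℕ.s≤s lt) (flip-shift a a′)
  NCk-next ne (C i m e q a) (C i′ m′ e′ q′ a′) = both z z′ (shift⇒ a a′ z) (shift⇒ a′ a z′)
    where
    i≢ : ¬ i ≡ i′
    i≢ q = ne (trans e (trans (cong ρf q) (sym e′)))
    z = subst₂ Z (sym e) (sym e′) (Z-ρf-same (inj₂ (m , m′)) i≢)
    z′ = subst₂ Z (sym e′) (sym e) (Z-ρf-same (inj₂ (m′ , m)) (λ q → i≢ (sym q)))
  NCk-next ne (C i m e q a) (D′ l le lt e′ a′) = lt-lt (ℕ.s≤s (ℕₚ.<-≤-trans (Finₚ.toℕ<n i) le)) (ℕ.s≤s ℕ.z≤n) (shift-shift a a′)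
  NCk-next ne (C i m e q a) (E′ i′ l p e′ lt h₁ h₂ q′ a′) = lt-lt (ℕ.s≤s (ℕₚ.<-≤-trans (Finₚ.toℕ<n i) n≤N₀)) (ℕ.s≤s ℕ.z≤n) (shift-shift a a′)
  NCk-next {x} {y} ne (D′ k le lt e a) (D′ l le′ lt′ e′ a′) = go (ℕₚ.<-cmp k l)
    where
    go : Tri (k ℕ.< l) (k ≡ l) (l ℕ.< k) → NCk (suc k) (suc l) x y ⟺ NCk (suc (k ℕ.∸ n)) (suc (l ℕ.∸ n)) (next x) (next y)
    go (tri< h _ _) = lt-lt (ℕ.s≤s h) (ℕ.s≤s (ℕₚ.∸-monoˡ-< h le)) (shift-shift a a′)
    go (tri≈ _ h _) = ⊥-elim (ne (trans e (trans (cong ρI h) (sym e′))))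
    go (tri> _ _ h) = swap⟺ (lt-lt (ℕ.s≤s h) (ℕ.s≤s (ℕₚ.∸-monoˡ-< h le′)) (shift-shift a′ a))
  NCk-next ne (D′ k le lt e a) (E′ i l p e′ lt′ h₁ h₂ q a′) = lt-lt (ℕ.s≤s lt) (ℕ.s≤s (∸n< le (ℕₚ.<-≤-trans lt h₁))) (shift-shift a a′)
  NCk-next ne (E′ i k p e lt h₁ h₂ q a) (E′ i′ k′ p′ e′ lt′ h₁′ h₂′ q′ a′) = both z z′ (shift⇒ a a′ z) (shift⇒ a′ a z′)
    where
    z = Z-nn e e′ (inj₁ (p , p′)) ne
    z′ = Z-nn e′ e (inj₁ (p′ , p)) (λ q → ne (sym q))
  NCk-next ne (B i′ p e′ a′) (A i k m e lt h q a) = swap⟺ (lt-lt (ℕ.s≤s ℕ.z≤n) (ℕ.s≤s lt) (flip-flip a a′))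
  NCk-next ne (C i′ m′ e′ q′ a′) (A i k m e lt h q a) = swap⟺ (lt-gt (ℕ.s≤s ℕ.z≤n) (ℕ.s≤s ℕ.z≤n) (flip-shift a a′))
  NCk-next ne (D′ l le lt′ e′ a′) (A i k m e lt h q a) = swap⟺ (lt-gt (ℕ.s≤s ℕ.z≤n) (ℕ.s≤s (∸n< le (ℕₚ.<-≤-trans lt′ (ℕₚ.≤-trans (ℕₚ.m≤m+n N₀ r) h)))) (flip-shift a a′))
  NCk-next ne (E′ i′ l p e′ lt′ h₁ h₂ q′ a′) (A i k m e lt h q a) = swap⟺ (lt-gt (ℕ.s≤s ℕ.z≤n) (ℕ.s≤s (ℕₚ.+-cancelʳ-< n l k (ℕₚ.<-≤-trans h₂ h))) (flip-shift a a′))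
  NCk-next ne (C i′ m e′ q a′) (B i p e a) = swap⟺ (lt-gt (ℕ.s≤s (ℕₚ.<-≤-trans p m)) (ℕ.s≤s ℕ.z≤n) (flip-shift a a′))
  NCk-next ne (D′ l le lt e′ a′) (B i p e a) = swap⟺ (lt-gt (ℕ.s≤s (ℕₚ.<-≤-trans (Finₚ.toℕ<n i) le)) (ℕ.s≤s (ℕₚ.≤-<-trans (ℕₚ.m∸n≤m l n) lt)) (flip-shift a a′))
  NCk-next ne (E′ i′ l p′ e′ lt h₁ h₂ q a′) (B i p e a) = swap⟺ (lt-gt (ℕ.s≤s (ℕₚ.<-≤-trans (Finₚ.toℕ<n i) n≤N₀)) (ℕ.s≤s lt) (flip-shift a a′))
  NCk-next ne (D′ l le lt e′ a′) (C i m e q a) = swap⟺ (lt-lt (ℕ.s≤s (ℕₚ.<-≤-trans (Finₚ.toℕ<n i) le)) (ℕ.s≤s ℕ.z≤n) (shift-shift a a′))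
  NCk-next ne (E′ i′ l p e′ lt h₁ h₂ q′ a′) (C i m e q a) = swap⟺ (lt-lt (ℕ.s≤s (ℕₚ.<-≤-trans (Finₚ.toℕ<n i) n≤N₀)) (ℕ.s≤s ℕ.z≤n) (shift-shift a a′))
  NCk-next ne (E′ i l p e′ lt′ h₁ h₂ q a′) (D′ k le lt e a) = swap⟺ (lt-lt (ℕ.s≤s lt) (ℕ.s≤s (∸n< le (ℕₚ.<-≤-trans lt h₁))) (shift-shift a a′))

-- The order ≺, degree and compatibility in terms of keys and χ.

module Compatibility (F : OrderedField) (n : ℕ) (D : BipRootSystem F n) where
  open Classes F n D public
  open WithRS F n D public using (σc; γV; ρ₁; Lρ; _≺_; Flip; 𝓡Rel; 𝓡Iter; Compat; Deg)

  ρ₁-ρI : ∀ k → ρ₁ (suc k) ≈V Φ (ρI k)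
  ρ₁-ρI k = St.~Vtrans (λ l → R₀.reflexive (cong₂ (λ L v → actV L v l) words (σc≡ k))) (St.~Vsym (Φ-act (map simp (pre k)) (simp (cyc k))))
    where
    σc≡ : ∀ k → σc k ≡ Φ (simp (cyc k))
    σc≡ k = cong (Φ ∘ simp) (sym (cyc-def k))
    words : applyUpTo σc k ≡ map Φ (map simp (pre k))
    words = trans (applyUpTo-cong σc≡ k) (sym (trans (cong (map Φ) (Listₚ.map-applyUpTo cyc simp k)) (Listₚ.map-applyUpTo (simp ∘ cyc) Φ k)))

  private
    <ᵇ-true : ∀ {p q} → p ℕ.< q → (p ℕ.<ᵇ q) ≡ true
    <ᵇ-true lt = Equivalence.to T-≡ (ℕₚ.<⇒<ᵇ lt)
    <ᵇ-false : ∀ {p q} → q ℕ.≤ p → (p ℕ.<ᵇ q) ≡ false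
    <ᵇ-false {p} {q} le = ¬-not (λ e → ℕₚ.<⇒≱ (ℕₚ.<ᵇ⇒< p q (Equivalence.from T-≡ e)) le)
    t = n ℕ.∸ r
    x₀ = N₀ ℕ.+ N₀ ℕ.∸ t
    t+r : r ℕ.+ t ≡ n
    t+r = ℕₚ.m+[n∸m]≡n r≤n
    t≤2N₀ : t ℕ.≤ N₀ ℕ.+ N₀
    t≤2N₀ = ℕₚ.≤-trans (ℕₚ.m∸n≤m n r) (ℕₚ.≤-trans n≤N₀ (ℕₚ.m≤m+n N₀ N₀))

  Lρ-low : ∀ p → p ℕ.< t → Lρ p ≈V Φ (ρI (x₀ ℕ.+ p))
  Lρ-low p lt = St.~Vtrans (λ l → R₀.reflexive (cong (λ b → (if b then ρ₁ ((2 ℕ.* N) ℕ.∸ t ℕ.+ 1 ℕ.+ p) else ρ₁ (1 ℕ.+ (p ℕ.∸ t))) l) (<ᵇ-true lt)))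
    (St.~Vtrans (λ l → R₀.reflexive (cong (λ k → ρ₁ k l) eq)) (ρ₁-ρI (x₀ ℕ.+ p)))
    where
    eq : (2 ℕ.* N) ℕ.∸ t ℕ.+ 1 ℕ.+ p ≡ suc (x₀ ℕ.+ p)
    eq = trans (cong (ℕ._+ p) (ℕₚ.+-comm _ 1)) (cong (λ x → suc (x ℕ.∸ t ℕ.+ p)) (trans (cong (N ℕ.+_) (ℕₚ.+-identityʳ N)) (cong₂ ℕ._+_ N≡N₀ N≡N₀)))
  Lρ-high : ∀ p → t ℕ.≤ p → Lρ p ≈V Φ (ρI (p ℕ.∸ t))
  Lρ-high p le = St.~Vtrans (λ l → R₀.reflexive (cong (λ b → (if b then ρ₁ ((2 ℕ.* N) ℕ.∸ t ℕ.+ 1 ℕ.+ p) else ρ₁ (1 ℕ.+ (p ℕ.∸ t))) l) (<ᵇ-false le))) (ρ₁-ρI (p ℕ.∸ t))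

  -- Applying γ gives the term at N₀ + N₀ + j with j in Π₋, which by `double` is some ρ_i with i in
  -- Π₋; and γ⁻¹ρ_i = -σ_i.
  Cls-low : ∀ p → p ℕ.< t → Cls (ρI (x₀ ℕ.+ p)) 0
  Cls-low p lt = n⁻ i m (trans (sym (γ⁻γ _)) (trans (cong γ⁻ (trans (sym (ρI-+n (x₀ ℕ.+ p))) (trans (cong ρI eq) e))) (γ⁻ρf-minus i m)))
    where
    lt′ : r ℕ.+ p ℕ.< n
    lt′ = subst (r ℕ.+ p ℕ.<_) t+r (ℕₚ.+-monoʳ-< r lt)
    j = cyc (r ℕ.+ p)
    j≡ : toℕ j ≡ r ℕ.+ p
    j≡ = toℕ-cyc (r ℕ.+ p) lt′
    d = double j (subst (r ℕ.≤_) (sym j≡) (ℕₚ.m≤m+n r p))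
    i = proj₁ d
    m = proj₁ (proj₂ d)
    e = proj₂ (proj₂ d)
    eq : n ℕ.+ (x₀ ℕ.+ p) ≡ N₀ ℕ.+ N₀ ℕ.+ toℕ j
    eq = trans (cong (ℕ._+ (x₀ ℕ.+ p)) (sym t+r)) (trans (+-shuffle r t x₀ p) (cong₂ ℕ._+_ (ℕₚ.m∸n+n≡m t≤2N₀) (sym j≡)))
      where
      open import Data.Nat.Solver using (module +-*-Solver)
      open +-*-Solver using () renaming (solve to solveℕ; _:+_ to _⊕_; _:=_ to _⊜_)
      +-shuffle : ∀ r t x p → r ℕ.+ t ℕ.+ (x ℕ.+ p) ≡ x ℕ.+ t ℕ.+ (r ℕ.+ p)
      +-shuffle = solveℕ 4 (λ r t x p → r ⊕ t ⊕ (x ⊕ p) ⊜ x ⊕ t ⊕ (r ⊕ p)) refl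

  Cls-top : ∀ k → N₀ ℕ.≤ k → k ℕ.< N₀ ℕ.+ r → Cls (ρI k) (suc N₀)
  Cls-top k le lt = by-colour tr (trans (cong ρI (trans (sym (ℕₚ.m+[n∸m]≡n le)) (cong (N₀ ℕ.+_) (sym j≡)))) e)
    where
    small : k ℕ.∸ N₀ ℕ.< r
    small = ℕₚ.+-cancelˡ-< N₀ (k ℕ.∸ N₀) r (subst (ℕ._< N₀ ℕ.+ r) (sym (ℕₚ.m+[n∸m]≡n le)) lt)
    j = cyc (k ℕ.∸ N₀)
    j≡ : toℕ j ≡ k ℕ.∸ N₀
    j≡ = toℕ-cyc (k ℕ.∸ N₀) (ℕₚ.<-≤-trans small r≤n)
    tu = turn j
    i = proj₁ tu
    tr = proj₁ (proj₂ tu)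
    e = proj₂ (proj₂ tu)
    by-colour : Same j i → ρI k ≡ neg (ρf i) → Cls (ρI k) (suc N₀)
    by-colour (inj₁ (_ , p)) q = n⁺ i p (trans q (cong neg (ρf-plus i p)))
    by-colour (inj₂ (m , _)) q = ⊥-elim (ℕₚ.<-irrefl refl (ℕₚ.<-≤-trans small (subst (r ℕ.≤_) j≡ m)))

  -- Translates ≺ into keys: they increase strictly except inside -Π₋ and -Π₊. Each of these blocks
  -- lies within n consecutive terms of the sequence, where `ρI-<-≢` shows the roots to be distinct.
  ≺-key : ∀ {a b} → Φ a ≺ Φ b → ¬ a ≡ b × (∀ {κ λ′} → Cls a κ → Cls b λ′ → κ ℕ.≤ λ′)
  ≺-key {a} {b} (p , q , p<q , q<N+n , ea , eb) = go (ℕₚ.<-≤-connex p t) (ℕₚ.<-≤-connex q t)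
    where
    Goal = ¬ a ≡ b × (∀ {κ λ′} → Cls a κ → Cls b λ′ → κ ℕ.≤ λ′)
    by-keys : ∀ {κ λ′} → Cls a κ → Cls b λ′ → κ ℕ.< λ′ → Goal
    by-keys ca cb lt = (λ e → ℕₚ.<-irrefl (Cls-key (subst (λ x → Cls x _) e ca) cb) lt) , λ ca′ cb′ → subst₂ ℕ._≤_ (Cls-key ca ca′) (Cls-key cb cb′) (ℕₚ.<⇒≤ lt)
    by-window : ∀ {κ k l} → a ≡ ρI k → b ≡ ρI l → Cls a κ → Cls b κ → k ℕ.< l → l ℕ.< k ℕ.+ n → Goal
    by-window {κ} {k} {l} e f ca cb lt lt′ = (λ q → ρI-<-≢ k l lt lt′ (trans (sym e) (trans q f))) , λ ca′ cb′ → ℕₚ.≤-reflexive (trans (Cls-key ca′ ca) (Cls-key cb cb′))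
    low : ∀ {c p} → p ℕ.< t → Lρ p ≈V Φ c → c ≡ ρI (x₀ ℕ.+ p)
    low {c} {p} lt e = Φ-inj _ _ (St.~Vtrans (St.~Vsym e) (Lρ-low p lt))
    high : ∀ {c p} → t ℕ.≤ p → Lρ p ≈V Φ c → c ≡ ρI (p ℕ.∸ t)
    high {c} {p} le e = Φ-inj _ _ (St.~Vtrans (St.~Vsym e) (Lρ-high p le))
    bound : ∀ {q} → t ℕ.≤ q → q ℕ.< N ℕ.+ n → q ℕ.∸ t ℕ.< N₀ ℕ.+ r
    bound {q} le lt = ℕₚ.+-cancelʳ-< t (q ℕ.∸ t) (N₀ ℕ.+ r) (subst₂ ℕ._<_ (sym (ℕₚ.m∸n+n≡m le)) (trans (cong₂ ℕ._+_ N≡N₀ (sym t+r)) (sym (ℕₚ.+-assoc N₀ r t))) lt)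
    go : (p ℕ.< t) ⊎ (t ℕ.≤ p) → (q ℕ.< t) ⊎ (t ℕ.≤ q) → Goal
    go (inj₁ pl) (inj₁ ql) = by-window (low pl ea) (low ql eb) (subst (λ x → Cls x 0) (sym (low pl ea)) (Cls-low p pl)) (subst (λ x → Cls x 0) (sym (low ql eb)) (Cls-low q ql))
      (ℕₚ.+-monoʳ-< x₀ p<q) (ℕₚ.<-≤-trans (ℕₚ.+-monoʳ-< x₀ (ℕₚ.<-≤-trans ql (ℕₚ.m∸n≤m n r))) (ℕₚ.+-monoˡ-≤ n (ℕₚ.m≤m+n x₀ p)))
    go (inj₂ ph) (inj₁ ql) = ⊥-elim (ℕₚ.<-irrefl refl (ℕₚ.<-trans (ℕₚ.<-≤-trans ql ph) p<q))
    go (inj₁ pl) (inj₂ qh) = h (ℕₚ.<-≤-connex (q ℕ.∸ t) N₀)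
      where
      ca : Cls a 0
      ca = subst (λ x → Cls x 0) (sym (low pl ea)) (Cls-low p pl)
      h : (q ℕ.∸ t ℕ.< N₀) ⊎ (N₀ ℕ.≤ q ℕ.∸ t) → Goal
      h (inj₁ lt) = by-keys ca (ps (q ℕ.∸ t) lt (high qh eb)) (ℕ.s≤s ℕ.z≤n)
      h (inj₂ le) = by-keys ca (subst (λ x → Cls x (suc N₀)) (sym (high qh eb)) (Cls-top (q ℕ.∸ t) le (bound qh q<N+n))) (ℕ.s≤s ℕ.z≤n)
    go (inj₂ ph) (inj₂ qh) = h (ℕₚ.<-≤-connex (p ℕ.∸ t) N₀) (ℕₚ.<-≤-connex (q ℕ.∸ t) N₀)
      where
      k<l : p ℕ.∸ t ℕ.< q ℕ.∸ t
      k<l = ℕₚ.∸-monoˡ-< p<q ph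
      topb : N₀ ℕ.≤ q ℕ.∸ t → Cls b (suc N₀)
      topb le = subst (λ x → Cls x (suc N₀)) (sym (high qh eb)) (Cls-top (q ℕ.∸ t) le (bound qh q<N+n))
      h : (p ℕ.∸ t ℕ.< N₀) ⊎ (N₀ ℕ.≤ p ℕ.∸ t) → (q ℕ.∸ t ℕ.< N₀) ⊎ (N₀ ℕ.≤ q ℕ.∸ t) → Goal
      h (inj₁ lt) (inj₁ lt′) = by-keys (ps (p ℕ.∸ t) lt (high ph ea)) (ps (q ℕ.∸ t) lt′ (high qh eb)) (ℕ.s≤s k<l)
      h (inj₁ lt) (inj₂ le′) = by-keys (ps (p ℕ.∸ t) lt (high ph ea)) (topb le′) (ℕ.s≤s lt)
      h (inj₂ le) (inj₁ lt′) = ⊥-elim (ℕₚ.<-irrefl refl (ℕₚ.<-trans (ℕₚ.<-≤-trans lt′ le) k<l))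
      h (inj₂ le) (inj₂ le′) = by-window (high ph ea) (high qh eb) (subst (λ x → Cls x (suc N₀)) (sym (high ph ea)) (Cls-top (p ℕ.∸ t) le (ℕₚ.<-trans k<l (bound qh q<N+n)))) (topb le′) k<l
        (ℕₚ.<-≤-trans (bound qh q<N+n) (ℕₚ.+-mono-≤ le r≤n))

  NegSimpI : Fin M → Set
  NegSimpI x = ∃ λ i → x ≡ neg (simp i)

  NegSimple⇒ : ∀ {v x} → v ≈V Φ x → NegSimple v → NegSimpI x
  NegSimple⇒ {v} {x} e (i , f) = i , Φ-inj _ _ (St.~Vtrans (St.~Vsym e) (St.~Vtrans f (St.~Vsym (Φ-neg (simp i)))))
  NegSimpI⇒ : ∀ {v x} → v ≈V Φ x → NegSimpI x → NegSimple v
  NegSimpI⇒ {v} {x} e (i , f) = i , St.~Vtrans e (St.~Vtrans (λ l → R₀.reflexive (cong (λ y → Φ y l) f)) (Φ-neg (simp i)))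

  private
    γV-act : ∀ {v x} → v ≈V Φ x → actV (reverse γV) v ≈V Φ (γ⁻ x)
    γV-act {v} {x} e = St.~Vtrans (St.actV-cong (reverse γV) e) (St.~Vtrans (λ l → R₀.reflexive (cong (λ L → actV L (Φ x) l) eq))
      (St.~Vtrans (St.~Vsym (Φ-act (reverse (map simp γL)) x)) (λ l → R₀.reflexive (cong (λ y → Φ y l) (sym (walk-rev γL x))))))
      where
      eq : reverse γV ≡ map Φ (reverse (map simp γL))
      eq = trans (cong reverse (Listₚ.map-∘ γL)) (sym (Listₚ.reverse-map Φ (map simp γL)))
    Flip⇒ : ∀ {v x} → v ≈V Φ x → Flip v → FlipI x
    Flip⇒ e (inj₁ (i , p , f)) = inj₁ (i , p , Φ-inj _ _ (St.~Vtrans (St.~Vsym e) f))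
    Flip⇒ e (inj₂ (i , m , f)) = inj₂ (i , m , Φ-inj _ _ (St.~Vtrans (St.~Vsym e) (St.~Vtrans f (St.~Vsym (Φ-neg (simp i))))))
    Flip⇐ : ∀ {v x} → v ≈V Φ x → FlipI x → Flip v
    Flip⇐ e (inj₁ (i , p , f)) = inj₁ (i , p , St.~Vtrans e (λ l → R₀.reflexive (cong (λ y → Φ y l) f)))
    Flip⇐ e (inj₂ (i , m , f)) = inj₂ (i , m , St.~Vtrans e (St.~Vtrans (λ l → R₀.reflexive (cong (λ y → Φ y l) f)) (Φ-neg (simp i))))
    neg-eq : ∀ {v x} → v ≈V Φ x → negV v ≈V Φ (neg x)
    neg-eq {v} {x} e = St.~Vtrans (St.negV-cong e) (St.~Vsym (Φ-neg x))
    at : ∀ {x y} → x ≡ y → Φ x ≈V Φ y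
    at e l = R₀.reflexive (cong (λ y → Φ y l) e)

  𝓡Rel⇒ : ∀ {v u x} → v ≈V Φ x → 𝓡Rel v u → u ≈V Φ (next x)
  𝓡Rel⇒ {x = x} e (inj₁ (f , q)) = St.~Vtrans q (St.~Vtrans (neg-eq e) (at (sym (next-flip x (Flip⇒ e f)))))
  𝓡Rel⇒ {x = x} e (inj₂ (nf , q)) = St.~Vtrans q (St.~Vtrans (γV-act e) (at (sym (next-shift x (λ f → nf (Flip⇐ e f))))))
  𝓡Rel⇐ : ∀ {v x} → v ≈V Φ x → 𝓡Rel v (Φ (next x))
  𝓡Rel⇐ {v} {x} e = go (FlipI? x)
    where
    go : Dec (FlipI x) → 𝓡Rel v (Φ (next x))
    go (yes f) = inj₁ (Flip⇐ e f , St.~Vtrans (at (next-flip x f)) (St.~Vsym (neg-eq e)))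
    go (no nf) = inj₂ ((λ f → nf (Flip⇒ e f)) , St.~Vtrans (at (next-shift x nf)) (St.~Vsym (γV-act e)))
  𝓡Iter⇒ : ∀ k {v u x} → v ≈V Φ x → 𝓡Iter k v u → u ≈V Φ (iter next k x)
  𝓡Iter⇒ zero e f = St.~Vtrans f e
  𝓡Iter⇒ (suc k) e (w , f , g) = 𝓡Iter⇒ k (𝓡Rel⇒ e f) g
  𝓡Iter⇐ : ∀ k {v x} → v ≈V Φ x → 𝓡Iter k v (Φ (iter next k x))
  𝓡Iter⇐ zero e = St.~Vsym e
  𝓡Iter⇐ (suc k) {x = x} e = Φ (next x) , 𝓡Rel⇐ e , 𝓡Iter⇐ k St.~Vrefl

  Deg-intro : ∀ {v x} d → v ≈V Φ x → NegSimpI (iter next d x) → (∀ d′ → d′ ℕ.< d → Pos (iter next d′ x)) → Deg v d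
  Deg-intro {v} {x} d e ns nn = (Φ (iter next d x) , 𝓡Iter⇐ d e , NegSimpI⇒ St.~Vrefl ns) ,
    λ d′ lt u it f → let i , q = NegSimple⇒ (𝓡Iter⇒ d′ e it) f in Pos-Neg (nn d′ lt) (Neg-neg-simp i q)
  Deg-uniq : ∀ {v d d′} → Deg v d → Deg v d′ → d ≡ d′
  Deg-uniq ((u , a , b) , c) ((u′ , a′ , b′) , c′) = ℕₚ.≤-antisym (ℕₚ.≮⇒≥ λ lt → c _ lt u′ a′ b′) (ℕₚ.≮⇒≥ λ lt → c′ _ lt u a b)
  Deg-neg : ∀ {v x} → v ≈V Φ x → NegSimpI x → Deg v 0
  Deg-neg e ns = Deg-intro 0 e ns (λ _ ())

  next-small : ∀ k → k ℕ.< n → NegSimpI (next (ρI k))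
  next-small k lt = go (proj₂ (Cls⇒Tr (ps k (ℕₚ.<-≤-trans lt n≤N₀) refl))) refl
    where
    go : ∀ {κ κ′} → Tr (ρI k) κ κ′ → κ ≡ suc k → NegSimpI (next (ρI k))
    go (B i p e q) _ = i , trans q (cong neg e)
    go (C i m e q _) _ = i , q
    go (D′ l le _ _ _) e = ⊥-elim (ℕₚ.<-irrefl refl (ℕₚ.<-≤-trans lt (subst (n ℕ.≤_) (ℕₚ.suc-injective e) le)))
    go (E′ _ _ _ _ _ _ _ _ _) e = ⊥-elim (ℕₚ.<-irrefl (sym (ℕₚ.suc-injective e)) (ℕₚ.<-≤-trans lt n≤N₀))
  next-big : ∀ k → n ℕ.≤ k → k ℕ.< N₀ → next (ρI k) ≡ ρI (k ℕ.∸ n)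
  next-big k le lt = go (proj₂ (Cls⇒Tr (ps k lt refl))) refl
    where
    go : ∀ {κ κ′} → Tr (ρI k) κ κ′ → κ ≡ suc k → next (ρI k) ≡ ρI (k ℕ.∸ n)
    go (B i p e q) e′ = ⊥-elim (ℕₚ.<-irrefl (ℕₚ.suc-injective e′) (ℕₚ.<-≤-trans (Finₚ.toℕ<n i) le))
    go (C i m e q _) e′ = ⊥-elim (ℕₚ.<-irrefl (ℕₚ.suc-injective e′) (ℕₚ.<-≤-trans (Finₚ.toℕ<n i) le))
    go (D′ l le _ _ q) e = trans q (γ⁻ρ k (subst (n ℕ.≤_) (ℕₚ.suc-injective e) le))
    go (E′ _ _ _ _ _ _ _ _ _) e = ⊥-elim (ℕₚ.<-irrefl (sym (ℕₚ.suc-injective e)) lt)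

  private
    descend : ∀ e (i : Fin n) → e ℕ.* n ℕ.+ toℕ i ℕ.< N₀ → NegSimpI (iter next (suc e) (ρI (e ℕ.* n ℕ.+ toℕ i))) × (∀ d → d ℕ.< suc e → Pos (iter next d (ρI (e ℕ.* n ℕ.+ toℕ i))))
    descend zero i lt = next-small (toℕ i) (Finₚ.toℕ<n i) , λ { zero _ → Pos-ρ (toℕ i) lt ; (suc d) (ℕ.s≤s ()) }
    descend (suc e) i lt = subst (λ x → NegSimpI (iter next (suc e) x)) (sym step) (proj₁ ih) ,
        λ { zero _ → Pos-ρ (suc e ℕ.* n ℕ.+ toℕ i) lt ; (suc d) (ℕ.s≤s h) → subst (λ x → Pos (iter next d x)) (sym step) (proj₂ ih d h) }
      where
      assoc : suc e ℕ.* n ℕ.+ toℕ i ≡ n ℕ.+ (e ℕ.* n ℕ.+ toℕ i)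
      assoc = ℕₚ.+-assoc n (e ℕ.* n) (toℕ i)
      ih = descend e i (ℕₚ.≤-<-trans (ℕₚ.m≤n+m (e ℕ.* n ℕ.+ toℕ i) n) (subst (ℕ._< N₀) assoc lt))
      step : next (ρI (suc e ℕ.* n ℕ.+ toℕ i)) ≡ ρI (e ℕ.* n ℕ.+ toℕ i)
      step = trans (next-big (suc e ℕ.* n ℕ.+ toℕ i) (subst (n ℕ.≤_) (sym assoc) (ℕₚ.m≤m+n n _)) lt) (cong ρI (trans (cong (ℕ._∸ n) assoc) (ℕₚ.m+n∸m≡n n _)))

  reach-ρ : ∀ {x} k → k ℕ.< N₀ → x ≡ ρI k → NegSimpI (iter next (suc (k / n)) x) × (∀ d → d ℕ.< suc (k / n) → Pos (iter next d x))
  reach-ρ {x} k lt e = subst (λ y → NegSimpI (iter next (suc (k / n)) y) × (∀ d → d ℕ.< suc (k / n) → Pos (iter next d y))) (sym (trans e (cong ρI (index k))))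
    (descend (k / n) (cyc k) (subst (ℕ._< N₀) (index k) lt))

  -- 𝓡 lowers the position by n while it is at least n; from a position below n, one more step gives
  -- a negative simple root. So the degree is the row number plus one.
  Deg-ρ : ∀ {v x} k → k ℕ.< N₀ → x ≡ ρI k → v ≈V Φ x → Deg v (suc (k / n))
  Deg-ρ k lt e f = let a , b = reach-ρ k lt e in Deg-intro (suc (k / n)) f a b

  Cls-reach : ∀ {x κ} → Cls x κ → ∃ λ d → NegSimpI (iter next d x)
  Cls-reach (n⁻ i _ e) = 0 , i , e
  Cls-reach (n⁺ i _ e) = 0 , i , e
  Cls-reach (ps k lt e) = suc (k / n) , proj₁ (reach-ρ k lt e)

  -- Induction on the inversions of w: a descent σ_j of w has ω_i ∙ σ_j ≤ 0, hence j ≠ i.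
  IsDual : Fin n → V → Set
  IsDual i w = (∀ j → ¬ j ≡ i → w ∙ σ j ~ 0#) × (coef (σ i) w ~ 1#)

  dual-cf : ∀ {i} ω → IsDual i ω → ∀ β → ω ∙ Φ β ~ cf β i * (ω ∙ σ i)
  dual-cf {i} ω d β = ~trans (∙-cong (~Vrefl {ω}) (↑V (Φ-lin β))) (~trans (∙-lin ω (cf β) σ) (sumK-single (λ a → cf β a * (ω ∙ σ a)) i (λ a ne → ~trans (*-congˡ (proj₁ d a ne)) (zeroʳ _))))

  parabolic : ∀ i w → (∀ ω → IsDual i ω → act w ω ~V ω) → ∃ λ v → All (λ j → ¬ j ≡ i) v × (∀ k → actI w k ≡ sact v k)
  parabolic i w fix = go w (<-wellFounded (count (inv w))) fix
    where
    inv : Word → Fin M → Bool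
    inv w k = pos k ∧ not (pos (actI (reverse w) k))
    go : ∀ w → Acc ℕ._<_ (count (inv w)) → (∀ ω → IsDual i ω → act w ω ~V ω) → ∃ λ v → All (λ j → ¬ j ≡ i) v × (∀ k → actI w k ≡ sact v k)
    go w (acc rs) fix = cases (Finₚ.any? (λ j → pos (actI w (simp j)) Bool.≟ false))
      where
      cases : Dec (∃ λ j → Neg (actI w (simp j))) → ∃ λ v → All (λ j → ¬ j ≡ i) v × (∀ k → actI w k ≡ sact v k)
      cases (no none) = [] , [] , word-Pos-pres⇒id w (λ j → Pos⇒ (λ q → none (j , q)))
      cases (yes (j , q)) = let v , al , e = go w′ (rs smaller) fix′ in v ++ j ∷ [] , Allₚ.++⁺ al (j≢i ∷ []) , λ k →
          trans (sym (trans (actI-++ w (simp j ∷ []) (s j k)) (cong (actI w) (s-s j k)))) (trans (e (s j k)) (sym (sact-++ v (j ∷ []) k)))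
        where
        w′ = w ++ simp j ∷ []
        j≢i : ¬ j ≡ i
        j≢i refl = dual i λ (ω , d) → 1≁0 (~trans (~sym (proj₂ d)) (coef-0 (σ i) ω (at-i ω d)))
          where
          at-i : ∀ ω → IsDual i ω → ω ∙ σ i ~ 0#
          at-i ω d = Nn-antisym nn (Nn-resp (~sym flip) (Nn-* (Neg-Nn k q i) nn))
            where
            k = actI w (simp i)
            nn : Nn (ω ∙ σ i)
            nn = Nn-cancel Nn-two two≁0 (Nn-resp (~trans (~sym (*-identityˡ _)) (~trans (*-congʳ (~sym (proj₂ d))) (coef-∙ {σ i} (Φ-NZ (simp i)) ω))) (∙-Nn (σ i)))
            flip : - (ω ∙ σ i) ~ (- cf k i) * (ω ∙ σ i)
            flip = ~trans (-‿cong (~trans (~sym (act-iso w ω (σ i))) (~trans (∙-cong (fix ω d) (~Vsym (↑V (Φ-act w (simp i))))) (dual-cf ω d k))))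
              (solve 2 (λ a b → :- (a :* b) := (:- a) :* b) ~refl (cf k i) (ω ∙ σ i))
        fix′ : ∀ ω → IsDual i ω → act w′ ω ~V ω
        fix′ ω d = ~Vtrans (λ l → ~reflexive (cong (λ v → v l) (act-++ w (simp j ∷ []) ω))) (~Vtrans (act-cong w (Refl-fix (σ j) ω (proj₁ d j j≢i))) (fix ω d))
        rev′ : ∀ k → actI (reverse w′) k ≡ s j (actI (reverse w) k)
        rev′ k = cong (λ v → actI v k) (Listₚ.reverse-++ w (simp j ∷ []))
        k₀ = neg (actI w (simp j))
        back : actI (reverse w) k₀ ≡ neg (simp j)
        back = trans (actI-neg (reverse w) (actI w (simp j))) (cong neg (actI-rev w (simp j)))
        sub : ∀ k → inv w′ k ≡ true → inv w k ≡ true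
        sub k e = cong₂ (λ a b → a ∧ not b) p (Neg⇒ nonpos)
          where
          p : Pos k
          p = ∧-conicalˡ (pos k) _ e
          neg′ : Neg (s j (actI (reverse w) k))
          neg′ = trans (cong pos (sym (rev′ k))) (not-injective (∧-conicalʳ (pos k) _ e))
          nonpos : ¬ Pos (actI (reverse w) k)
          nonpos h = Pos-Neg p (trans (cong pos (trans (sym (actI-rev′ w k)) (cong (actI w) (Pos-neg-flip h neg′)))) q)
        smaller : count (inv w′) ℕ.< count (inv w)
        smaller = count-< (inv w′) (inv w) sub k₀
          (cong₂ (λ a b → a ∧ not b) (Neg⇒Pos-neg q) (trans (cong pos (trans (rev′ k₀) (trans (cong (s j) back) (trans (ref-neg (simp j) (simp j)) (neg-neg (simp j)))))) (Pos-simp j)))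
          (cong₂ (λ a b → a ∧ not b) (Neg⇒Pos-neg q) (trans (cong pos back) (Pos⇒Neg-neg (Pos-simp j))))

  cf-sact₀ : ∀ v i j → All (λ a → ¬ a ≡ i) v → cf (sact v j) i R₀.≈ cf j i
  cf-sact₀ [] i j [] = R₀.refl
  cf-sact₀ (a ∷ v) i j (ne ∷ nes) = R₀.trans (cf-s₀ a (sact v j) i (λ q → ne (sym q))) (cf-sact₀ v i j nes)

  -- Vanishing of a coefficient is a combinatorial fact, hence the double negation can be removed.
  cf-0-strict : ∀ β i → cf β i ~ 0# → cf β i R₀.≈ 0#
  cf-0-strict β i z = St.cancel {two} (λ e → two≁0 (↑ e)) (R₀.trans (St.solve 1 (λ x → (St.:1 St.:+ St.:1) St.:* x St.:= x St.:+ (St.:- (St.:- x))) R₀.refl (cf β i))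
      (R₀.trans (R₀.+-congˡ (R₀.-‿cong (R₀.trans (R₀.sym (cf-neg₀ β i)) (R₀.trans (R₀.reflexive (cong (λ k → cf k i) (proj₂ (proj₂ par) β))) (cf-sact₀ (proj₁ par) i β (proj₁ (proj₂ par)))))))
        (R₀.-‿inverseʳ _)))
    where
    -- As ω_i ∙ β vanishes, R(β) fixes ω_i and is a word in the other simple reflections, which keep
    -- the i-th coefficient exactly. But R(β) negates β, so the coefficient equals its own negative.
    par = parabolic i (β ∷ []) (λ ω d → Refl-fix (Φ β) ω (~trans (dual-cf ω d β) (~trans (*-congʳ z) (zeroˡ _))))

  -- A root -σ_i of Π₋ has the least key and enters χ as second argument; one of Π₊ has the greatest
  -- and enters as first argument. These are the sides on which `χ-minus` and `χ-plus` read off the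
  -- coefficient at σ_i.
  base : ∀ {x y κ λ′} i → x ≡ neg (simp i) → Cls x κ → Cls y λ′ → ¬ x ≡ y → Neg y ⊎ (cf y i ~ 0#) → NCk κ λ′ x y
  base {x} {y} i e cx cy ne h = go cx cy
    where
    vanish : ∀ {k} → k ℕ.< N₀ → y ≡ ρI k → cf y i ~ 0#
    vanish lt q = [ (λ ng → ⊥-elim (Pos-Neg (Pos-ρ′ _ lt q) ng)) , (λ z → z) ]′ h
    same : ∀ {i₁ i₂ κ λ′} → x ≡ neg (simp i₁) → y ≡ neg (simp i₂) → Same i₁ i₂ → NCk κ λ′ x y
    same {i₁} {i₂} p q sm = (λ _ → subst₂ Z (sym q) (sym p) (Z-negˡ (Z-negʳ (Z-simp-same (Same-sym sm) (λ z → i≢ (sym z)))))) , (λ _ → subst₂ Z (sym p) (sym q) (Z-negˡ (Z-negʳ (Z-simp-same sm i≢))))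
      where
      i≢ : ¬ i₁ ≡ i₂
      i≢ z = ne (trans p (trans (cong (neg ∘ simp) z) (sym q)))
    go : ∀ {κ λ′} → Cls x κ → Cls y λ′ → NCk κ λ′ x y
    go (ps k lt q) _ = ⊥-elim (Pos-Neg (Pos-ρ′ k lt q) (Neg-neg-simp i e))
    go (n⁻ i₁ m p) (n⁻ i₂ m′ q) = same p q (inj₂ (m , m′))
    go (n⁺ i₁ m p) (n⁺ i₂ m′ q) = same p q (inj₁ (m , m′))
    go (n⁻ i₁ m p) (n⁺ i₂ m′ q) = (λ _ → subst₂ Z (sym q) (sym p) (Z-negˡ (Z-negʳ (Z-simp-< i₂ i₁ (ℕₚ.<-≤-trans m′ m))))) , (λ ())
    go (n⁺ i₁ m p) (n⁻ i₂ m′ q) = (λ ()) , (λ _ → subst₂ Z (sym p) (sym q) (Z-negˡ (Z-negʳ (Z-simp-< i₁ i₂ (ℕₚ.<-≤-trans m m′)))))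
    go (n⁻ i₁ m p) (ps k lt q) = (λ _ → subst (Z y) (sym e) (Z-negʳ (λ u su → ~-stable (Sol-exists (simp i) >>= λ (v , sv) → return (~trans (χ-minus i m′ sv su) (~trans (*-congʳ (vanish lt q)) (zeroˡ _))))))) , (λ ())
      where
      m′ : Minus i
      m′ = subst Minus (neg-simp-uniq p e) m
    go (n⁺ i₁ m p) (ps k lt q) = (λ le → ⊥-elim (ℕₚ.<-irrefl refl (ℕₚ.<-≤-trans lt (ℕₚ.≤-pred le)))) , (λ _ → subst (λ z → Z z y) (sym e) (Z-negˡ (λ v sv → ~trans (χ-plus i m′ sv y) (~trans (*-congʳ (vanish lt q)) (zeroˡ _)))))
      where
      m′ : Plus i
      m′ = subst Plus (neg-simp-uniq p e) m

  base⁻ : ∀ {x y κ λ′} i → x ≡ neg (simp i) → Cls x κ → Cls y λ′ → NCk κ λ′ x y → NegSimpI y ⊎ (Pos y × cf y i R₀.≈ 0#)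
  base⁻ {x} {y} i e cx (n⁻ i′ _ q) nc = inj₁ (i′ , q)
  base⁻ {x} {y} i e cx (n⁺ i′ _ q) nc = inj₁ (i′ , q)
  base⁻ {x} {y} i e (ps k′ lt′ q′) (ps k lt q) nc = ⊥-elim (Pos-Neg (Pos-ρ′ k′ lt′ q′) (Neg-neg-simp i e))
  base⁻ {x} {y} i e (n⁻ i₁ m p) (ps k lt q) (z , _) = inj₂ (Pos-ρ′ k lt q , cf-0-strict y i (~-stable (Sol-exists y >>= λ (u , su) → Sol-exists (simp i) >>= λ (v , sv) →
      return (cancel (χ-self≁0 sv) (~trans (*-comm _ _) (~trans (~sym (χ-minus i (subst Minus (neg-simp-uniq p e) m) sv su)) (Z-negʳ⁻ (subst (Z y) e (z ℕ.z≤n)) u su)))))))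
  base⁻ {x} {y} i e (n⁺ i₁ m p) (ps k lt q) (_ , z) = inj₂ (Pos-ρ′ k lt q , cf-0-strict y i (~-stable (Sol-exists (simp i) >>= λ (v , sv) →
      return (cancel (χ-self≁0 sv) (~trans (*-comm _ _) (~trans (~sym (χ-plus i (subst Plus (neg-simp-uniq p e) m) sv y)) (Z-negˡ⁻ (subst (λ x → Z x y) e (z (ℕ.s≤s (ℕₚ.<⇒≤ lt)))) v sv)))))))

  -- `Compat` may be witnessed at any k for which 𝓡^k α is negative simple. The condition holds
  -- there by `base` and is carried back one step at a time by `NCk-next`, so the choice of k is
  -- immaterial.
  Compat⇒NCk : ∀ {α β x y κ λ′} → α ≈V Φ x → β ≈V Φ y → Cls x κ → Cls y λ′ → ¬ x ≡ y → Compat α β → NCk κ λ′ x y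
  Compat⇒NCk a b cx cy ne (k , u , u′ , it , it′ , i , ui , cond) = go k a b cx cy ne it it′
    where
    go : ∀ k {α β x y κ λ′} → α ≈V Φ x → β ≈V Φ y → Cls x κ → Cls y λ′ → ¬ x ≡ y → 𝓡Iter k α u → 𝓡Iter k β u′ → NCk κ λ′ x y
    go zero {x = x} {y} a b cx cy ne it it′ = base i (Φ-inj _ _ (St.~Vtrans (St.~Vsym ux) (St.~Vtrans ui (St.~Vsym (Φ-neg (simp i)))))) cx cy ne (cases cond)
      where
      ux : u ≈V Φ x
      ux = St.~Vtrans it a
      uy : u′ ≈V Φ y
      uy = St.~Vtrans it′ b
      cases : NegSimple u′ ⊎ (IsPos u′ × ∃ λ c → (u′ ≈V linΠ c) × (c i R₀.≈ 0#)) → Neg y ⊎ (cf y i ~ 0#)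
      cases (inj₁ ns) = let i′ , q = NegSimple⇒ uy ns in inj₁ (Neg-neg-simp i′ q)
      cases (inj₂ (_ , c , e , z)) = inj₂ (~trans (cf-uniq y c (~Vtrans (~Vsym (↑V uy)) (↑V e)) i) (↑ z))
    go (suc k) a b cx cy ne (w , f , it) (w′ , f′ , it′) = let _ , tx = Cls⇒Tr cx ; _ , ty = Cls⇒Tr cy in
      proj₂ (NCk-next ne tx ty) (go k (𝓡Rel⇒ a f) (𝓡Rel⇒ b f′) (Tr⇒Cls tx) (Tr⇒Cls ty) (λ e → ne (next-inj cx cy e)) it it′)

  NCk⇒Compat : ∀ {α β x y κ λ′} → α ≈V Φ x → β ≈V Φ y → Cls x κ → Cls y λ′ → ¬ x ≡ y → NCk κ λ′ x y → Compat α β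
  NCk⇒Compat {x = x} {y} a b cx cy ne nc = let d , i , e = Cls-reach cx in
      d , Φ (iter next d x) , Φ (iter next d y) , 𝓡Iter⇐ d a , 𝓡Iter⇐ d b , i , St.~Vtrans (λ l → R₀.reflexive (cong (λ z → Φ z l) e)) (Φ-neg (simp i)) , finish d cx cy ne nc i e
    where
    finish : ∀ d {x y κ λ′} → Cls x κ → Cls y λ′ → ¬ x ≡ y → NCk κ λ′ x y → ∀ i → iter next d x ≡ neg (simp i) →
      NegSimple (Φ (iter next d y)) ⊎ (IsPos (Φ (iter next d y)) × ∃ λ c → (Φ (iter next d y) ≈V linΠ c) × (c i R₀.≈ 0#))
    finish zero {x} {y} cx cy ne nc i e = cases (base⁻ i e cx cy nc)
      where
      cases : NegSimpI y ⊎ (Pos y × cf y i R₀.≈ 0#) → NegSimple (Φ y) ⊎ (IsPos (Φ y) × ∃ λ c → (Φ y ≈V linΠ c) × (c i R₀.≈ 0#))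
      cases (inj₁ ns) = inj₁ (NegSimpI⇒ St.~Vrefl ns)
      cases (inj₂ (p , z)) = inj₂ (Pos-IsPos y p , cf y , Φ-lin y , z)
    finish (suc d) cx cy ne nc i e = let _ , tx = Cls⇒Tr cx ; _ , ty = Cls⇒Tr cy in
      finish d (Tr⇒Cls tx) (Tr⇒Cls ty) (λ q → ne (next-inj cx cy q)) (proj₁ (NCk-next ne tx ty) nc) i e

-- Absolute order and m-compatibility of pairs, with list and counting utilities.

AllPairs-++⁻ : ∀ {A : Set} {R : A → A → Set} xs {ys} → AllPairs R (xs ++ ys) → AllPairs R xs × AllPairs R ys × All (λ x → All (R x) ys) xs
AllPairs-++⁻ [] p = [] , p , []
AllPairs-++⁻ (x ∷ xs) (p ∷ ps) = let a , b , c = AllPairs-++⁻ xs ps in Allₚ.++⁻ˡ xs p ∷ a , b , Allₚ.++⁻ʳ xs p ∷ c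

AllPairs-map∈ : ∀ {A : Set} {R S : A → A → Set} {w : List A} → (∀ {a b} → a ∈ w → b ∈ w → R a b → S a b) → AllPairs R w → AllPairs S w
AllPairs-map∈ f [] = []
AllPairs-map∈ f (p ∷ ps) = All.tabulate (λ m → f (here refl) (there m) (All.lookup p m)) ∷ AllPairs-map∈ (λ x y → f (there x) (there y)) ps

AllPairs-choose : ∀ {A : Set} {R : A → A → Set} {w : List A} → AllPairs R w → ∀ {a b} → a ∈ w → b ∈ w → ¬ a ≡ b → R a b ⊎ R b a
AllPairs-choose (p ∷ ps) (here refl) (here refl) ne = ⊥-elim (ne refl)
AllPairs-choose (p ∷ ps) (here refl) (there y) ne = inj₁ (All.lookup p y)
AllPairs-choose (p ∷ ps) (there x) (here refl) ne = inj₂ (All.lookup p x)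
AllPairs-choose (p ∷ ps) (there x) (there y) ne = AllPairs-choose ps x y ne

count-cong : ∀ {k} {f g : Fin k → Bool} → (∀ i → f i ≡ g i) → count f ≡ count g
count-cong {zero} e = refl
count-cong {suc k} e = cong₂ (λ b c → (if b then 1 else 0) ℕ.+ c) (e zero) (count-cong (e ∘ suc))

count-false : ∀ {k} (f : Fin k → Bool) → (∀ i → f i ≡ false) → count f ≡ 0
count-false {zero} f e = refl
count-false {suc k} f e = trans (cong (λ b → (if b then 1 else 0) ℕ.+ count (f ∘ suc)) (e zero)) (count-false (f ∘ suc) (e ∘ suc))

without : ∀ {k} → (Fin k → Bool) → Fin k → Fin k → Bool
without f a x = f x ∧ not (does (x Finₚ.≟ a))

count-without : ∀ {k} (f : Fin k → Bool) a → f a ≡ true → count f ≡ suc (count (without f a))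
count-without {suc k} f zero e = trans (cong (λ b → (if b then 1 else 0) ℕ.+ count (f ∘ suc)) e)
  (cong suc (sym (trans (cong (λ b → (if b then 1 else 0) ℕ.+ count (without f zero ∘ suc)) (∧-zeroʳ (f zero))) (count-cong (λ i → ∧-identityʳ (f (suc i)))))))
count-without {suc k} f (suc a) e = trans (cong ((if f zero then 1 else 0) ℕ.+_) (count-without (f ∘ suc) a e))
  (trans (ℕₚ.+-suc (if f zero then 1 else 0) _) (cong suc (cong (λ b → (if b then 1 else 0) ℕ.+ count (without (f ∘ suc) a)) (sym (∧-identityʳ (f zero))))))

length-count : ∀ {k} (w : List (Fin k)) → AllPairs (λ a b → ¬ a ≡ b) w → (f : Fin k → Bool) → (∀ j → f j ≡ true → j ∈ w) → (∀ j → j ∈ w → f j ≡ true) → length w ≡ count f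
length-count [] [] f to from = sym (count-false f (λ i → ¬-not (λ e → ¬∈[] (to i e))))
  where
  ¬∈[] : ∀ {j} → ¬ j ∈ []
  ¬∈[] ()
length-count (a ∷ w) (p ∷ ps) f to from = trans (cong suc (length-count w ps (without f a) to′ from′)) (sym (count-without f a (from a (here refl))))
  where
  to′ : ∀ j → without f a j ≡ true → j ∈ w
  to′ j e = h (to j (∧-conicalˡ (f j) _ e))
    where
    h : j ∈ a ∷ w → j ∈ w
    h (there m) = m
    h (here q) = ⊥-elim (not-¬ (dec-true (j Finₚ.≟ a) q) (not-injective (∧-conicalʳ (f j) _ e)))
  from′ : ∀ j → j ∈ w → without f a j ≡ true
  from′ j m = cong₂ _∧_ (from j (there m)) (cong not (dec-false (j Finₚ.≟ a) (λ e → All.lookup p m (sym e))))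

module Main (F : OrderedField) (n : ℕ) (D : BipRootSystem F n) where
  open Compatibility F n D public
  open WithRS F n D public using (HasLT; AbsLe; InNC; prodW; IsWτ; _≈W_; module Colored; module ColoredNC)

  HasLT-uniq : ∀ {w a b} → HasLT w a → HasLT w b → a ≡ b
  HasLT-uniq ((t , lt , et) , m) ((t′ , lt′ , et′) , m′) = ℕₚ.≤-antisym (subst (_ ℕ.≤_) lt′ (m t′ et′)) (subst (_ ℕ.≤_) lt (m′ t et))

  private
    ↓≋ : ∀ {u v} → u ≈W v → u ≋ v
    ↓≋ {u} {v} e = ≈⇒≋ {u} {v} (λ x → ↑V (e x))

  -- P is completed to a factorization of γ into n reflections; a shorter word for P would write γ
  -- with fewer than n.
  exceptional-HasLT : ∀ P → AllPairs Z P → HasLT P (length P)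
  exceptional-HasLT P ex = (P , refl , λ x → St.~Vrefl) , shortest (exceptional-complete P ex)
    where
    shortest : (∃ λ Q → (length Q ≡ n ℕ.∸ length P) × (P ++ Q) ≋ γW) → ∀ t → t ≈W P → length P ℕ.≤ length t
    shortest (Q , lQ , e) t te = ℕₚ.+-cancelʳ-≤ (n ℕ.∸ length P) (length P) (length t) (begin
      length P ℕ.+ (n ℕ.∸ length P) ≡⟨ ℕₚ.m+[n∸m]≡n (exceptional-length P ex) ⟩
      n ≤⟨ γ-shortest (t ++ Q) (λ j → trans (actI-++ t Q j) (trans (↓≋ {t} {P} te (actI Q j)) (trans (sym (actI-++ P Q j)) (e j)))) ⟩
      length (t ++ Q) ≡⟨ Listₚ.length-++ t ⟩
      length t ℕ.+ length Q ≡⟨ cong (length t ℕ.+_) lQ ⟩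
      length t ℕ.+ (n ℕ.∸ length P) ∎)
      where open ℕₚ.≤-Reasoning

  γ-HasLT : HasLT γW n
  γ-HasLT = (γW , length-γW , λ x → St.~Vrefl) , λ t e → γ-shortest t (↓≋ {t} {γW} e)

  exceptional-AbsLe : ∀ P → AllPairs Z P → AbsLe P γW
  exceptional-AbsLe P ex = length P , n ℕ.∸ length P , n , exceptional-HasLT P ex , compl (exceptional-complete P ex) , γ-HasLT , ℕₚ.m+[n∸m]≡n (exceptional-length P ex)
    where
    compl : (∃ λ Q → (length Q ≡ n ℕ.∸ length P) × (P ++ Q) ≋ γW) → HasLT (reverse P ++ γW) (n ℕ.∸ length P)
    compl (Q , lQ , e) = (Q , lQ , ≋⇒≈ {Q} {reverse P ++ γW} (λ j → sym (trans (actI-++ (reverse P) γW j) (trans (cong (actI (reverse P)) (trans (sym (e j)) (actI-++ P Q j))) (actI-rev P (actI Q j)))))) ,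
      λ t te → ℕₚ.m≤n+o⇒m∸n≤o n (length P) (subst (n ℕ.≤_) (Listₚ.length-++ P) (γ-shortest (P ++ t) (λ j → trans (actI-++ P t j)
        (trans (cong (actI P) (trans (↓≋ {t} {reverse P ++ γW} te j) (actI-++ (reverse P) γW j))) (actI-rev′ P (γI j))))))

  -- A shortest word for P⁻¹γ, appended to P, gives n reflections with product γ; the vanishing of χ
  -- is inherited by the initial part P.
  AbsLe⇒exceptional : ∀ P → HasLT P (length P) → AbsLe P γW → AllPairs Z P
  AbsLe⇒exceptional P lP (a , b , c , la , ((t , lt , te) , _) , lc , sum) = proj₁ (AllPairs-++⁻ P (factorization⇒AllPairs-Z (P ++ t)
      (λ j → trans (actI-++ P t j) (trans (cong (actI P) (trans (↓≋ {t} {reverse P ++ γW} te j) (actI-++ (reverse P) γW j))) (actI-rev′ P (γI j))))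
      (trans (Listₚ.length-++ P) (trans (cong₂ ℕ._+_ (HasLT-uniq {P} lP la) lt) (trans sum (HasLT-uniq {γW} lc γ-HasLT))))))

  exceptional-InNC : ∀ P → AllPairs Z P → InNC P
  exceptional-InNC P ex = (0 , length P , length P , (([] , refl , λ x → St.~Vrefl) , λ t _ → ℕ.z≤n) , exceptional-HasLT P ex , exceptional-HasLT P ex , refl) , exceptional-AbsLe P ex

  length-prodW : ∀ {t} (f : Fin t → Word) (m : ℕ) → length (prodW f) ≡ Colored.sumℕ m (λ p → length (f p))
  length-prodW {zero} f m = refl
  length-prodW {suc t} f m = trans (Listₚ.length-++ (f zero)) (cong (length (f zero) ℕ.+_) (length-prodW (f ∘ suc) m))

  prodW-AllPairs : ∀ {t} (f : Fin t → Word) → (∀ p → AllPairs Z (f p)) → (∀ p q → toℕ p ℕ.< toℕ q → ∀ {a b} → a ∈ f p → b ∈ f q → Z a b) → AllPairs Z (prodW f)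
  prodW-AllPairs {zero} f inner cross = []
  prodW-AllPairs {suc t} f inner cross = AllPairsₚ.++⁺ (inner zero) (prodW-AllPairs (f ∘ suc) (inner ∘ suc) (λ p q lt → cross (suc p) (suc q) (ℕ.s≤s lt)))
    (All.tabulate λ a∈ → All.tabulate λ b∈ → let q , m = find (f ∘ suc) b∈ in cross zero (suc q) (ℕ.s≤s ℕ.z≤n) a∈ m)
    where
    find : ∀ {t} (f : Fin t → Word) {b} → b ∈ prodW f → ∃ λ q → b ∈ f q
    find {suc t} f m = [ (λ h → zero , h) , (λ h → let q , h′ = find (f ∘ suc) h in suc q , h′) ]′ (∈ₚ.∈-++⁻ (f zero) m)

  ∈-prodW : ∀ {t} (f : Fin t → Word) q {b} → b ∈ f q → b ∈ prodW f
  ∈-prodW f zero m = ∈ₚ.∈-++⁺ˡ m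
  ∈-prodW f (suc q) m = ∈ₚ.∈-++⁺ʳ (f zero) (∈-prodW (f ∘ suc) q m)

  prodW-inner : ∀ {t} (f : Fin t → Word) → AllPairs Z (prodW f) → ∀ p → AllPairs Z (f p)
  prodW-inner f ex zero = proj₁ (AllPairs-++⁻ (f zero) ex)
  prodW-inner f ex (suc p) = prodW-inner (f ∘ suc) (proj₁ (proj₂ (AllPairs-++⁻ (f zero) ex))) p

  prodW-cross : ∀ {t} (f : Fin t → Word) → AllPairs Z (prodW f) → ∀ p q → toℕ p ℕ.< toℕ q → ∀ {a b} → a ∈ f p → b ∈ f q → Z a b
  prodW-cross f ex zero (suc q) lt a∈ b∈ = All.lookup (All.lookup (proj₂ (proj₂ (AllPairs-++⁻ (f zero) ex))) a∈) (∈-prodW (f ∘ suc) q b∈)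
  prodW-cross f ex (suc p) (suc q) (ℕ.s≤s lt) a∈ b∈ = prodW-cross (f ∘ suc) (proj₁ (proj₂ (AllPairs-++⁻ (f zero) ex))) p q lt a∈ b∈

  module Pair (m : ℕ) where
    open Colored m
    open ColoredNC m

    private
      only₁ : ∀ {κ λ′ x y} → κ ℕ.< λ′ → NCk κ λ′ x y ⟺ Z y x
      only₁ lt = (λ (p , _) → p (ℕₚ.<⇒≤ lt)) , (λ z → (λ _ → z) , (λ le → ⊥-elim (ℕₚ.<-irrefl refl (ℕₚ.<-≤-trans lt le))))
      only₂ : ∀ {κ λ′ x y} → λ′ ℕ.< κ → NCk κ λ′ x y ⟺ Z x y
      only₂ lt = (λ (_ , p) → p (ℕₚ.<⇒≤ lt)) , (λ z → (λ le → ⊥-elim (ℕₚ.<-irrefl refl (ℕₚ.<-≤-trans lt le))) , (λ _ → z))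

    row-≤ : ∀ {k l} → k / n ℕ.≤ l / n → k ℕ.< l ℕ.+ n
    row-≤ {k} {l} le = begin-strict
      k ≡⟨ index k ⟩
      k / n ℕ.* n ℕ.+ toℕ (cyc k) <⟨ ℕₚ.+-monoʳ-< (k / n ℕ.* n) (Finₚ.toℕ<n (cyc k)) ⟩
      k / n ℕ.* n ℕ.+ n ≤⟨ ℕₚ.+-monoˡ-≤ n (ℕₚ.*-monoˡ-≤ n le) ⟩
      l / n ℕ.* n ℕ.+ n ≤⟨ ℕₚ.+-monoˡ-≤ n (ℕₚ.≤-trans (ℕₚ.m≤m+n _ (toℕ (cyc l))) (ℕₚ.≤-reflexive (sym (index l)))) ⟩
      l ℕ.+ n ∎
      where open ℕₚ.≤-Reasoning
    row-< : ∀ {k l} → l / n ℕ.< k / n → l ℕ.< k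
    row-< {k} {l} lt = begin-strict
      l ≡⟨ index l ⟩
      l / n ℕ.* n ℕ.+ toℕ (cyc l) <⟨ ℕₚ.+-monoʳ-< (l / n ℕ.* n) (Finₚ.toℕ<n (cyc l)) ⟩
      l / n ℕ.* n ℕ.+ n ≡⟨ ℕₚ.+-comm (l / n ℕ.* n) n ⟩
      suc (l / n) ℕ.* n ≤⟨ ℕₚ.*-monoˡ-≤ n lt ⟩
      k / n ℕ.* n ≤⟨ ℕₚ.≤-trans (ℕₚ.m≤m+n _ (toℕ (cyc k))) (ℕₚ.≤-reflexive (sym (index k))) ⟩
      k ∎
      where open ℕₚ.≤-Reasoning

    private
      comp : ∀ {A B C : Set} → A ⟺ B → B ⟺ C → A ⟺ C
      comp (f , g) (h , k) = (λ a → h (f a)) , (λ c → g (k c))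

    -- If x has degree at most that of y, then 𝓡 x comes before y or lies in −Π₊; Serre duality applies.
    next-NCk : ∀ {x y k l} → k ℕ.< N₀ → x ≡ ρI k → l ℕ.< N₀ → y ≡ ρI l → k / n ℕ.≤ l / n →
      ∃ λ κ′ → Cls (next x) κ′ × ¬ next x ≡ y × (NCk κ′ (suc l) (next x) y ⟺ Z x y)
    next-NCk {x} {y} {k} {l} k< ex l< ey le = go (proj₂ (Cls⇒Tr (ps k k< ex))) refl
      where
      cy : Cls y (suc l)
      cy = ps l l< ey
      serre : ∀ {x′} → x′ ≡ γ⁻ x → Z y x′ ⟺ Z x y
      serre e = (λ z → Z-serre⁻ (subst (Z y) e z)) , (λ z → subst (Z y) (sym e) (Z-serre z))
      go : ∀ {κ κ′} → Tr x κ κ′ → κ ≡ suc k → ∃ λ κ′ → Cls (next x) κ′ × ¬ next x ≡ y × (NCk κ′ (suc l) (next x) y ⟺ Z x y)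
      go tr@(B i p e q) _ = suc N₀ , Tr⇒Cls tr , Cls-≢ (Tr⇒Cls tr) cy (λ q → ℕₚ.<-irrefl (sym (ℕₚ.suc-injective q)) l<) ,
        comp (only₂ (ℕ.s≤s l<)) ((λ z → Z-negˡ⁻ (subst (λ w → Z w y) q z)) , (λ z → subst (λ w → Z w y) (sym q) (Z-negˡ z)))
      go tr@(C i m e _ q) _ = 0 , Tr⇒Cls tr , Cls-≢ (Tr⇒Cls tr) cy (λ ()) , comp (only₁ (ℕ.s≤s ℕ.z≤n)) (serre q)
      go tr@(D′ k′ n≤k _ _ q) e = suc (k′ ℕ.∸ n) , Tr⇒Cls tr , Cls-≢ (Tr⇒Cls tr) cy (λ e′ → ℕₚ.<-irrefl (ℕₚ.suc-injective e′) lt) , comp (only₁ (ℕ.s≤s lt)) (serre q)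
        where
        lt : k′ ℕ.∸ n ℕ.< l
        lt = ℕₚ.+-cancelʳ-< n (k′ ℕ.∸ n) l (subst (ℕ._< l ℕ.+ n) (sym (trans (ℕₚ.m∸n+n≡m n≤k) (ℕₚ.suc-injective e))) (row-≤ {k} {l} le))
      go (E′ _ _ _ _ _ _ _ _ _) e = ⊥-elim (ℕₚ.<-irrefl (sym (ℕₚ.suc-injective e)) k<)

    private
      Compat⟺ : ∀ {α β x y κ λ′} → α ≈V Φ x → β ≈V Φ y → Cls x κ → Cls y λ′ → ¬ x ≡ y → Compat α β ⟺ NCk κ λ′ x y
      Compat⟺ a b cx cy ne = Compat⇒NCk a b cx cy ne , NCk⇒Compat a b cx cy ne
      rfl : ∀ {x} → Φ x ≈V Φ x
      rfl = St.~Vrefl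
      irr : ∀ {a} → a ℕ.< a → ⊥
      irr = ℕₚ.<-irrefl refl

    -- The larger colour goes first, whatever ≺ says. If d(x) > d(y), then y precedes x and
    -- compatibility is already χ(x, y) = 0. Otherwise 𝓡x is compared with y, and `next-NCk` turns
    -- the result into the same equation.
    MCompat-> : ∀ {x y k l} (c c′ : Fin m) → toℕ c′ ℕ.< toℕ c → k ℕ.< N₀ → x ≡ ρI k → l ℕ.< N₀ → y ≡ ρI l → MCompat (Φ x) c (Φ y) c′ ⟺ Z x y
    MCompat-> {x} {y} {k} {l} c c′ c> k< ex l< ey = to , from
      where
      dx : Deg (Φ x) (suc (k / n))
      dx = Deg-ρ k k< ex rfl
      dy : Deg (Φ y) (suc (l / n))
      dy = Deg-ρ l l< ey rfl
      cx : Cls x (suc k)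
      cx = ps k k< ex
      cy : Cls y (suc l)
      cy = ps l l< ey
      far : l ℕ.< k → Compat (Φ x) (Φ y) ⟺ Z x y
      far lt = comp (Compat⟺ rfl rfl cx cy (Cls-≢ cx cy (λ e → ℕₚ.<-irrefl (sym (ℕₚ.suc-injective e)) lt))) (only₂ (ℕ.s≤s lt))
      near : k / n ℕ.≤ l / n → ∀ {u} → u ≈V Φ (next x) → Compat u (Φ y) ⟺ Z x y
      near le ue = let κ′ , cn , ne , eq = next-NCk k< ex l< ey le in comp (Compat⟺ ue rfl cn cy ne) eq
      to : MCompat (Φ x) c (Φ y) c′ → Z x y
      to (inj₁ (_ , dα , dβ , a , b , le , u , ru , co)) = proj₁ (near (ℕₚ.≤-pred (subst₂ ℕ._≤_ (Deg-uniq a dx) (Deg-uniq b dy) le)) (𝓡Rel⇒ rfl ru)) co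
      to (inj₂ (inj₁ (lt , _))) = ⊥-elim (irr (ℕₚ.<-trans c> lt))
      to (inj₂ (inj₂ (inj₁ (_ , dα , dβ , a , b , lt , co)))) = proj₁ (far (row-< {k} {l} (ℕₚ.≤-pred (subst₂ ℕ._<_ (Deg-uniq b dy) (Deg-uniq a dx) lt)))) co
      to (inj₂ (inj₂ (inj₂ (inj₁ (lt , _))))) = ⊥-elim (irr (ℕₚ.<-trans c> lt))
      to (inj₂ (inj₂ (inj₂ (inj₂ (e , _))))) = ⊥-elim (ℕₚ.<-irrefl (cong toℕ (sym e)) c>)
      from : Z x y → MCompat (Φ x) c (Φ y) c′
      from z = go (ℕₚ.<-≤-connex (l / n) (k / n))
        where
        go : (l / n ℕ.< k / n) ⊎ (k / n ℕ.≤ l / n) → MCompat (Φ x) c (Φ y) c′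
        go (inj₁ lt) = inj₂ (inj₂ (inj₁ (c> , _ , _ , dx , dy , ℕ.s≤s lt , proj₂ (far (row-< {k} {l} lt)) z)))
        go (inj₂ le) = inj₁ (c> , _ , _ , dx , dy , ℕ.s≤s le , Φ (next x) , 𝓡Rel⇐ rfl , proj₂ (near le rfl) z)

    MCompat-< : ∀ {x y k l} (c c′ : Fin m) → toℕ c ℕ.< toℕ c′ → k ℕ.< N₀ → x ≡ ρI k → l ℕ.< N₀ → y ≡ ρI l → MCompat (Φ x) c (Φ y) c′ ⟺ Z y x
    MCompat-< {x} {y} {k} {l} c c′ c< k< ex l< ey = to , from
      where
      dx : Deg (Φ x) (suc (k / n))
      dx = Deg-ρ k k< ex rfl
      dy : Deg (Φ y) (suc (l / n))
      dy = Deg-ρ l l< ey rfl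
      cx : Cls x (suc k)
      cx = ps k k< ex
      cy : Cls y (suc l)
      cy = ps l l< ey
      far : k ℕ.< l → Compat (Φ x) (Φ y) ⟺ Z y x
      far lt = comp (Compat⟺ rfl rfl cx cy (Cls-≢ cx cy (λ e → ℕₚ.<-irrefl (ℕₚ.suc-injective e) lt))) (only₁ (ℕ.s≤s lt))
      near : l / n ℕ.≤ k / n → ∀ {u} → u ≈V Φ (next y) → Compat (Φ x) u ⟺ Z y x
      near le ue = let κ′ , cn , ne , eq = next-NCk l< ey k< ex le in comp (Compat⟺ rfl ue cx cn (λ e → ne (sym e))) (comp ((λ p → NCk-sym p) , (λ p → NCk-sym p)) eq)
      to : MCompat (Φ x) c (Φ y) c′ → Z y x
      to (inj₁ (lt , _)) = ⊥-elim (irr (ℕₚ.<-trans c< lt))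
      to (inj₂ (inj₁ (_ , dα , dβ , a , b , le , u , ru , co))) = proj₁ (near (ℕₚ.≤-pred (subst₂ ℕ._≤_ (Deg-uniq b dy) (Deg-uniq a dx) le)) (𝓡Rel⇒ rfl ru)) co
      to (inj₂ (inj₂ (inj₁ (lt , _)))) = ⊥-elim (irr (ℕₚ.<-trans c< lt))
      to (inj₂ (inj₂ (inj₂ (inj₁ (_ , dα , dβ , a , b , lt , co))))) = proj₁ (far (row-< {l} {k} (ℕₚ.≤-pred (subst₂ ℕ._<_ (Deg-uniq a dx) (Deg-uniq b dy) lt)))) co
      to (inj₂ (inj₂ (inj₂ (inj₂ (e , _))))) = ⊥-elim (ℕₚ.<-irrefl (cong toℕ e) c<)
      from : Z y x → MCompat (Φ x) c (Φ y) c′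
      from z = go (ℕₚ.<-≤-connex (k / n) (l / n))
        where
        go : (k / n ℕ.< l / n) ⊎ (l / n ℕ.≤ k / n) → MCompat (Φ x) c (Φ y) c′
        go (inj₁ lt) = inj₂ (inj₂ (inj₂ (inj₁ (c< , _ , _ , dx , dy , ℕ.s≤s lt , proj₂ (far (row-< {l} {k} lt)) z))))
        go (inj₂ le) = inj₂ (inj₁ (c< , _ , _ , dx , dy , ℕ.s≤s le , Φ (next y) , 𝓡Rel⇐ rfl , proj₂ (near le rfl) z))

    MCompat-≡ : ∀ {α β} (c : Fin m) → MCompat α c β c ⟺ Compat α β
    MCompat-≡ {α} {β} c = to , λ co → inj₂ (inj₂ (inj₂ (inj₂ (refl , co))))
      where
      to : MCompat α c β c → Compat α β
      to (inj₁ (lt , _)) = ⊥-elim (irr lt)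
      to (inj₂ (inj₁ (lt , _))) = ⊥-elim (irr lt)
      to (inj₂ (inj₂ (inj₁ (lt , _)))) = ⊥-elim (irr lt)
      to (inj₂ (inj₂ (inj₂ (inj₁ (lt , _))))) = ⊥-elim (irr lt)
      to (inj₂ (inj₂ (inj₂ (inj₂ (_ , co))))) = co

    -- A negative simple root has degree 0 and the least colour.
    MCompat-pos-neg : ∀ {x y k} (c c′ : Fin m) → toℕ c′ ≡ 0 → k ℕ.< N₀ → x ≡ ρI k → NegSimpI y → MCompat (Φ x) c (Φ y) c′ ⟺ Compat (Φ x) (Φ y)
    MCompat-pos-neg {x} {y} {k} c c′ c0 k< ex ny = to , from
      where
      dx : Deg (Φ x) (suc (k / n))
      dx = Deg-ρ k k< ex rfl
      dy : Deg (Φ y) 0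
      dy = Deg-neg rfl ny
      to : MCompat (Φ x) c (Φ y) c′ → Compat (Φ x) (Φ y)
      to (inj₁ (_ , dα , dβ , a , b , le , _)) = ⊥-elim (ℕₚ.n≮0 (subst₂ ℕ._≤_ (Deg-uniq a dx) (Deg-uniq b dy) le))
      to (inj₂ (inj₁ (lt , _))) = ⊥-elim (ℕₚ.n≮0 (subst (toℕ c ℕ.<_) c0 lt))
      to (inj₂ (inj₂ (inj₁ (_ , _ , _ , _ , _ , _ , co)))) = co
      to (inj₂ (inj₂ (inj₂ (inj₁ (lt , _))))) = ⊥-elim (ℕₚ.n≮0 (subst (toℕ c ℕ.<_) c0 lt))
      to (inj₂ (inj₂ (inj₂ (inj₂ (_ , co))))) = co
      from : Compat (Φ x) (Φ y) → MCompat (Φ x) c (Φ y) c′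
      from co = go (ℕₚ.m≤n⇒m<n∨m≡n (subst (ℕ._≤ toℕ c) (sym c0) ℕ.z≤n))
        where
        go : (toℕ c′ ℕ.< toℕ c) ⊎ (toℕ c′ ≡ toℕ c) → MCompat (Φ x) c (Φ y) c′
        go (inj₁ lt) = inj₂ (inj₂ (inj₁ (lt , _ , _ , dx , dy , ℕ.s≤s ℕ.z≤n , co)))
        go (inj₂ e) = inj₂ (inj₂ (inj₂ (inj₂ (Finₚ.toℕ-injective (sym e) , co))))

    MCompat-neg-pos : ∀ {x y k} (c c′ : Fin m) → toℕ c′ ≡ 0 → k ℕ.< N₀ → x ≡ ρI k → NegSimpI y → MCompat (Φ y) c′ (Φ x) c ⟺ Compat (Φ y) (Φ x)
    MCompat-neg-pos {x} {y} {k} c c′ c0 k< ex ny = to , from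
      where
      dx : Deg (Φ x) (suc (k / n))
      dx = Deg-ρ k k< ex rfl
      dy : Deg (Φ y) 0
      dy = Deg-neg rfl ny
      to : MCompat (Φ y) c′ (Φ x) c → Compat (Φ y) (Φ x)
      to (inj₂ (inj₁ (_ , dα , dβ , a , b , le , _))) = ⊥-elim (ℕₚ.n≮0 (subst₂ ℕ._≤_ (Deg-uniq b dx) (Deg-uniq a dy) le))
      to (inj₁ (lt , _)) = ⊥-elim (ℕₚ.n≮0 (subst (toℕ c ℕ.<_) c0 lt))
      to (inj₂ (inj₂ (inj₁ (lt , _)))) = ⊥-elim (ℕₚ.n≮0 (subst (toℕ c ℕ.<_) c0 lt))
      to (inj₂ (inj₂ (inj₂ (inj₁ (_ , _ , _ , _ , _ , _ , co))))) = co
      to (inj₂ (inj₂ (inj₂ (inj₂ (_ , co))))) = co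
      from : Compat (Φ y) (Φ x) → MCompat (Φ y) c′ (Φ x) c
      from co = go (ℕₚ.m≤n⇒m<n∨m≡n (subst (ℕ._≤ toℕ c) (sym c0) ℕ.z≤n))
        where
        go : (toℕ c′ ℕ.< toℕ c) ⊎ (toℕ c′ ≡ toℕ c) → MCompat (Φ y) c′ (Φ x) c
        go (inj₁ lt) = inj₂ (inj₂ (inj₂ (inj₁ (lt , _ , _ , dy , dx , ℕ.s≤s ℕ.z≤n , co))))
        go (inj₂ e) = inj₂ (inj₂ (inj₂ (inj₂ (Finₚ.toℕ-injective e , co))))

-- The tuple of words: block conditions, faces and rank.

module Assembly (F : OrderedField) (n : ℕ) (D : BipRootSystem F n) where
  open Main F n D public
  open WithRS F n D using (InNegΠ₊; InNegΠ₋)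

  module WithTuple (m′ : ℕ) (σs : Colored.CSubset (suc m′)) (inΦ : Colored.InΦm (suc m′) σs) (wP wM : Word) (wc : Fin (suc m′) → Word)
      (hP : IsWτ (Colored.plusPart (suc m′) σs) wP) (hM : IsWτ (Colored.minusPart (suc m′) σs) wM)
      (hC : ∀ k → IsWτ (Colored.colorPart (suc m′) σs k) (wc k)) where
    m = suc m′
    open Colored m
    open ColoredNC m
    open Pair m

    T′ : Fin m → Word
    T′ = tuple wP wM wc

    private
      ≡ᵇ-true : ∀ a b → (a ℕ.≡ᵇ b) ≡ true → a ≡ b
      ≡ᵇ-true a b e = ℕₚ.≡ᵇ⇒≡ a b (Equivalence.from T-≡ e)
      ≡ᵇ-refl : ∀ a → (a ℕ.≡ᵇ a) ≡ true
      ≡ᵇ-refl a = Equivalence.to T-≡ (ℕₚ.≡⇒≡ᵇ a a refl)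
      ∈-if : ∀ b {w : Word} {a} → a ∈ (if b then w else []) → b ≡ true × a ∈ w
      ∈-if true h = refl , h
      ∈-if false ()
      AllPairs-if : ∀ b {w : Word} → AllPairs Z w → AllPairs Z (if b then w else [])
      AllPairs-if true h = h
      AllPairs-if false h = []
      opp-< : ∀ {p q : Fin m} → toℕ p ℕ.< toℕ q → toℕ (Fin.opposite q) ℕ.< toℕ (Fin.opposite p)
      opp-< {p} {q} lt = subst₂ ℕ._<_ (sym (Finₚ.opposite-prop q)) (sym (Finₚ.opposite-prop p)) (ℕₚ.∸-monoʳ-< (ℕ.s≤s lt) (Finₚ.toℕ<n q))
      bP : Fin m → Bool
      bP p = toℕ p ℕ.≡ᵇ 0
      bM : Fin m → Bool
      bM p = suc (toℕ p) ℕ.≡ᵇ m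
      bM-last : bM (Fin.fromℕ m′) ≡ true
      bM-last = trans (cong (ℕ._≡ᵇ m′) (Finₚ.toℕ-fromℕ m′)) (≡ᵇ-refl m′)

      data Part (a : Fin M) (p : Fin m) : Set where
        inP : toℕ p ≡ 0 → a ∈ wP → Part a p
        inC : a ∈ wc (Fin.opposite p) → Part a p
        inM : suc (toℕ p) ≡ m → a ∈ wM → Part a p
      part : ∀ {a} p → a ∈ T′ p → Part a p
      part {a} p h = [ (λ h → let e , h′ = ∈-if (bP p) h in inP (≡ᵇ-true _ _ e) h′) ,
          (λ h → [ inC , (λ h → let e , h′ = ∈-if (bM p) h in inM (≡ᵇ-true _ _ e) h′) ]′ (∈ₚ.∈-++⁻ (wc (Fin.opposite p)) h)) ]′ (∈ₚ.∈-++⁻ (if bP p then wP else []) h)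
      ∈-C : ∀ {a} k → a ∈ wc k → a ∈ T′ (Fin.opposite k)
      ∈-C {a} k h = ∈ₚ.∈-++⁺ʳ (if bP (Fin.opposite k) then wP else []) (∈ₚ.∈-++⁺ˡ (subst (λ l → a ∈ wc l) (sym (Finₚ.opposite-involutive k)) h))
      ∈-M : ∀ {a} → a ∈ wM → a ∈ T′ (Fin.fromℕ m′)
      ∈-M {a} h = ∈ₚ.∈-++⁺ʳ (if bP (Fin.fromℕ m′) then wP else []) (∈ₚ.∈-++⁺ʳ (wc (Fin.opposite (Fin.fromℕ m′))) (subst (λ b → a ∈ (if b then wM else [])) (sym bM-last) h))

    -- `AllPairs Z` for the concatenated tuple, sorted by block: w_{σ₊}, then the colours in
    -- decreasing order, then w_{σ₋}.
    record Pairwise : Set where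
      field
        PP : AllPairs Z wP
        PC : ∀ {a b} k → a ∈ wP → b ∈ wc k → Z a b
        PM : ∀ {a b} → a ∈ wP → b ∈ wM → Z a b
        CC : ∀ k → AllPairs Z (wc k)
        CC′ : ∀ {a b} k l → toℕ l ℕ.< toℕ k → a ∈ wc k → b ∈ wc l → Z a b
        CM : ∀ {a b} k → a ∈ wc k → b ∈ wM → Z a b
        MM : AllPairs Z wM
    open Pairwise

    Pairwise⇒ : Pairwise → AllPairs Z (prodW T′)
    Pairwise⇒ h = prodW-AllPairs T′ inner cross
      where
      inner : ∀ p → AllPairs Z (T′ p)
      inner p = AllPairsₚ.++⁺ (AllPairs-if (bP p) (PP h)) (AllPairsₚ.++⁺ (CC h (Fin.opposite p)) (AllPairs-if (bM p) (MM h))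
          (All.tabulate λ a∈ → All.tabulate λ b∈ → CM h (Fin.opposite p) a∈ (proj₂ (∈-if (bM p) b∈))))
        (All.tabulate λ a∈ → All.tabulate λ b∈ → [ PC h (Fin.opposite p) (proj₂ (∈-if (bP p) a∈)) , (λ b∈ → PM h (proj₂ (∈-if (bP p) a∈)) (proj₂ (∈-if (bM p) b∈))) ]′ (∈ₚ.∈-++⁻ (wc (Fin.opposite p)) b∈))
      cross : ∀ p q → toℕ p ℕ.< toℕ q → ∀ {a b} → a ∈ T′ p → b ∈ T′ q → Z a b
      cross p q lt {a} {b} a∈ b∈ = go (part p a∈) (part q b∈)
        where
        go : Part a p → Part b q → Z a b
        go _ (inP e _) = ⊥-elim (ℕₚ.n≮0 (subst (toℕ p ℕ.<_) e lt))
        go (inM e _) _ = ⊥-elim (ℕₚ.<-irrefl refl (ℕₚ.<-≤-trans (Finₚ.toℕ<n q) (subst (ℕ._≤ toℕ q) e lt)))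
        go (inP _ a∈) (inC b∈) = PC h (Fin.opposite q) a∈ b∈
        go (inP _ a∈) (inM _ b∈) = PM h a∈ b∈
        go (inC a∈) (inC b∈) = CC′ h (Fin.opposite p) (Fin.opposite q) (opp-< {p} {q} lt) a∈ b∈
        go (inC a∈) (inM _ b∈) = CM h (Fin.opposite p) a∈ b∈

    module _ (ex : AllPairs Z (prodW T′)) where
      private
        inner = prodW-inner T′ ex
        cross = prodW-cross T′ ex
      pairs-CC : ∀ k → AllPairs Z (wc k)
      pairs-CC k = subst (λ l → AllPairs Z (wc l)) (Finₚ.opposite-involutive k) (proj₁ (AllPairs-++⁻ (wc (Fin.opposite (Fin.opposite k)))
        (proj₁ (proj₂ (AllPairs-++⁻ (if bP (Fin.opposite k) then wP else []) (inner (Fin.opposite k)))))))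
      pairs-CC′ : ∀ {a b} k l → toℕ l ℕ.< toℕ k → a ∈ wc k → b ∈ wc l → Z a b
      pairs-CC′ k l lt a∈ b∈ = cross (Fin.opposite k) (Fin.opposite l) (opp-< {l} {k} lt) (∈-C k a∈) (∈-C l b∈)
      pairs-PC : ∀ {a b} k → a ∈ wP → b ∈ wc k → Z a b
      pairs-PC {a} {b} k a∈ b∈ = go (Fin.opposite k) refl
        where
        go : ∀ q → Fin.opposite k ≡ q → Z a b
        go zero e = All.lookup (All.lookup (proj₂ (proj₂ (AllPairs-++⁻ wP (inner zero)))) a∈) (∈ₚ.∈-++⁺ˡ (subst (λ l → b ∈ wc l) (trans (sym (Finₚ.opposite-involutive k)) (cong Fin.opposite e)) b∈))
        go (suc q) e = cross zero (suc q) (ℕ.s≤s ℕ.z≤n) (∈ₚ.∈-++⁺ˡ a∈) (subst (λ q → b ∈ T′ q) e (∈-C k b∈))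
      pairs-CM : ∀ {a b} k → a ∈ wc k → b ∈ wM → Z a b
      pairs-CM {a} {b} k a∈ b∈ = go (ℕₚ.m≤n⇒m<n∨m≡n (subst (toℕ p ℕ.≤_) (sym (Finₚ.toℕ-fromℕ m′)) (ℕₚ.≤-pred (Finₚ.toℕ<n p))))
        where
        p = Fin.opposite k
        go : (toℕ p ℕ.< toℕ (Fin.fromℕ m′)) ⊎ (toℕ p ≡ toℕ (Fin.fromℕ m′)) → Z a b
        go (inj₁ lt) = cross p (Fin.fromℕ m′) lt (∈-C k a∈) (∈-M b∈)
        go (inj₂ e) = All.lookup (All.lookup (proj₂ (proj₂ (AllPairs-++⁻ (wc (Fin.opposite p)) (proj₁ (proj₂ (AllPairs-++⁻ (if bP p then wP else []) (inner p)))))))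
            (subst (λ l → a ∈ wc l) (sym (Finₚ.opposite-involutive k)) a∈)) (subst (λ c → b ∈ (if c then wM else [])) (sym (trans (cong bM (Finₚ.toℕ-injective e)) bM-last)) b∈)

    private
      plus∈ : ∀ {j} → j ∈ wP → ∃ λ k → σs j k ≡ true × (∃ λ i → Plus i × j ≡ neg (simp i))
      plus∈ {j} h = let (k , e) , i , p , q = proj₂ (proj₂ hP j) h in k , e , i , p , Φ-inj _ _ (St.~Vtrans q (St.~Vsym (Φ-neg (simp i))))
      minus∈ : ∀ {j} → j ∈ wM → ∃ λ k → σs j k ≡ true × (∃ λ i → Minus i × j ≡ neg (simp i))
      minus∈ {j} h = let (k , e) , i , p , q = proj₂ (proj₂ hM j) h in k , e , i , p , Φ-inj _ _ (St.~Vtrans q (St.~Vsym (Φ-neg (simp i))))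
      colour∈ : ∀ {j} k → j ∈ wc k → σs j k ≡ true × (∃ λ l → l ℕ.< N₀ × j ≡ ρI l)
      colour∈ {j} k h = let e , p = proj₂ (proj₂ (hC k) j) h in e , ρ-onto j (IsPos⇒Pos j p)
      ∈plus : ∀ {j i} k → σs j k ≡ true → Plus i → j ≡ neg (simp i) → j ∈ wP
      ∈plus {j} {i} k e p q = proj₁ (proj₂ hP j) ((k , e) , i , p , St.~Vtrans (λ l → R₀.reflexive (cong (λ x → Φ x l) q)) (Φ-neg (simp i)))
      ∈minus : ∀ {j i} k → σs j k ≡ true → Minus i → j ≡ neg (simp i) → j ∈ wM
      ∈minus {j} {i} k e p q = proj₁ (proj₂ hM j) ((k , e) , i , p , St.~Vtrans (λ l → R₀.reflexive (cong (λ x → Φ x l) q)) (Φ-neg (simp i)))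
      ∈colour : ∀ {j} k → σs j k ≡ true → Pos j → j ∈ wc k
      ∈colour {j} k e p = proj₁ (proj₂ (hC k) j) (e , Pos-IsPos j p)
      neg-colour : ∀ {j i} k → σs j k ≡ true → j ≡ neg (simp i) → toℕ k ≡ 0
      neg-colour {j} {i} k e q = [ (λ p → ⊥-elim (Pos-Neg (IsPos⇒Pos j p) (Neg-neg-simp i q))) , proj₂ ]′ (inΦ j k e)
      order : ∀ {τ w} → IsWτ τ w → AllPairs (λ a b → ¬ a ≡ b × (∀ {κ λ′} → Cls b κ → Cls a λ′ → κ ℕ.≤ λ′)) w
      order h = AllPairs-map∈ (λ _ _ R → let ne , le = ≺-key R in (λ e → ne (sym e)) , le) (proj₁ h)
      distinct : ∀ {τ w} → IsWτ τ w → AllPairs (λ a b → ¬ a ≡ b) w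
      distinct h = AllPairs-map∈ (λ _ _ → proj₁) (order h)
      rfl : ∀ {x} → Φ x ≈V Φ x
      rfl = St.~Vrefl

    Face⇒Pairwise : Face σs → Pairwise
    Face⇒Pairwise face = record
      -- Two distinct negative simple roots are always compatible, so `PP`, `MM` and `PM` come from
      -- `base`.
      { PP = AllPairs-map∈ (λ {a} {b} a∈ b∈ (ne , le) → let _ , _ , i , p , e = plus∈ a∈ ; _ , _ , i′ , p′ , e′ = plus∈ b∈ in
            proj₂ (base i e (n⁺ i p e) (n⁺ i′ p′ e′) ne (inj₁ (Neg-neg-simp i′ e′))) ℕₚ.≤-refl) (order hP)
      ; MM = AllPairs-map∈ (λ {a} {b} a∈ b∈ (ne , le) → let _ , _ , i , p , e = minus∈ a∈ ; _ , _ , i′ , p′ , e′ = minus∈ b∈ in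
            proj₂ (base i e (n⁻ i p e) (n⁻ i′ p′ e′) ne (inj₁ (Neg-neg-simp i′ e′))) ℕₚ.≤-refl) (order hM)
      ; PM = λ {a} {b} a∈ b∈ → let _ , _ , i , p , e = plus∈ a∈ ; _ , _ , i′ , p′ , e′ = minus∈ b∈ in
            proj₂ (base i e (n⁺ i p e) (n⁻ i′ p′ e′) (Cls-≢ (n⁺ i p e) (n⁻ i′ p′ e′) λ ()) (inj₁ (Neg-neg-simp i′ e′))) ℕ.z≤n
      ; PC = λ {a} {b} k a∈ b∈ → let c , s₁ , i , p , e = plus∈ a∈ ; s₂ , l , l< , e′ = colour∈ k b∈
                                     ca = n⁺ i p e ; cb = ps l l< e′
                                     ne = Cls-≢ ca cb (λ q → ℕₚ.<-irrefl (sym (ℕₚ.suc-injective q)) l<) in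
            proj₂ (Compat⇒NCk rfl rfl ca cb ne (proj₁ (MCompat-neg-pos k c (neg-colour c s₁ e) l< e′ (i , e)) (face a c b k s₁ s₂ (λ q → ne (proj₁ q))))) (ℕ.s≤s (ℕₚ.<⇒≤ l<))
      ; CM = λ {a} {b} k a∈ b∈ → let s₁ , l , l< , e = colour∈ k a∈ ; c , s₂ , i , p , e′ = minus∈ b∈
                                     ca = ps l l< e ; cb = n⁻ i p e′
                                     ne = Cls-≢ ca cb (λ ()) in
            proj₂ (Compat⇒NCk rfl rfl ca cb ne (proj₁ (MCompat-pos-neg k c (neg-colour c s₂ e′) l< e (i , e′)) (face a k b c s₁ s₂ (λ q → ne (proj₁ q))))) ℕ.z≤n
      ; CC = λ k → AllPairs-map∈ (λ {a} {b} a∈ b∈ (ne , le) → let s₁ , l , l< , e = colour∈ k a∈ ; s₂ , l′ , l′< , e′ = colour∈ k b∈ in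
            proj₂ (Compat⇒NCk rfl rfl (ps l l< e) (ps l′ l′< e′) ne (proj₁ (MCompat-≡ k) (face a k b k s₁ s₂ (λ q → ne (proj₁ q))))) (le (ps l′ l′< e′) (ps l l< e))) (order (hC k))
      ; CC′ = λ {a} {b} k k′ lt a∈ b∈ → let s₁ , l , l< , e = colour∈ k a∈ ; s₂ , l′ , l′< , e′ = colour∈ k′ b∈ in
            proj₁ (MCompat-> k k′ lt l< e l′< e′) (face a k b k′ s₁ s₂ (λ q → ℕₚ.<-irrefl (cong toℕ (sym (proj₂ q))) lt)) }

    module _ (ex : AllPairs Z (prodW T′)) where
      private
        data Kind (j : Fin M) (k : Fin m) : Set where
          plain : ∀ l → l ℕ.< N₀ → j ≡ ρI l → j ∈ wc k → Kind j k
          neg⁺ : ∀ i → Plus i → j ≡ neg (simp i) → toℕ k ≡ 0 → j ∈ wP → Kind j k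
          neg⁻ : ∀ i → Minus i → j ≡ neg (simp i) → toℕ k ≡ 0 → j ∈ wM → Kind j k
        kind : ∀ j k → σs j k ≡ true → Kind j k
        kind j k e = go (inΦ j k e)
          where
          go : ValidCol j k → Kind j k
          go (inj₁ p) = let q = IsPos⇒Pos j p ; l , l< , e′ = ρ-onto j q in plain l l< e′ (∈colour k e q)
          go (inj₂ (ns , k0)) = let i , q = NegSimple⇒ rfl ns in [ (λ p → neg⁺ i p q k0 (∈plus k e p q)) , (λ m → neg⁻ i m q k0 (∈minus k e m q)) ]′ (ℕₚ.<-≤-connex (toℕ i) r)
        both-neg : ∀ {j k j′ k′ κ λ′} i → j ≡ neg (simp i) → toℕ k ≡ 0 → Cls j κ → Neg j′ → toℕ k′ ≡ 0 → Cls j′ λ′ → ¬ (j ≡ j′ × k ≡ k′) → MCompat (Φ j) k (Φ j′) k′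
        both-neg {j} {k} {j′} {k′} i e k0 cj nj′ k0′ cj′ ne = subst (λ c → MCompat (Φ j) k (Φ j′) c) k≡ (proj₂ (MCompat-≡ k) (NCk⇒Compat rfl rfl cj cj′ j≢ (base i e cj cj′ j≢ (inj₁ nj′))))
          where
          k≡ : k ≡ k′
          k≡ = Finₚ.toℕ-injective (trans k0 (sym k0′))
          j≢ : ¬ j ≡ j′
          j≢ q = ne (q , k≡)
        -- The word lists the roots of one colour in ≺-decreasing order, so whichever root stands
        -- first has the larger key; distinct positive roots have distinct keys, and the other half
        -- of `NCk` is void.
        same-colour : ∀ {x y} k l l′ → l ℕ.< N₀ → x ≡ ρI l → l′ ℕ.< N₀ → y ≡ ρI l′ → x ∈ wc k → y ∈ wc k → ¬ x ≡ y → NCk (suc l) (suc l′) x y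
        same-colour {x} {y} k l l′ l< e l′< e′ x∈ y∈ ne = go (AllPairs-choose both x∈ y∈ ne)
          where
          Before = λ a b → Z a b × (∀ {κ λ′} → Cls b κ → Cls a λ′ → κ ℕ.≤ λ′)
          both : AllPairs Before (wc k)
          both = AllPairs.zipWith {R = Z} {S = λ a b → ¬ a ≡ b × (∀ {κ λ′} → Cls b κ → Cls a λ′ → κ ℕ.≤ λ′)} {T = Before} (λ {x} {y} (z , o) → z , (λ {κ} {λ′} → proj₂ o {κ} {λ′})) (pairs-CC ex k , order (hC k))
          cx = ps l l< e
          cy = ps l′ l′< e′
          keys≢ : ¬ suc l ≡ suc l′
          keys≢ q = ne (trans e (trans (cong ρI (ℕₚ.suc-injective q)) (sym e′)))
          go : Before x y ⊎ Before y x → NCk (suc l) (suc l′) x y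
          go (inj₁ (z , le)) = (λ h → ⊥-elim (keys≢ (ℕₚ.≤-antisym h (le cy cx)))) , (λ _ → z)
          go (inj₂ (z , le)) = (λ _ → z) , (λ h → ⊥-elim (keys≢ (ℕₚ.≤-antisym (le cx cy) h)))

      pairs⇒Face : Face σs
      pairs⇒Face j k j′ k′ s₁ s₂ ne = go (kind j k s₁) (kind j′ k′ s₂)
        where
        go : Kind j k → Kind j′ k′ → MCompat (Φ j) k (Φ j′) k′
        go (neg⁺ i p e k0 _) (neg⁺ i′ p′ e′ k0′ _) = both-neg i e k0 (n⁺ i p e) (Neg-neg-simp i′ e′) k0′ (n⁺ i′ p′ e′) ne
        go (neg⁺ i p e k0 _) (neg⁻ i′ p′ e′ k0′ _) = both-neg i e k0 (n⁺ i p e) (Neg-neg-simp i′ e′) k0′ (n⁻ i′ p′ e′) ne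
        go (neg⁻ i p e k0 _) (neg⁺ i′ p′ e′ k0′ _) = both-neg i e k0 (n⁻ i p e) (Neg-neg-simp i′ e′) k0′ (n⁺ i′ p′ e′) ne
        go (neg⁻ i p e k0 _) (neg⁻ i′ p′ e′ k0′ _) = both-neg i e k0 (n⁻ i p e) (Neg-neg-simp i′ e′) k0′ (n⁻ i′ p′ e′) ne
        go (plain l l< e x∈) (neg⁺ i p e′ k0 y∈) = proj₂ (MCompat-pos-neg k k′ k0 l< e (i , e′)) (NCk⇒Compat rfl rfl (ps l l< e) (n⁺ i p e′) (Cls-≢ (ps l l< e) (n⁺ i p e′) (λ q → ℕₚ.<-irrefl (ℕₚ.suc-injective q) l<))
          ((λ _ → pairs-PC ex k y∈ x∈) , (λ le → ⊥-elim (ℕₚ.<-irrefl refl (ℕₚ.<-≤-trans l< (ℕₚ.≤-pred le))))))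
        go (plain l l< e x∈) (neg⁻ i p e′ k0 y∈) = proj₂ (MCompat-pos-neg k k′ k0 l< e (i , e′)) (NCk⇒Compat rfl rfl (ps l l< e) (n⁻ i p e′) (Cls-≢ (ps l l< e) (n⁻ i p e′) (λ ()))
          ((λ ()) , (λ _ → pairs-CM ex k x∈ y∈)))
        go (neg⁺ i p e k0 x∈) (plain l l< e′ y∈) = proj₂ (MCompat-neg-pos k′ k k0 l< e′ (i , e)) (NCk⇒Compat rfl rfl (n⁺ i p e) (ps l l< e′) (Cls-≢ (n⁺ i p e) (ps l l< e′) (λ q → ℕₚ.<-irrefl (sym (ℕₚ.suc-injective q)) l<))
          ((λ le → ⊥-elim (ℕₚ.<-irrefl refl (ℕₚ.<-≤-trans l< (ℕₚ.≤-pred le)))) , (λ _ → pairs-PC ex k′ x∈ y∈)))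
        go (neg⁻ i p e k0 x∈) (plain l l< e′ y∈) = proj₂ (MCompat-neg-pos k′ k k0 l< e′ (i , e)) (NCk⇒Compat rfl rfl (n⁻ i p e) (ps l l< e′) (Cls-≢ (n⁻ i p e) (ps l l< e′) (λ ()))
          ((λ _ → pairs-CM ex k′ y∈ x∈) , (λ ())))
        go (plain l l< e x∈) (plain l′ l′< e′ y∈) = tri (ℕₚ.<-cmp (toℕ k) (toℕ k′))
          where
          tri : Tri (toℕ k ℕ.< toℕ k′) (toℕ k ≡ toℕ k′) (toℕ k′ ℕ.< toℕ k) → MCompat (Φ j) k (Φ j′) k′
          tri (tri< lt _ _) = proj₂ (MCompat-< k k′ lt l< e l′< e′) (pairs-CC′ ex k′ k lt y∈ x∈)
          tri (tri> _ _ gt) = proj₂ (MCompat-> k k′ gt l< e l′< e′) (pairs-CC′ ex k k′ gt x∈ y∈)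
          tri (tri≈ _ q _) = subst (λ c → MCompat (Φ j) k (Φ j′) c) k≡ (proj₂ (MCompat-≡ k) (NCk⇒Compat rfl rfl (ps l l< e) (ps l′ l′< e′) j≢
              (same-colour k l l′ l< e l′< e′ x∈ (subst (λ c → j′ ∈ wc c) (sym k≡) y∈) j≢)))
            where
            k≡ : k ≡ k′
            k≡ = Finₚ.toℕ-injective q
            j≢ : ¬ j ≡ j′
            j≢ z = ne (z , k≡)

    private
      bit : Bool → ℕ
      bit b = if b then 1 else 0
      S-cong : ∀ {t} {f g : Fin t → ℕ} → (∀ i → f i ≡ g i) → sumℕ f ≡ sumℕ g
      S-cong {zero} e = refl
      S-cong {suc t} e = cong₂ ℕ._+_ (e zero) (S-cong (e ∘ suc))
      S-+ : ∀ {t} (f g : Fin t → ℕ) → sumℕ (λ i → f i ℕ.+ g i) ≡ sumℕ f ℕ.+ sumℕ g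
      S-+ {zero} f g = refl
      S-+ {suc t} f g = trans (cong (f zero ℕ.+ g zero ℕ.+_) (S-+ (f ∘ suc) (g ∘ suc))) (exch (f zero) (g zero) (sumℕ (f ∘ suc)) (sumℕ (g ∘ suc)))
        where
        open import Data.Nat.Solver using (module +-*-Solver)
        open +-*-Solver using () renaming (solve to solveℕ; _:+_ to _⊕_; _:=_ to _⊜_)
        exch : ∀ a b c d → a ℕ.+ b ℕ.+ (c ℕ.+ d) ≡ a ℕ.+ c ℕ.+ (b ℕ.+ d)
        exch = solveℕ 4 (λ a b c d → a ⊕ b ⊕ (c ⊕ d) ⊜ a ⊕ c ⊕ (b ⊕ d)) refl
      S-0 : ∀ {t} {f : Fin t → ℕ} → (∀ i → f i ≡ 0) → sumℕ f ≡ 0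
      S-0 {zero} e = refl
      S-0 {suc t} e = cong₂ ℕ._+_ (e zero) (S-0 (e ∘ suc))
      S-swap : ∀ {s t} (f : Fin s → Fin t → ℕ) → sumℕ (λ i → sumℕ (f i)) ≡ sumℕ (λ j → sumℕ (λ i → f i j))
      S-swap {zero} {t} f = sym (S-0 {t} (λ _ → refl))
      S-swap {suc s} f = trans (cong (sumℕ (f zero) ℕ.+_) (S-swap (f ∘ suc))) (sym (S-+ (f zero) (λ j → sumℕ (λ i → f (suc i) j))))
      S-snoc : ∀ t (f : Fin (suc t) → ℕ) → sumℕ f ≡ sumℕ (f ∘ Fin.inject₁) ℕ.+ f (Fin.fromℕ t)
      S-snoc zero f = ℕₚ.+-comm (f zero) 0
      S-snoc (suc t) f = trans (cong (f zero ℕ.+_) (S-snoc t (f ∘ suc))) (sym (ℕₚ.+-assoc (f zero) _ _))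
      S-opposite : ∀ t (f : Fin t → ℕ) → sumℕ (f ∘ Fin.opposite) ≡ sumℕ f
      S-opposite zero f = refl
      S-opposite (suc t) f = trans (cong (f (Fin.fromℕ t) ℕ.+_) (S-opposite t (f ∘ Fin.inject₁))) (trans (ℕₚ.+-comm (f (Fin.fromℕ t)) _) (sym (S-snoc t f)))
      S-count : ∀ {t} (f : Fin t → Bool) → count f ≡ sumℕ (λ i → bit (f i))
      S-count {zero} f = refl
      S-count {suc t} f = cong (bit (f zero) ℕ.+_) (S-count (f ∘ suc))

      used? : ∀ j → Dec (∃ λ k → σs j k ≡ true)
      used? j = Finₚ.any? (λ k → σs j k Bool.≟ true)
      plus? : ∀ j → Dec ((∃ λ k → σs j k ≡ true) × (∃ λ i → Plus i × j ≡ neg (simp i)))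
      plus? j = used? j ×-dec Finₚ.any? (λ i → Plus? i ×-dec (j Finₚ.≟ neg (simp i)))
      minus? : ∀ j → Dec ((∃ λ k → σs j k ≡ true) × (∃ λ i → Minus i × j ≡ neg (simp i)))
      minus? j = used? j ×-dec Finₚ.any? (λ i → (r ℕₚ.≤? toℕ i) ×-dec (j Finₚ.≟ neg (simp i)))
      fP fM : Fin M → Bool
      fP j = does (plus? j)
      fM j = does (minus? j)
      fC : Fin m → Fin M → Bool
      fC k j = σs j k ∧ pos j

      length-P : length wP ≡ sumℕ (λ j → bit (fP j))
      length-P = trans (length-count wP (distinct hP) fP (λ j e → let (k , e′) , i , p , q = does-true (plus? j) e in ∈plus k e′ p q)
        (λ j h → let k , e , c = plus∈ h in dec-true (plus? j) ((k , e) , c))) (S-count fP)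
      length-M : length wM ≡ sumℕ (λ j → bit (fM j))
      length-M = trans (length-count wM (distinct hM) fM (λ j e → let (k , e′) , i , p , q = does-true (minus? j) e in ∈minus k e′ p q)
        (λ j h → let k , e , c = minus∈ h in dec-true (minus? j) ((k , e) , c))) (S-count fM)
      length-C : ∀ k → length (wc k) ≡ sumℕ (λ j → bit (fC k j))
      length-C k = trans (length-count (wc k) (distinct (hC k)) (fC k) (λ j e → ∈colour k (∧-conicalˡ (σs j k) _ e) (∧-conicalʳ (σs j k) _ e))
        (λ j h → let e , l , l< , q = colour∈ k h in cong₂ _∧_ e (Pos-ρ′ l l< q))) (S-count (fC k))

      -- A positive root contributes once for each of its colours, whereas a negative simple root
      -- has only colour 1 and lies in exactly one of σ₊, σ₋.
      column : ∀ j → sumℕ (λ k → bit (σs j k)) ≡ bit (fP j) ℕ.+ (sumℕ (λ k → bit (fC k j)) ℕ.+ bit (fM j))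
      column j = go (Pos⊎Neg j)
        where
        Goal = sumℕ (λ k → bit (σs j k)) ≡ bit (fP j) ℕ.+ (sumℕ (λ k → bit (fC k j)) ℕ.+ bit (fM j))
        go : Pos j ⊎ Neg j → Goal
        go (inj₁ p) = sym (trans (cong₂ (λ a b → bit a ℕ.+ (sumℕ (λ k → bit (fC k j)) ℕ.+ bit b))
            (dec-false (plus? j) (λ (_ , i , _ , q) → Pos-Neg p (Neg-neg-simp i q))) (dec-false (minus? j) (λ (_ , i , _ , q) → Pos-Neg p (Neg-neg-simp i q))))
          (trans (ℕₚ.+-identityʳ _) (S-cong (λ k → cong bit (trans (cong (σs j k ∧_) p) (∧-identityʳ (σs j k)))))))
        go (inj₂ ng) = trans (neg-sum (used? j)) (cong (λ x → bit (fP j) ℕ.+ (x ℕ.+ bit (fM j))) (sym (S-0 {m} (λ k → cong bit (trans (cong (σs j k ∧_) ng) (∧-zeroʳ (σs j k)))))))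
          where
          neg-sum : Dec (∃ λ k → σs j k ≡ true) → sumℕ (λ k → bit (σs j k)) ≡ bit (fP j) ℕ.+ bit (fM j)
          neg-sum (no none) = trans (S-0 {m} (λ k → cong bit (¬-not (λ e → none (k , e))))) (sym (cong₂ (λ a b → bit a ℕ.+ bit b) (dec-false (plus? j) (none ∘ proj₁)) (dec-false (minus? j) (none ∘ proj₁))))
          neg-sum (yes (k , e)) = trans one (sym (by-colour (ℕₚ.<-≤-connex (toℕ i) r)))
            where
            ns : NegSimpI j
            ns = [ (λ p → ⊥-elim (Pos-Neg (IsPos⇒Pos j p) ng)) , (λ h → NegSimple⇒ rfl (proj₁ h)) ]′ (inΦ j k e)
            i = proj₁ ns
            q = proj₂ ns
            k≡0 : k ≡ zero
            k≡0 = Finₚ.toℕ-injective (neg-colour k e q)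
            one : sumℕ (λ k → bit (σs j k)) ≡ 1
            one = cong₂ ℕ._+_ (cong bit (subst (λ k → σs j k ≡ true) k≡0 e)) (S-0 {m′} (λ k → cong bit (¬-not (λ e → ℕₚ.1+n≢0 (neg-colour (suc k) e q)))))
            by-colour : Plus i ⊎ Minus i → bit (fP j) ℕ.+ bit (fM j) ≡ 1
            by-colour (inj₁ p) = cong₂ (λ a b → bit a ℕ.+ bit b) (dec-true (plus? j) ((k , e) , i , p , q)) (dec-false (minus? j) (λ (_ , i′ , m′ , q′) → Plus-Minus (neg-simp-uniq q q′) p m′))
            by-colour (inj₂ mi) = cong₂ (λ a b → bit a ℕ.+ bit b) (dec-false (plus? j) (λ (_ , i′ , p′ , q′) → Plus-Minus (neg-simp-uniq q′ q) p′ mi)) (dec-true (minus? j) ((k , e) , i , mi , q))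

      length-if : ∀ b (w : Word) → length (if b then w else []) ≡ (if b then length w else 0)
      length-if true w = refl
      length-if false w = refl
      no-last : ∀ t (q : Fin t) → (toℕ (Fin.inject₁ q) ℕ.≡ᵇ t) ≡ false
      no-last t q = ¬-not (λ e → ℕₚ.<-irrefl (trans (sym (Finₚ.toℕ-inject₁ q)) (≡ᵇ-true _ _ e)) (Finₚ.toℕ<n q))

    length-tuple : sumℕ (λ p → length (T′ p)) ≡ card σs
    length-tuple = begin
      sumℕ (λ p → length (T′ p)) ≡⟨ S-cong length-T ⟩
      sumℕ (λ p → lP p ℕ.+ (lC p ℕ.+ lM p)) ≡⟨ trans (S-+ lP (λ p → lC p ℕ.+ lM p)) (cong (sumℕ lP ℕ.+_) (S-+ lC lM)) ⟩
      sumℕ lP ℕ.+ (sumℕ lC ℕ.+ sumℕ lM) ≡⟨ cong₂ (λ a b → a ℕ.+ (sumℕ lC ℕ.+ b)) sum-lP sum-lM ⟩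
      length wP ℕ.+ (sumℕ lC ℕ.+ length wM) ≡⟨ cong₂ (λ a b → a ℕ.+ (sumℕ lC ℕ.+ b)) length-P length-M ⟩
      sumℕ (λ j → bit (fP j)) ℕ.+ (sumℕ lC ℕ.+ sumℕ (λ j → bit (fM j))) ≡⟨ cong (λ x → sumℕ (λ j → bit (fP j)) ℕ.+ (x ℕ.+ sumℕ (λ j → bit (fM j)))) sum-lC ⟩
      sumℕ (λ j → bit (fP j)) ℕ.+ (sumℕ (λ j → sumℕ (λ k → bit (fC k j))) ℕ.+ sumℕ (λ j → bit (fM j)))
        ≡⟨ sym (trans (S-+ (λ j → bit (fP j)) _) (cong (sumℕ (λ j → bit (fP j)) ℕ.+_) (S-+ (λ j → sumℕ (λ k → bit (fC k j))) (λ j → bit (fM j))))) ⟩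
      sumℕ (λ j → bit (fP j) ℕ.+ (sumℕ (λ k → bit (fC k j)) ℕ.+ bit (fM j))) ≡⟨ S-cong (λ j → sym (column j)) ⟩
      card σs ∎
      where
      open ≡.≡-Reasoning
      lP lC lM : Fin m → ℕ
      lP p = if bP p then length wP else 0
      lC p = length (wc (Fin.opposite p))
      lM p = if bM p then length wM else 0
      length-T : ∀ p → length (T′ p) ≡ lP p ℕ.+ (lC p ℕ.+ lM p)
      length-T p = trans (Listₚ.length-++ wp {wc (Fin.opposite p) ++ wm}) (cong₂ ℕ._+_ (length-if (bP p) wP)
          (trans (Listₚ.length-++ (wc (Fin.opposite p)) {wm}) (cong (lC p ℕ.+_) (length-if (bM p) wM))))
        where
        wp = if bP p then wP else []
        wm = if bM p then wM else []
      sum-lP : sumℕ lP ≡ length wP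
      sum-lP = trans (cong (length wP ℕ.+_) (S-0 {m′} (λ _ → refl))) (ℕₚ.+-identityʳ _)
      sum-lM : sumℕ lM ≡ length wM
      sum-lM = trans (S-snoc m′ lM) (cong₂ ℕ._+_ (S-0 {m′} (λ q → cong (λ b → if b then length wM else 0) (no-last m′ q))) (cong (λ b → if b then length wM else 0) bM-last))
      sum-lC : sumℕ lC ≡ sumℕ (λ j → sumℕ (λ k → bit (fC k j)))
      sum-lC = trans (S-opposite m (λ k → length (wc k))) (trans (S-cong length-C) (S-swap (λ k j → bit (fC k j))))

    length-product : length (prodW T′) ≡ card σs
    length-product = trans (length-prodW T′ m) length-tuple

    face⇒noncrossing : Face σs → InNCmRank T′ (card σs)
    face⇒noncrossing face = (λ p → exceptional-InNC (T′ p) (prodW-inner T′ ex p)) , exceptional-AbsLe (prodW T′) ex , (λ p → length (T′ p)) ,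
        (λ p → exceptional-HasLT (T′ p) (prodW-inner T′ ex p)) , subst (HasLT (prodW T′)) (length-prodW T′ m) (exceptional-HasLT (prodW T′) ex) , length-tuple
      where
      ex : AllPairs Z (prodW T′)
      ex = Pairwise⇒ (Face⇒Pairwise face)

    -- The rank |σ| is the number of letters of the concatenated word, so that word is reduced;
    -- lying below γ, it has χ = 0 on all ordered pairs of letters.
    noncrossing⇒face : InNCmRank T′ (card σs) → Face σs
    noncrossing⇒face (_ , le , ℓ , _ , lt , rank) = pairs⇒Face (AbsLe⇒exceptional (prodW T′) (subst (HasLT (prodW T′)) (trans rank (sym length-product)) lt) le)

theorem1p1 : (F : OrderedField) (n : ℕ) (D : BipRootSystem F n) →
    let open WithRS F n D in
    (m : ℕ) → 1 ≤ m →
    let open Colored m in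
    let open ColoredNC m in
    (σs : CSubset) → InΦm σs →
    (wP wM : Word) (wc : Fin m → Word) →
    IsWτ (plusPart σs) wP → IsWτ (minusPart σs) wM →
    (∀ k → IsWτ (colorPart σs k) (wc k)) →
    (Face σs ⇔ InNCmRank (tuple wP wM wc) (card σs))
theorem1p1 F n D (suc m) _ σs inΦ wP wM wc hP hM hC = mk⇔ face⇒noncrossing noncrossing⇒face
  where
  open Assembly F n D
  open WithTuple m σs inΦ wP wM wc hP hM hC
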